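{- There is a universal constant $C'>0$ such that the following holds. Let $p=0.5$, $\gamma>100\sqrt{\log n/n}$, and $c>0$ with $c\gamma<0.25$. There exists an adversary (corrupting at most $\gamma n$ nodes) such that, with probability at least $0.99$, the prune-then-median estimate that deletes $c\gamma n$ highest-degree and $c\gamma n$ lowest-degree nodes satisfies $|\hat p(\mathcal{A}(G))-p|\ge C'\gamma$, and the corresponding prune-then-mean estimate satisfies $|\hat p(\mathcal{A}(G))-p|\ge C'\gamma^2$, where $G\sim G(n,p)$.
   Context: $G(n,p)$ is the distribution over undirected graphs on $[n]$ with each edge present independently with probability $p$. An adversary chooses $B\subseteq[n]$ with $|B|\le\gamma n$ and may arbitrarily change the status of any edge with at least one endpoint in $B$, producing $\mathcal{A}(G)$. The prune-then-mean/median algorithm: remove the $c\gamma n$ nodes of largest degree and the $c\gamma n$ nodes of smallest degree (degrees in $\mathcal{A}(G)$); on the remaining induced graph $H$ with $m=(1-2c\gamma)n$ nodes output either $(\text{number of edges of }H)/\binom m2$ (mean) or $\mathrm{Median}\{\deg_H(v)\}/(m-1)$ (median).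
   Formalization: The quantities γ and c are taken rational instead of real, and γ ≤ 1 is stated explicitly since γ is a fraction of the nodes; cγn is rounded down and degree ties are broken by vertex index. -}

module Defs where

open import Data.Bool using (Bool; true; false; _∧_; _∨_; if_then_else_)
open import Data.Nat as ℕ using (ℕ; zero; suc; _∸_; _≤ᵇ_)
import Data.Nat.Properties as ℕP
open import Data.Integer as ℤ using (ℤ; +_)
open import Data.Fin using (Fin; toℕ)
open import Data.List using (List; []; _∷_; length; filter; map; concatMap; allFin)
open import Data.Vec.Functional using (Vector) renaming (_∷_ to _∷ᶠ_)
open import Data.Rational as ℚ using (ℚ; _/_; _*_; _+_; _-_; ∣_∣; floor)
open import Relation.Binary.PropositionalEquality using (_≡_)
open import Data.Product using (∃)
open import Relation.Nullary.Decidable using (does)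
import Data.List.Sort

ℕtoℚ : ℕ → ℚ
ℕtoℚ k = (+ k) / 1

-- x / d with the convention x / 0 = 0 (only used for degenerate graph sizes)
divℕ : ℚ → ℕ → ℚ
divℕ x zero    = ℚ.0ℚ
divℕ x (suc d) = x * ((+ 1) / suc d)

infix 4 _<ᵇ_
_<ᵇ_ : ℕ → ℕ → Bool
m <ᵇ n = suc m ≤ᵇ n

-- Natural logarithm, via the exponential series.
-- For x ≥ 0 the partial sums of Σ x^k/k! increase to exp x, hence
--   ln n < x  ⟺  n < exp x  ⟺  ∃ K. n < Σ_{k ≤ K} x^k / k!

expTerm : ℚ → ℕ → ℚ
expTerm x zero    = ℚ.1ℚ
expTerm x (suc k) = expTerm x k * x * ((+ 1) / suc k)

expPartial : ℚ → ℕ → ℚ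
expPartial x zero    = ℚ.1ℚ
expPartial x (suc K) = expPartial x K + expTerm x (suc K)

-- LnLt n x  :  ln n < x   (x ≥ 0, n ≥ 1)
LnLt : ℕ → ℚ → Set
LnLt n x = ∃ λ K → ℕtoℚ n ℚ.< expPartial x K

countF : ∀ {k} → (Fin k → Bool) → ℕ
countF {zero}  f = 0
countF {suc k} f = (if f Fin.zero then 1 else 0) ℕ.+ countF (λ i → f (Fin.suc i))
  where import Data.Fin as Fin

sumF : ∀ {k} → (Fin k → ℕ) → ℕ
sumF {zero}  f = 0
sumF {suc k} f = f Fin.zero ℕ.+ sumF (λ i → f (Fin.suc i))
  where import Data.Fin as Fin

-- Graphs on [n] and the uniform distribution G(n,1/2).
-- A graph is encoded by a Boolean matrix u; only the entries u i j with
-- i < j matter: the adjacency relation is the symmetric, loopless graph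
-- adj u.  Every graph on [n] arises from exactly 2^(n*n - n(n-1)/2)
-- matrices, so the uniform distribution on matrices pushes forward to
-- G(n,1/2).

Mat : ℕ → Set
Mat n = Fin n → Fin n → Bool

adj : ∀ {n} → Mat n → Fin n → Fin n → Bool
adj u i j =
  if toℕ i <ᵇ toℕ j then u i j
  else if toℕ j <ᵇ toℕ i then u j i
  else false

allFuns : ∀ {A : Set} → List A → (k : ℕ) → List (Fin k → A)
allFuns xs zero    = (λ ()) ∷ []
allFuns xs (suc k) = concatMap (λ f → map (λ a → a ∷ᶠ f) xs) (allFuns xs k)

allMats : (n : ℕ) → List (Mat n)
allMats n = allFuns (allFuns (true ∷ false ∷ []) n) n

countMats : (n : ℕ) → (Mat n → Bool) → ℕ
countMats n P = length (filter (λ u → P u Data.Bool.≟ true) (allMats n))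
  where import Data.Bool

ProbAtLeast : (n : ℕ) → (Mat n → Bool) → ℕ → ℕ → Set
ProbAtLeast n P a b = a ℕ.* length (allMats n) ℕ.≤ b ℕ.* countMats n P

record Adversary (n : ℕ) (γ : ℚ) : Set where
  field
    corrupt : Mat n → Fin n → Bool
    attack  : Mat n → Mat n
    budget  : ∀ u → ℕtoℚ (countF (corrupt u)) ℚ.≤ γ * ℕtoℚ n
    local   : ∀ u i j → corrupt u i ≡ false → corrupt u j ≡ false →
              adj (attack u) i j ≡ adj u i j

-- Prune-then-mean / prune-then-median estimators on a graph g on [n]
-- (given as a symmetric loopless adjacency function).

module _ {n : ℕ} (g : Fin n → Fin n → Bool) where

  deg : Fin n → ℕ
  deg v = countF (g v)

  before : Fin n → Fin n → Bool
  before w v = (deg w <ᵇ deg v) ∨ ((deg w ≤ᵇ deg v) ∧ (toℕ w <ᵇ toℕ v))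

  rank : Fin n → ℕ
  rank v = countF (λ w → before w v)

  kept : ℕ → Fin n → Bool
  kept k v = (k ≤ᵇ rank v) ∧ (rank v <ᵇ (n ∸ k))

  degH : ℕ → Fin n → ℕ
  degH k v = countF (λ w → kept k w ∧ g v w)

  sizeH : ℕ → ℕ
  sizeH k = countF (kept k)

  edgesH : ℕ → ℕ
  edgesH k = sumF (λ i → countF (λ j → kept k i ∧ kept k j ∧ (toℕ i <ᵇ toℕ j) ∧ g i j))

  degreesH : ℕ → List ℕ
  degreesH k = map (degH k) (filter (λ v → kept k v Data.Bool.≟ true) (allFin n))
    where import Data.Bool

-- median of a list of naturals: middle element of the sorted list if the
-- length is odd, average of the two middle elements if it is even
-- (0 for the empty list)
nth : List ℕ → ℕ → ℕ
nth []       _       = 0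
nth (x ∷ xs) zero    = x
nth (x ∷ xs) (suc i) = nth xs i

open Data.List.Sort ℕP.≤-decTotalOrder using (sort)

median : List ℕ → ℚ
median xs with length xs ℕ.% 2
... | zero  = divℕ (ℕtoℚ (nth (sort xs) (length xs ℕ./ 2 ∸ 1)) + ℕtoℚ (nth (sort xs) (length xs ℕ./ 2))) 2
... | suc _ = ℕtoℚ (nth (sort xs) (length xs ℕ./ 2))

pruneCount : (n : ℕ) → (c γ : ℚ) → ℕ
pruneCount n c γ = ℤ.∣ floor (c * γ * ℕtoℚ n) ∣

meanEst : ∀ {n} → (Fin n → Fin n → Bool) → ℕ → ℚ
meanEst g k = divℕ (ℕtoℚ (edgesH g k)) ((sizeH g k ℕ.* (sizeH g k ∸ 1)) ℕ./ 2)

medianEst : ∀ {n} → (Fin n → Fin n → Bool) → ℕ → ℚ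
medianEst g k = divℕ (median (degreesH g k)) (sizeH g k ∸ 1)

_≤Q_ : ℚ → ℚ → Bool
a ≤Q b = a ℚ.≤ᵇ b

{-# OPTIONS --safe #-}
module Submission where

-- A successful attack exists on every graph, so the randomness of G plays no
-- role, and the bound on log n is only used to get γ² n > 5000.  Let b = 48 r
-- ≤ γ n vertices be corrupted, and order the others by their degree outside
-- the corrupted set into the k lowest, the k highest and the middle ones.
-- If some lowest vertex has a very large degree, or some highest vertex a very
-- small one, then all but k vertices do, and making the corrupted vertices
-- complete, respectively isolated, puts all kept degrees on one side.
-- Otherwise give every lowest vertex z, every middle vertex about z + 6 r and
-- every highest vertex z + 12 r corrupted neighbours, balanced among the
-- corrupted vertices.  For a suitable z the corrupted degrees lie strictly
-- between those of the lowest and highest vertices, so exactly these are pruned.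
--
-- Median: replacing z + 6 r by z + 7 r on slightly more than half of the kept
-- vertices and by z + 5 r on the middle vertices of smallest degree keeps the
-- same vertices and lifts both middle order statistics by r; one of the two
-- medians is far from 1/2.  Mean: a clique on r corrupted vertices does not
-- affect what is kept but adds r (r - 1) / 2 edges; with or without it, the
-- mean is far from 1/2.
open import Defs

-- For an arbitrary graph nothing tells on which side of 1/2 an estimate lies before the attack.
-- Each deviation is therefore obtained from two attacks with the same kept set whose estimates
-- differ by a known amount: at least one of them misses 1/2. A single attack has to spoil both
-- estimates, so there are four variants, with or without the raise and with or without the clique;
-- the median selects the raise, and then the mean selects the clique.
--
-- The factor 48 comes from the threshold `θ` between the outer degrees of the lowest and of the
-- highest vertices. The extreme cases force `θ` into the range from A/8 to 7A/8, where
-- `A = n - 2b`, so that `y`, about `θ * b / A`, lies between b/8 and 7b/8. For `b = 48 * r` these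
-- are 6r and 42r, hence `y - 6r` and `y + 6r` are possible numbers of corrupted neighbours. The
-- margin of 6r on either side of the corrupted degrees pays for rounding, for the surplus of about
-- 3r caused by the raise and for clique degrees below r.

module Pruning where

  open import Data.Bool using (Bool; true; false; _∧_; _∨_; not; if_then_else_)
  import Data.Bool as Bool
  import Data.Bool.Properties as Boolₚ
  open import Data.Empty using (⊥; ⊥-elim)
  open import Data.Fin as Fin using (Fin; toℕ)
  import Data.Fin.Properties as Finₚ
  import Data.Integer as ℤ
  import Data.Integer.Properties as ℤₚ
  open import Data.List using (List; []; _∷_; length; map; filter; tabulate)
  open import Data.List.Properties using (filter-all)
  import Data.List.Relation.Unary.All as All
  open import Data.List.Relation.Binary.Permutation.Propositional as Perm using (_↭_)
  open import Data.List.Relation.Binary.Permutation.Propositional.Properties using (↭-length)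
  import Data.List.Relation.Unary.Linked as Linked
  open import Data.Nat hiding (_/_; _%_; _<ᵇ_)
  open import Data.Nat.Divisibility using (divides-refl)
  open import Data.Nat.DivMod
    using (_/_; _%_; m≡m%n+[m/n]*n; m%n<n; m/n*n≤m; [m+kn]%n≡m%n; +-distrib-/-∣ʳ; m*n/n≡m)
  open import Data.Nat.Properties
  open import Data.Nat.Tactic.RingSolver using (solve; solve-∀)
  open import Data.List.Relation.Unary.Sorted.TotalOrder ≤-totalOrder using (Sorted)
  open import Data.List.Sort ≤-decTotalOrder using (sort; sort-↭; sort-↗)
  open import Data.Product using (∃; ∃-syntax; _×_; _,_; proj₁; proj₂)
  open import Data.Rational as ℚ using (ℚ; mkℚ; 0ℚ; 1ℚ; ½; toℚᵘ)
  import Data.Rational.Properties as ℚₚ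
  open import Data.Rational.Solver using (module +-*-Solver)
  import Data.Rational.Unnormalised as ℚᵘ
  open ℚᵘ using (mkℚᵘ; *≡*; *≤*; *<*)
  import Data.Rational.Unnormalised.Properties as ℚᵘₚ
  open import Data.Sum using (_⊎_; inj₁; inj₂)
  open import Function using (_∘_; id; Equivalence)
  open import Relation.Binary.Definitions using (tri<; tri≈; tri>)
  open import Relation.Binary.PropositionalEquality
  open import Relation.Nullary using (¬_; yes; no; does)

  private
    variable
      n p : ℕ

  -- A certificate for linear arithmetic: L ≤ R is a combination of hypotheses,
  -- and the identity is left to the ring solver.
  linear : ∀ {a b L R} e → L ≤ R → a + R + e ≡ b + L → a ≤ b
  linear {a} {b} {L} {R} e L≤R eq = +-cancelʳ-≤ L a b (begin
    a + L      ≤⟨ +-monoʳ-≤ a L≤R ⟩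
    a + R      ≤⟨ m≤m+n (a + R) e ⟩
    a + R + e  ≡⟨ eq ⟩
    b + L      ∎)
    where open ≤-Reasoning

  -- The type of *-monoʳ-≤ contains a section, which the ring solver cannot read.
  scale : ∀ c {a b} → a ≤ b → c * a ≤ c * b
  scale c = *-monoʳ-≤ c

  false≢true : false ≡ true → ⊥
  false≢true ()

  ind : Bool → ℕ
  ind p = if p then 1 else 0

  -- Finite sums and cardinalities

  sumF-cong : {f g : Fin n → ℕ} → (∀ i → f i ≡ g i) → sumF f ≡ sumF g
  sumF-cong {zero}  e = refl
  sumF-cong {suc n} e = cong₂ _+_ (e Fin.zero) (sumF-cong (e ∘ Fin.suc))

  sumF-mono : {f g : Fin n → ℕ} → (∀ i → f i ≤ g i) → sumF f ≤ sumF g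
  sumF-mono {zero}  e = z≤n
  sumF-mono {suc n} e = +-mono-≤ (e Fin.zero) (sumF-mono (e ∘ Fin.suc))

  sumF-+ : (f g : Fin n → ℕ) → sumF (λ i → f i + g i) ≡ sumF f + sumF g
  sumF-+ {zero}  f g = refl
  sumF-+ {suc n} f g rewrite sumF-+ (f ∘ Fin.suc) (g ∘ Fin.suc) =
    interchange (f Fin.zero) (g Fin.zero) (sumF (f ∘ Fin.suc)) (sumF (g ∘ Fin.suc))
    where
    interchange : ∀ a b c d → a + b + (c + d) ≡ a + c + (b + d)
    interchange = solve-∀

  sumF-*ʳ : (f : Fin n → ℕ) (c : ℕ) → sumF (λ i → f i * c) ≡ sumF f * c
  sumF-*ʳ {zero}  f c = refl
  sumF-*ʳ {suc n} f c rewrite sumF-*ʳ (f ∘ Fin.suc) c =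
    sym (*-distribʳ-+ c (f Fin.zero) (sumF (f ∘ Fin.suc)))

  sumF-0 : (n : ℕ) → sumF {n} (λ _ → 0) ≡ 0
  sumF-0 zero    = refl
  sumF-0 (suc n) = sumF-0 n

  sumF-swap : (h : Fin n → Fin p → ℕ) →
              sumF (λ i → sumF (λ j → h i j)) ≡ sumF (λ j → sumF (λ i → h i j))
  sumF-swap {zero}  {p} h = sym (sumF-0 p)
  sumF-swap {suc n} {p} h rewrite sumF-swap (h ∘ Fin.suc) =
    sym (sumF-+ (h Fin.zero) (λ j → sumF (λ i → h (Fin.suc i) j)))

  countF≡sumF : (P : Fin n → Bool) → countF P ≡ sumF (ind ∘ P)
  countF≡sumF {zero}  P = refl
  countF≡sumF {suc n} P = cong (ind (P Fin.zero) +_) (countF≡sumF (P ∘ Fin.suc))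

  countF-cong : {P Q : Fin n → Bool} → (∀ i → P i ≡ Q i) → countF P ≡ countF Q
  countF-cong {zero}  e = refl
  countF-cong {suc n} e = cong₂ _+_ (cong ind (e Fin.zero)) (countF-cong (e ∘ Fin.suc))

  ind-mono : ∀ {x y} → (x ≡ true → y ≡ true) → ind x ≤ ind y
  ind-mono {false} h = z≤n
  ind-mono {true} {true}  h = ≤-refl
  ind-mono {true} {false} h with () ← h refl

  countF-mono : {P Q : Fin n → Bool} → (∀ i → P i ≡ true → Q i ≡ true) → countF P ≤ countF Q
  countF-mono {zero}  h = z≤n
  countF-mono {suc n} h = +-mono-≤ (ind-mono (h Fin.zero)) (countF-mono (h ∘ Fin.suc))

  countF-mono-< : {P Q : Fin n → Bool} → (∀ i → P i ≡ true → Q i ≡ true) →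
                  ∀ i → P i ≡ false → Q i ≡ true → countF P < countF Q
  countF-mono-< h Fin.zero    ¬pi qi rewrite ¬pi | qi = s≤s (countF-mono (h ∘ Fin.suc))
  countF-mono-< {Q = Q} h (Fin.suc i) ¬pi qi =
    ≤-trans (≤-reflexive (sym (+-suc _ _)))
      (+-mono-≤ (ind-mono (h Fin.zero)) (countF-mono-< (h ∘ Fin.suc) i ¬pi qi))

  countF-∪ : {P Q R : Fin n → Bool} → (∀ i → ind (R i) ≡ ind (P i) + ind (Q i)) → countF R ≡ countF P + countF Q
  countF-∪ {P = P} {Q = Q} {R = R} h = begin
    countF R                                ≡⟨ countF≡sumF R ⟩
    sumF (ind ∘ R)                          ≡⟨ sumF-cong h ⟩
    sumF (λ i → ind (P i) + ind (Q i))      ≡⟨ sumF-+ (ind ∘ P) (ind ∘ Q) ⟩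
    sumF (ind ∘ P) + sumF (ind ∘ Q)         ≡⟨ cong₂ _+_ (countF≡sumF P) (countF≡sumF Q) ⟨
    countF P + countF Q                     ∎
    where open ≡-Reasoning

  countF-none : {P : Fin n → Bool} → (∀ i → P i ≡ false) → countF P ≡ 0
  countF-none {zero}  h = refl
  countF-none {suc n} h rewrite h Fin.zero = countF-none (h ∘ Fin.suc)

  countF-all : {P : Fin n → Bool} → (∀ i → P i ≡ true) → countF {n} P ≡ n
  countF-all {zero}  h = refl
  countF-all {suc n} h rewrite h Fin.zero = cong suc (countF-all (h ∘ Fin.suc))

  countF-not : (P : Fin n → Bool) → countF P + countF (not ∘ P) ≡ n
  countF-not {zero}  P = refl
  countF-not {suc n} P with P Fin.zero
  ... | true  = cong suc (countF-not (P ∘ Fin.suc))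
  ... | false = trans (+-suc _ _) (cong suc (countF-not (P ∘ Fin.suc)))

  countF≡0⇒none : {P : Fin n → Bool} → countF P ≡ 0 → ∀ i → P i ≡ false
  countF≡0⇒none {P = P} e i with P i in eq
  ... | false = refl
  ... | true  = ⊥-elim (<⇒≱ (countF-mono-< {P = λ _ → false} {Q = P} (λ _ ()) i refl eq)
                            (≤-trans (≤-reflexive e) z≤n))

  _==_ : Fin n → Fin n → Bool
  i == j = does (i Finₚ.≟ j)

  ==-refl : (i : Fin n) → (i == i) ≡ true
  ==-refl i with i Finₚ.≟ i
  ... | yes _ = refl
  ... | no i≢i = ⊥-elim (i≢i refl)

  ==-sound : (i j : Fin n) → (i == j) ≡ true → i ≡ j
  ==-sound i j e with i Finₚ.≟ j
  ==-sound i j e | yes eq = eq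
  ==-sound i j () | no _

  ==-sym : (i j : Fin n) → (i == j) ≡ (j == i)
  ==-sym i j with i Finₚ.≟ j | j Finₚ.≟ i
  ... | yes _ | yes _ = refl
  ... | no _  | no _  = refl
  ... | yes e | no ¬e = ⊥-elim (¬e (sym e))
  ... | no ¬e | yes e = ⊥-elim (¬e (sym e))

  countF-== : (i : Fin n) → countF (i ==_) ≡ 1
  countF-== {suc n} Fin.zero    = cong suc (countF-none {n} {P = λ j → Fin.zero == Fin.suc j} (λ _ → refl))
  countF-== {suc n} (Fin.suc i) = countF-== i

  -- Selecting the k smallest elements of a set

  -- Called with a constant key, this is a search that either finds an element of `X` or shows that
  -- `X` is empty.
  argmin : (key : Fin n → ℕ) (X : Fin n → Bool) →
           (∀ i → X i ≡ false) ⊎ (∃[ i ] X i ≡ true × (∀ j → X j ≡ true → key i ≤ key j))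
  argmin {zero}  key X = inj₁ (λ ())
  argmin {suc n} key X with argmin (key ∘ Fin.suc) (X ∘ Fin.suc) | X Fin.zero in eq
  ... | inj₁ none | false = inj₁ (λ { Fin.zero → eq ; (Fin.suc i) → none i })
  ... | inj₁ none | true  = inj₂ (Fin.zero , eq , λ
    { Fin.zero _ → ≤-refl
    ; (Fin.suc j) xj → ⊥-elim (false≢true (trans (sym (none j)) xj)) })
  ... | inj₂ (i , xi , min) | false = inj₂ (Fin.suc i , xi , λ
    { Fin.zero x0 → ⊥-elim (false≢true (trans (sym eq) x0))
    ; (Fin.suc j) xj → min j xj })
  ... | inj₂ (i , xi , min) | true with ≤-total (key Fin.zero) (key (Fin.suc i))
  ... | inj₁ le = inj₂ (Fin.zero , eq , λ
    { Fin.zero _ → ≤-refl ; (Fin.suc j) xj → ≤-trans le (min j xj) })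
  ... | inj₂ ge = inj₂ (Fin.suc i , xi , λ
    { Fin.zero _ → ge ; (Fin.suc j) xj → min j xj })

  record Lowest (key : Fin n → ℕ) (X : Fin n → Bool) (k : ℕ) : Set where
    field
      set     : Fin n → Bool
      subset  : ∀ i → set i ≡ true → X i ≡ true
      size    : countF set ≡ k
      minimal : ∀ i j → set i ≡ true → X j ≡ true → set j ≡ false → key i ≤ key j

  lowest : (key : Fin n → ℕ) (X : Fin n → Bool) (k : ℕ) → k ≤ countF X → Lowest key X k
  lowest {n} key X zero _ = record
    { set = λ _ → false ; subset = λ _ () ; size = countF-none {n} {P = λ _ → false} (λ _ → refl) ; minimal = λ _ _ () }
  lowest {n} key X (suc k) k<X with lowest key X k (<⇒≤ k<X)
  ... | record { set = L ; subset = L⊆X ; size = |L| ; minimal = Lmin }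
    with argmin key (λ i → X i ∧ not (L i))
  ... | inj₁ none = ⊥-elim (<⇒≱ k<X (≤-trans (countF-mono X⊆L) (≤-reflexive |L|)))
    where
    X⊆L : ∀ i → X i ≡ true → L i ≡ true
    X⊆L i xi with X i | L i | none i
    ... | true | true | _ = refl
  ... | inj₂ (a , a∈ , amin) = record { set = L′ ; subset = sub ; size = sz ; minimal = mn }
    where
    L′ : Fin n → Bool
    L′ i = L i ∨ (a == i)
    a-props : X a ≡ true × L a ≡ false
    a-props = ∧-not (X a) (L a) a∈
      where
      ∧-not : ∀ x l → (x ∧ not l) ≡ true → x ≡ true × l ≡ false
      ∧-not true false _ = refl , refl
    sub : ∀ i → L′ i ≡ true → X i ≡ true
    sub i e with L i in eq
    ... | true  = L⊆X i eq
    ... | false = subst (λ z → X z ≡ true) (==-sound a i e) (proj₁ a-props)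
    sz : countF L′ ≡ suc k
    sz = begin
      countF L′                   ≡⟨ countF-∪ disj ⟩
      countF L + countF (a ==_)   ≡⟨ cong₂ _+_ |L| (countF-== a) ⟩
      k + 1                       ≡⟨ +-comm k 1 ⟩
      suc k                       ∎
      where
      open ≡-Reasoning
      disj : ∀ i → ind (L′ i) ≡ ind (L i) + ind (a == i)
      disj i with L i in eq | a == i in ai
      ... | false | _     = refl
      ... | true  | false = refl
      ... | true  | true  with refl ← ==-sound a i ai with () ← trans (sym eq) (proj₂ a-props)
    mn : ∀ i j → L′ i ≡ true → X j ≡ true → L′ j ≡ false → key i ≤ key j
    mn i j e xj ¬l with L j in eqj
    mn i j e xj () | true
    mn i j e xj ¬l | false with L i in eqi
    ... | true  = Lmin i j eqi xj eqj
    ... | false with refl ← ==-sound a i e = amin j (cong₂ (λ s t → s ∧ not t) xj eqj)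

  ≤ᵇ-true : ∀ {a b} → a ≤ b → (a ≤ᵇ b) ≡ true
  ≤ᵇ-true le = Boolₚ.T-≡ .Equivalence.to (≤⇒≤ᵇ le)

  ≤ᵇ-sound : ∀ {a b} → (a ≤ᵇ b) ≡ true → a ≤ b
  ≤ᵇ-sound {a} {b} e = ≤ᵇ⇒≤ a b (Boolₚ.T-≡ .Equivalence.from e)

  ≤ᵇ-false : ∀ {a b} → b < a → (a ≤ᵇ b) ≡ false
  ≤ᵇ-false {a} {b} lt with a ≤ᵇ b in e
  ... | false = refl
  ... | true  = ⊥-elim (<⇒≱ lt (≤ᵇ-sound {a} e))

  ∧-elim : ∀ {x y} → (x ∧ y) ≡ true → x ≡ true × y ≡ true
  ∧-elim {true} {true} _ = refl , refl

  -- Bipartite graphs with prescribed row degrees and balanced columns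

  record Design (B : Fin n → Bool) (X : Fin p → ℕ) : Set where
    field
      edge     : Fin p → Fin n → Bool
      row      : ∀ v → countF (edge v) ≡ X v
      inside   : ∀ v w → edge v w ≡ true → B w ≡ true
    col : Fin n → ℕ
    col w = countF (λ v → edge v w)
    field
      balanced : ∀ w w′ → B w ≡ true → B w′ ≡ true → col w ≤ suc (col w′)

  -- Each new row uses the columns which are lowest so far.
  design : (B : Fin n → Bool) (X : Fin p → ℕ) → (∀ v → X v ≤ countF B) → Design B X
  design {p = zero} B X X≤ = record
    { edge = λ () ; row = λ () ; inside = λ () ; balanced = λ _ _ _ _ → z≤n }
  design {n} {suc p} B X X≤ = record
    { edge = edge ; row = row ; inside = inside ; balanced = balanced }
    where
    module D = Design (design B (X ∘ Fin.suc) (X≤ ∘ Fin.suc))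
    module L = Lowest (lowest D.col B (X Fin.zero) (X≤ Fin.zero))
    edge : Fin (suc p) → Fin n → Bool
    edge Fin.zero    = L.set
    edge (Fin.suc v) = D.edge v
    row : ∀ v → countF (edge v) ≡ X v
    row Fin.zero    = L.size
    row (Fin.suc v) = D.row v
    inside : ∀ v w → edge v w ≡ true → B w ≡ true
    inside Fin.zero    = L.subset
    inside (Fin.suc v) = D.inside v
    balanced : ∀ w w′ → B w ≡ true → B w′ ≡ true →
               ind (L.set w) + D.col w ≤ suc (ind (L.set w′) + D.col w′)
    balanced w w′ w∈ w′∈ with L.set w in e | L.set w′ in e′
    ... | true  | true  = s≤s (D.balanced w w′ w∈ w′∈)
    -- `w` was chosen and `w′` was not, so `w` had the smaller or an equal column. In the other
    -- cases the excess of `w` over `w′` does not grow.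
    ... | true  | false = s≤s (L.minimal w w′ e w′∈ e′)
    ... | false | true  = m≤n⇒m≤1+n (D.balanced w w′ w∈ w′∈)
    ... | false | false = D.balanced w w′ w∈ w′∈

  module _ {B : Fin n → Bool} {X : Fin p → ℕ} (D : Design B X) where
    open Design D

    sum-col : sumF col ≡ sumF X
    sum-col = begin
      sumF col                                     ≡⟨ sumF-cong (λ w → countF≡sumF (λ v → edge v w)) ⟩
      sumF (λ w → sumF (λ v → ind (edge v w)))     ≡⟨ sumF-swap (λ w v → ind (edge v w)) ⟩
      sumF (λ v → sumF (λ w → ind (edge v w)))     ≡⟨ sumF-cong (λ v → countF≡sumF (edge v)) ⟨
      sumF (λ v → countF (edge v))                 ≡⟨ sumF-cong row ⟩
      sumF X                                       ∎
      where open ≡-Reasoning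

    private
      b*_ : (c : ℕ) → countF B * c ≡ sumF (λ w → ind (B w) * c)
      b* c = trans (cong (_* c) (countF≡sumF B)) (sym (sumF-*ʳ (ind ∘ B) c))

    -- Averaging: by balance every column in `B` is at least `col w - 1`, and together these columns
    -- hold at most all `sumF X` edges.
    col-upper : ∀ w → B w ≡ true → countF B * col w ≤ sumF X + countF B
    col-upper w w∈ = begin
      countF B * col w                        ≡⟨ b* (col w) ⟩
      sumF (λ w′ → ind (B w′) * col w)        ≤⟨ sumF-mono bound ⟩
      sumF (λ w′ → col w′ + ind (B w′))       ≡⟨ sumF-+ col (ind ∘ B) ⟩
      sumF col + sumF (ind ∘ B)               ≡⟨ cong₂ _+_ sum-col (sym (countF≡sumF B)) ⟩
      sumF X + countF B                       ∎
      where
      open ≤-Reasoning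
      bound : ∀ w′ → ind (B w′) * col w ≤ col w′ + ind (B w′)
      bound w′ with B w′ in e
      ... | false = z≤n
      ... | true  = ≤-trans (≤-reflexive (*-identityˡ (col w)))
                     (≤-trans (balanced w w′ w∈ e) (≤-reflexive (+-comm 1 (col w′))))

    -- This direction of the average also needs the columns outside `B` to be empty, which `inside`
    -- guarantees.
    col-lower : ∀ w → B w ≡ true → sumF X ≤ countF B * col w + countF B
    col-lower w w∈ = begin
      sumF X                                  ≡⟨ sum-col ⟨
      sumF col                                ≤⟨ sumF-mono bound ⟩
      sumF (λ w′ → ind (B w′) * suc (col w))  ≡⟨ b* (suc (col w)) ⟨
      countF B * suc (col w)                  ≡⟨ *-suc (countF B) (col w) ⟩
      countF B + countF B * col w             ≡⟨ +-comm (countF B) _ ⟩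
      countF B * col w + countF B             ∎
      where
      open ≤-Reasoning
      bound : ∀ w′ → col w′ ≤ ind (B w′) * suc (col w)
      bound w′ with B w′ in e
      ... | true  = ≤-trans (balanced w′ w e w∈) (≤-reflexive (sym (*-identityˡ _)))
      ... | false = ≤-reflexive (countF-none no-edge)
        where
        no-edge : ∀ v → edge v w′ ≡ false
        no-edge v with edge v w′ in e′
        ... | false = refl
        ... | true  = ⊥-elim (false≢true (trans (sym e) (inside v w′ e′)))

  -- Order statistics

  -- Counts are invariant under permutation, so they carry order statistics from the sorted list
  -- back to the vertices: in a sorted list, `t` is at most the entry at index `j` exactly when at
  -- most `j` entries lie below `t`.
  cnt : ℕ → List ℕ → ℕ
  cnt t []       = 0
  cnt t (x ∷ xs) = ind (x <ᵇ t) + cnt t xs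

  cnt-↭ : ∀ t {xs ys} → xs ↭ ys → cnt t xs ≡ cnt t ys
  cnt-↭ t Perm.refl = refl
  cnt-↭ t (Perm.prep x xs↭ys) = cong (ind (x <ᵇ t) +_) (cnt-↭ t xs↭ys)
  cnt-↭ t (Perm.swap x y xs↭ys) rewrite cnt-↭ t xs↭ys =
    exchange (ind (x <ᵇ t)) (ind (y <ᵇ t)) _
    where
    exchange : ∀ a b c → a + (b + c) ≡ b + (a + c)
    exchange = solve-∀
  cnt-↭ t (Perm.trans p q) = trans (cnt-↭ t p) (cnt-↭ t q)

  head≤nth : ∀ {x xs} → Sorted (x ∷ xs) → ∀ j → j < length (x ∷ xs) → x ≤ nth (x ∷ xs) j
  head≤nth s zero _ = ≤-refl
  head≤nth (x≤y Linked.∷ s) (suc j) (s≤s j<) = ≤-trans x≤y (head≤nth s j j<)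

  cnt-head : ∀ {x xs t} → Sorted (x ∷ xs) → t ≤ x → cnt t (x ∷ xs) ≡ 0
  cnt-head {x} {t = t} Linked.[-] t≤x rewrite ≤ᵇ-false {suc x} {t} (s≤s t≤x) = refl
  cnt-head {x} {t = t} (x≤y Linked.∷ s) t≤x rewrite ≤ᵇ-false {suc x} {t} (s≤s t≤x) =
    cnt-head s (≤-trans t≤x x≤y)

  cnt≤⇒≤nth : ∀ {t xs} → Sorted xs → ∀ j → j < length xs → cnt t xs ≤ j → t ≤ nth xs j
  cnt≤⇒≤nth {t} {x ∷ xs} s j j< c with t ≤? x
  ... | yes t≤x = ≤-trans t≤x (head≤nth s j j<)
  ... | no t≰x rewrite ≤ᵇ-true {suc x} {t} (≰⇒> t≰x) with j | j< | c
  ... | suc j′ | s≤s j′< | s≤s c′ = cnt≤⇒≤nth (Linked.tail s) j′ j′< c′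

  ≤nth⇒cnt≤ : ∀ {t xs} → Sorted xs → ∀ j → j < length xs → t ≤ nth xs j → cnt t xs ≤ j
  ≤nth⇒cnt≤ {t} {x ∷ xs} s zero j< t≤ = ≤-reflexive (cnt-head s t≤)
  ≤nth⇒cnt≤ {t} {x ∷ xs} s (suc j) (s≤s j<) t≤ =
    +-mono-≤ (ind≤1 (x <ᵇ t)) (≤nth⇒cnt≤ (Linked.tail s) j j< t≤)
    where
    ind≤1 : ∀ b → ind b ≤ 1
    ind≤1 true  = ≤-refl
    ind≤1 false = z≤n

  module _ (P : Fin n → Bool) where

    private
      members : List (Fin n) → List (Fin n)
      members = filter (λ v → P v Bool.≟ true)

    cnt-filter : ∀ t (f : Fin n → ℕ) (h : Fin p → Fin n) →
                 cnt t (map f (members (tabulate h))) ≡ countF (λ i → P (h i) ∧ (f (h i) <ᵇ t))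
    cnt-filter {zero}  t f h = refl
    cnt-filter {suc p} t f h with P (h Fin.zero)
    ... | true  = cong (ind (f (h Fin.zero) <ᵇ t) +_) (cnt-filter t f (h ∘ Fin.suc))
    ... | false = cnt-filter t f (h ∘ Fin.suc)

    length-filter : ∀ (f : Fin n → ℕ) (h : Fin p → Fin n) →
                    length (map f (members (tabulate h))) ≡ countF (P ∘ h)
    length-filter {zero}  f h = refl
    length-filter {suc p} f h with P (h Fin.zero)
    ... | true  = cong suc (length-filter f (h ∘ Fin.suc))
    ... | false = length-filter f (h ∘ Fin.suc)

  -- Pruning

  module _ {n : ℕ} (g : Fin n → Fin n → Bool) (k : ℕ) where

    orderStat : ℕ → ℕ
    orderStat j = nth (sort (degreesH g k)) j

    length-degrees : length (degreesH g k) ≡ sizeH g k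
    length-degrees = length-filter (kept g k) (degH g k) id

    length-sorted : length (sort (degreesH g k)) ≡ sizeH g k
    length-sorted = trans (↭-length (sort-↭ (degreesH g k))) length-degrees

    below : ℕ → ℕ
    below t = countF (λ v → kept g k v ∧ (degH g k v <ᵇ t))

    cnt-sorted : ∀ t → cnt t (sort (degreesH g k)) ≡ below t
    cnt-sorted t = trans (cnt-↭ t (sort-↭ (degreesH g k)))
                         (cnt-filter (kept g k) t (degH g k) id)

    below≤⇒≤orderStat : ∀ {t j} → j < sizeH g k → below t ≤ j → t ≤ orderStat j
    below≤⇒≤orderStat {t} {j} j< c = cnt≤⇒≤nth (sort-↗ (degreesH g k)) j
      (subst (j <_) (sym length-sorted) j<) (subst (_≤ j) (sym (cnt-sorted t)) c)

    ≤orderStat⇒below≤ : ∀ {t j} → j < sizeH g k → t ≤ orderStat j → below t ≤ j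
    ≤orderStat⇒below≤ {t} {j} j< t≤ = subst (_≤ j) (cnt-sorted t)
      (≤nth⇒cnt≤ (sort-↗ (degreesH g k)) j (subst (j <_) (sym length-sorted) j<) t≤)

    before-intro : ∀ {w v} → deg g w < deg g v ⊎ (deg g w ≤ deg g v × toℕ w < toℕ v) →
                   before g w v ≡ true
    before-intro {w} {v} (inj₁ lt) rewrite ≤ᵇ-true lt = refl
    before-intro {w} {v} (inj₂ (le , lt)) rewrite ≤ᵇ-true le | ≤ᵇ-true lt = Boolₚ.∨-zeroʳ _

    before-elim : ∀ {w v} → before g w v ≡ true →
                  deg g w < deg g v ⊎ (deg g w ≤ deg g v × toℕ w < toℕ v)
    before-elim {w} {v} e with deg g w <ᵇ deg g v in e₁
    ... | true  = inj₁ (≤ᵇ-sound e₁)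
    ... | false with ∧-elim {deg g w ≤ᵇ deg g v} e
    ... | le , lt = inj₂ (≤ᵇ-sound le , ≤ᵇ-sound lt)

    before-asym : ∀ {w v} → before g w v ≡ true → before g v w ≡ true → ⊥
    before-asym e e′ with before-elim e | before-elim e′
    ... | inj₁ a | inj₁ b = <-asym a b
    ... | inj₁ a | inj₂ (b , _) = <⇒≱ a b
    ... | inj₂ (a , _) | inj₁ b = <⇒≱ b a
    ... | inj₂ (_ , a) | inj₂ (_ , b) = <-asym a b

    before-irrefl : ∀ v → before g v v ≡ false
    before-irrefl v with before g v v in e
    ... | false = refl
    ... | true  = ⊥-elim (before-asym e e)

    -- A vertex outside `Lo` is preceded by all `k` elements of `Lo`, and a vertex of `Lo` only by
    -- other elements of `Lo`, so `rank` separates the two at `k`. The complement of `Hi`, of size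
    -- `n ∸ k`, gives the other cut in the same way.
    kept-middle : (Lo Hi : Fin n → Bool) → countF Lo ≡ k → countF Hi ≡ k →
                  (∀ l v → Lo l ≡ true → Lo v ≡ false → before g l v ≡ true) →
                  (∀ v h → Hi v ≡ false → Hi h ≡ true → before g v h ≡ true) →
                  ∀ v → kept g k v ≡ not (Lo v) ∧ not (Hi v)
    kept-middle Lo Hi |Lo| |Hi| lo-first hi-last v = cong₂ _∧_ lower upper
      where
      |¬Hi| : countF (not ∘ Hi) ≡ n ∸ k
      |¬Hi| = sym (trans (cong₂ _∸_ (sym (countF-not Hi)) (sym |Hi|)) (m+n∸m≡n (countF Hi) _))
      lower : (k ≤ᵇ rank g v) ≡ not (Lo v)
      lower with Lo v in e
      ... | false = ≤ᵇ-true (subst (_≤ rank g v) |Lo| (countF-mono (λ l l∈ → lo-first l v l∈ e)))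
      ... | true  = ≤ᵇ-false (subst (rank g v <_) |Lo|
                      (countF-mono-< ⊆Lo v (before-irrefl v) e))
        where
        ⊆Lo : ∀ w → before g w v ≡ true → Lo w ≡ true
        ⊆Lo w wv with Lo w in e′
        ... | true  = refl
        ... | false = ⊥-elim (before-asym wv (lo-first v w e e′))
      upper : (rank g v <ᵇ (n ∸ k)) ≡ not (Hi v)
      upper with Hi v in e
      ... | true  = ≤ᵇ-false (s≤s (subst (_≤ rank g v) |¬Hi|
                      (countF-mono (λ w w∉ → hi-last w v (not-true w∉) e))))
        where
        not-true : ∀ {x} → not x ≡ true → x ≡ false
        not-true {false} _ = refl
      ... | false = ≤ᵇ-true (subst (rank g v <_) |¬Hi|
                      (countF-mono-< ⊆¬Hi v (before-irrefl v) (cong not e)))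
        where
        ⊆¬Hi : ∀ w → before g w v ≡ true → not (Hi w) ≡ true
        ⊆¬Hi w wv with Hi w in e′
        ... | false = refl
        ... | true  = ⊥-elim (before-asym wv (hi-last v w e e′))

    private
      -- The order of before is lexicographic in (deg v , toℕ v).
      key : Fin n → ℕ
      key v = deg g v * n + toℕ v

      key≤⇒before : ∀ {w v} → key w ≤ key v → ¬ w ≡ v → before g w v ≡ true
      key≤⇒before {w} {v} le w≢v with <-cmp (deg g w) (deg g v)
      ... | tri< lt _ _ = before-intro (inj₁ lt)
      ... | tri≈ _ eq _ = before-intro (inj₂ (≤-reflexive eq , ≤∧≢⇒< w≤v (w≢v ∘ Finₚ.toℕ-injective)))
        where
        w≤v : toℕ w ≤ toℕ v
        w≤v = +-cancelˡ-≤ (deg g v * n) _ _ (subst (λ d → d * n + toℕ w ≤ key v) eq le)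
      ... | tri> _ _ gt = ⊥-elim (<⇒≱ (begin-strict
        deg g v * n + toℕ v    <⟨ +-monoʳ-< (deg g v * n) (Finₚ.toℕ<n v) ⟩
        deg g v * n + n        ≡⟨ +-comm (deg g v * n) n ⟩
        suc (deg g v) * n      ≤⟨ *-monoˡ-≤ n gt ⟩
        deg g w * n            ≤⟨ m≤m+n _ _ ⟩
        key w                  ∎) le)
        where open ≤-Reasoning

    -- In an arbitrary graph the pruned sets are not known in advance. They are selected by `lowest`
    -- with respect to `key`, which no two vertices share, so that `kept-middle` applies.
    sizeH+2k : k + k ≤ n → sizeH g k + (k + k) ≡ n
    sizeH+2k 2k≤n = begin
      sizeH g k + (k + k)          ≡⟨ cong (_+ (k + k)) (countF-cong same) ⟩
      countF M.set + (k + k)       ≡⟨ cong (_+ (k + k)) M.size ⟩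
      n ∸ (k + k) + (k + k)        ≡⟨ m∸n+n≡m 2k≤n ⟩
      n                            ∎
      where
      open ≡-Reasoning
      module L = Lowest (lowest key (λ _ → true) k
        (subst (k ≤_) (sym (countF-all {n} {P = λ _ → true} (λ _ → refl))) (≤-trans (m≤m+n k k) 2k≤n)))
      |¬Lo| : k + countF (not ∘ L.set) ≡ n
      |¬Lo| = trans (cong (_+ countF (not ∘ L.set)) (sym L.size)) (countF-not L.set)
      fits : n ∸ (k + k) ≤ countF (not ∘ L.set)
      fits = subst (n ∸ (k + k) ≤_) (trans (cong (_∸ k) (sym |¬Lo|)) (m+n∸m≡n k _))
               (∸-monoʳ-≤ n (m≤m+n k k))
      module M = Lowest (lowest key (not ∘ L.set) (n ∸ (k + k)) fits)
      Hi : Fin n → Bool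
      Hi v = not (L.set v) ∧ not (M.set v)
      |Hi| : countF Hi ≡ k
      |Hi| = +-cancelˡ-≡ (n ∸ (k + k) + k) _ _ (begin
        n ∸ (k + k) + k + countF Hi       ≡⟨ regroup (n ∸ (k + k)) k (countF Hi) ⟩
        k + (n ∸ (k + k) + countF Hi)     ≡⟨ cong (λ x → k + (x + countF Hi)) M.size ⟨
        k + (countF M.set + countF Hi)    ≡⟨ cong (k +_) (countF-∪ disj) ⟨
        k + countF (not ∘ L.set)          ≡⟨ |¬Lo| ⟩
        n                                 ≡⟨ m∸n+n≡m 2k≤n ⟨
        n ∸ (k + k) + (k + k)             ≡⟨ +-assoc (n ∸ (k + k)) k k ⟨
        n ∸ (k + k) + k + k               ∎)
        where
        regroup : ∀ a b c → a + b + c ≡ b + (a + c)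
        regroup = solve-∀
        disj : ∀ i → ind (not (L.set i)) ≡ ind (M.set i) + ind (Hi i)
        disj i with L.set i in e | M.set i in e′
        ... | true  | false = refl
        ... | false | true  = refl
        ... | false | false = refl
        ... | true  | true  = ⊥-elim (false≢true (trans (sym (cong not e)) (M.subset i e′)))
      differ : ∀ {P : Fin n → Bool} {w v} → P w ≡ true → P v ≡ false → ¬ w ≡ v
      differ {P} Pw Pv eq = false≢true (trans (sym Pv) (trans (cong P (sym eq)) Pw))
      lo-first : ∀ l v → L.set l ≡ true → L.set v ≡ false → before g l v ≡ true
      lo-first l v l∈ v∉ = key≤⇒before (L.minimal l v l∈ refl v∉) (differ {L.set} l∈ v∉)
      hi-last : ∀ v h → Hi v ≡ false → Hi h ≡ true → before g v h ≡ true
      hi-last v h v∉ h∈ with L.set v in ev | L.set h in eh | M.set v in ev′ | M.set h in eh′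
      ... | true  | false | _    | _     = lo-first v h ev eh
      ... | false | false | true | false =
        key≤⇒before (M.minimal v h ev′ (cong not eh) eh′) (differ {M.set} ev′ eh′)
      same : ∀ v → kept g k v ≡ M.set v
      same v = trans (kept-middle L.set Hi L.size |Hi| lo-first hi-last v) (help v)
        where
        help : ∀ v → not (L.set v) ∧ not (Hi v) ≡ M.set v
        help v with L.set v in e | M.set v in e′
        ... | true  | true  = ⊥-elim (false≢true (trans (sym (cong not e)) (M.subset v e′)))
        ... | true  | false = refl
        ... | false | true  = refl
        ... | false | false = refl

    -- The handshake identity inside H: `half` sees each edge from its smaller endpoint, its
    -- transpose from the larger one, and diagonal terms vanish by `g-irr`.
    twice-edgesH : (∀ i j → g i j ≡ g j i) → (∀ i → g i i ≡ false) →
                   2 * edgesH g k ≡ sumF (λ v → ind (kept g k v) * degH g k v)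
    twice-edgesH g-sym g-irr = begin
      2 * edgesH g k                                                ≡⟨ cong (2 *_) edges ⟩
      2 * sumF (λ i → sumF (λ j → half i j))                        ≡⟨ cong (sumF (λ i → sumF (λ j → half i j)) +_) (trans (+-identityʳ _) (sumF-swap half)) ⟩
      sumF (λ i → sumF (half i)) + sumF (λ i → sumF (λ j → half j i)) ≡⟨ sumF-+ (λ i → sumF (half i)) (λ i → sumF (λ j → half j i)) ⟨
      sumF (λ i → sumF (half i) + sumF (λ j → half j i))            ≡⟨ sumF-cong (λ i → sumF-+ (half i) (λ j → half j i)) ⟨
      sumF (λ i → sumF (λ j → half i j + half j i))                 ≡⟨ sumF-cong (λ i → trans (sumF-cong (both i)) (row i)) ⟩
      sumF (λ v → ind (kept g k v) * degH g k v)                    ∎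
      where
      open ≡-Reasoning
      half : Fin n → Fin n → ℕ
      half i j = ind (kept g k i ∧ kept g k j ∧ (toℕ i <ᵇ toℕ j) ∧ g i j)
      edges : edgesH g k ≡ sumF (λ i → sumF (λ j → half i j))
      edges = sumF-cong {n} (λ i → countF≡sumF (λ j → kept g k i ∧ kept g k j ∧ (toℕ i <ᵇ toℕ j) ∧ g i j))
      row : ∀ i → sumF (λ j → ind (kept g k i ∧ (kept g k j ∧ g i j))) ≡ ind (kept g k i) * degH g k i
      row i with kept g k i
      ... | true  = trans (sym (countF≡sumF (λ j → kept g k j ∧ g i j))) (sym (+-identityʳ _))
      ... | false = sumF-0 n
      split : ∀ i j → (ind (toℕ i <ᵇ toℕ j) + ind (toℕ j <ᵇ toℕ i)) * ind (g i j) ≡ ind (g i j)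
      split i j with <-cmp (toℕ i) (toℕ j)
      ... | tri< lt _ ¬gt rewrite ≤ᵇ-true lt | ≤ᵇ-false {suc (toℕ j)} {toℕ i} (s≤s (<⇒≤ lt)) = +-identityʳ _
      ... | tri> ¬lt _ gt rewrite ≤ᵇ-true gt | ≤ᵇ-false {suc (toℕ i)} {toℕ j} (s≤s (<⇒≤ gt)) = +-identityʳ _
      ... | tri≈ _ eq _ with refl ← Finₚ.toℕ-injective eq rewrite g-irr i = *-zeroʳ (ind (toℕ i <ᵇ toℕ i) + ind (toℕ i <ᵇ toℕ i))
      bool : ∀ a b l l′ e → (ind l + ind l′) * ind e ≡ ind e →
             ind (a ∧ b ∧ l ∧ e) + ind (b ∧ a ∧ l′ ∧ e) ≡ ind (a ∧ (b ∧ e))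
      bool false false _ _ _ _ = refl
      bool false true _ _ _ _ = refl
      bool true false _ _ _ _ = refl
      bool true true false false e h = h
      bool true true false true e h = refl
      bool true true true false e h = +-identityʳ _
      bool true true true true false h = refl
      both : ∀ i j → half i j + half j i ≡ ind (kept g k i ∧ (kept g k j ∧ g i j))
      both i j rewrite g-sym j i = bool (kept g k i) (kept g k j) _ _ (g i j) (split i j)

  ∧-intro : ∀ {x y} → x ≡ true → y ≡ true → (x ∧ y) ≡ true
  ∧-intro refl refl = refl

  countF-∨ : (P Q : Fin n → Bool) → countF (λ i → P i ∨ Q i) ≤ countF P + countF Q
  countF-∨ P Q = begin
    countF (λ i → P i ∨ Q i)                   ≡⟨ countF≡sumF (λ i → P i ∨ Q i) ⟩
    sumF (λ i → ind (P i ∨ Q i))               ≤⟨ sumF-mono (λ i → le (P i) (Q i)) ⟩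
    sumF (λ i → ind (P i) + ind (Q i))         ≡⟨ sumF-+ (ind ∘ P) (ind ∘ Q) ⟩
    sumF (ind ∘ P) + sumF (ind ∘ Q)            ≡⟨ cong₂ _+_ (countF≡sumF P) (countF≡sumF Q) ⟨
    countF P + countF Q                        ∎
    where
    open ≤-Reasoning
    le : ∀ x y → ind (x ∨ y) ≤ ind x + ind y
    le true  y = s≤s z≤n
    le false y = ≤-refl

  -- Symmetric loopless matrices and the graphs they encode

  Symmetric Irreflexive : (Fin n → Fin n → Bool) → Set
  Symmetric g = ∀ i j → g i j ≡ g j i
  Irreflexive g = ∀ i → g i i ≡ false

  adj-sym : (u : Mat n) → Symmetric (adj u)
  adj-sym u i j with <-cmp (toℕ i) (toℕ j)
  ... | tri< lt _ _ rewrite ≤ᵇ-true lt | ≤ᵇ-false {suc (toℕ j)} {toℕ i} (s≤s (<⇒≤ lt)) = refl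
  ... | tri> _ _ gt rewrite ≤ᵇ-true gt | ≤ᵇ-false {suc (toℕ i)} {toℕ j} (s≤s (<⇒≤ gt)) = refl
  ... | tri≈ _ eq _ with refl ← Finₚ.toℕ-injective eq = refl

  adj-irr : (u : Mat n) → Irreflexive (adj u)
  adj-irr u i rewrite ≤ᵇ-false {suc (toℕ i)} {toℕ i} ≤-refl = refl

  -- `adj` reads only the entries above the diagonal. Attacks are therefore built as symmetric
  -- loopless matrices, which `adj` returns unchanged.
  adj-realizes : (a : Mat n) → Symmetric a → Irreflexive a → ∀ i j → adj a i j ≡ a i j
  adj-realizes a a-sym a-irr i j with <-cmp (toℕ i) (toℕ j)
  ... | tri< lt _ _ rewrite ≤ᵇ-true lt = refl
  ... | tri> _ _ gt rewrite ≤ᵇ-true gt | ≤ᵇ-false {suc (toℕ i)} {toℕ j} (s≤s (<⇒≤ gt)) = a-sym j i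
  ... | tri≈ _ eq _ with refl ← Finₚ.toℕ-injective eq = trans (adj-irr a i) (sym (a-irr i))

  -- Deviation of the estimators from 1/2

  Apart : ℕ → ℕ → ℕ → Set
  Apart a q δ = q + δ ≤ a ⊎ a + δ ≤ q

  -- r is about γ n / 480.  With m kept vertices, j₁ and j₂ are the indices of the
  -- two middle order statistics (counted from 0), so that j₁ + j₂ = m - 1.
  record Sizes (n k r j₁ j₂ : ℕ) : Set where
    field
      total  : suc (j₁ + j₂) + (k + k) ≡ n
      j₁≤j₂  : j₁ ≤ j₂
      j₂≤    : j₂ ≤ suc j₁
      k-small : 4 * k ≤ n
      r-small : 480 * r ≤ n
      r-large : 10 ≤ r
      n-small : n ≤ 56 * (r * r)

  -- Both distances from 1/2 with denominators cleared: for m kept vertices and E kept edges, twice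
  -- the median is compared with m - 1, and 4E with m(m - 1).
  record Far (g : Fin n → Fin n → Bool) (k r j₁ j₂ : ℕ) : Set where
    field
      size       : sizeH g k ≡ suc (j₁ + j₂)
      median-far : Apart (orderStat g k j₁ + orderStat g k j₂) (j₁ + j₂) r
      mean-far   : Apart (4 * edgesH g k) (suc (j₁ + j₂) * (j₁ + j₂)) (r * (r ∸ 1))

  -- Order statistics of two graphs with the same kept set

  module _ {g g′ : Fin n → Fin n → Bool} {k : ℕ} {H : Fin n → Bool}
           (kept-g : ∀ v → kept g k v ≡ H v) (kept-g′ : ∀ v → kept g′ k v ≡ H v) where

    -- W and the low set T may change arbitrarily: together they are too few
    -- to carry the j-th order statistic.
    orderStat-shift : (T W : Fin n → Bool) (s j : ℕ) →
      j < countF H → countF T + countF W ≤ j →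
      (∀ v → H v ≡ true → T v ≡ false → degH g k v + s ≤ degH g′ k v) →
      (∀ t v → T t ≡ true → H v ≡ true → T v ≡ false → W v ≡ false → degH g k t ≤ degH g k v) →
      orderStat g k j + s ≤ orderStat g′ k j
    orderStat-shift T W s j j<m few shift low = below≤⇒≤orderStat g′ k (subst (j <_) (sym size′) j<m) bound
      where
      open ≤-Reasoning
      size : sizeH g k ≡ countF H
      size = countF-cong kept-g
      size′ : sizeH g′ k ≡ countF H
      size′ = countF-cong kept-g′
      t = orderStat g k j
      below-t : below g k t ≤ j
      below-t = ≤orderStat⇒below≤ g k (subst (j <_) (sym size) j<m) ≤-refl
      U : Fin n → Bool
      U v = H v ∧ not (T v) ∧ not (W v) ∧ (degH g k v <ᵇ t)
      U-elim : ∀ a b c d → (a ∧ not b ∧ not c ∧ d) ≡ true →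
               a ≡ true × b ≡ false × c ≡ false × d ≡ true
      U-elim true false false true _ = refl , refl , refl , refl
      bound : below g′ k (t + s) ≤ j
      -- Either some vertex of `H` outside `T` and `W` had degree below `t`; then so had all of `T`,
      -- and whatever is below `t + s` now was below `t` before. Or there is no such vertex, and
      -- only `T` and `W` can be below `t + s`.
      bound with argmin (λ _ → 0) U
      ... | inj₂ (v₀ , v₀∈ , _) with U-elim (H v₀) (T v₀) (W v₀) _ v₀∈
      ... | h₀ , t₀ , w₀ , lt₀ = ≤-trans (countF-mono ⊆) below-t
        where
        ⊆ : ∀ v → (kept g′ k v ∧ (degH g′ k v <ᵇ (t + s))) ≡ true →
            (kept g k v ∧ (degH g k v <ᵇ t)) ≡ true
        ⊆ v e with ∧-elim {kept g′ k v} e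
        ... | kv , lt = ∧-intro (trans (kept-g v) hv) (≤ᵇ-true lt′)
          where
          hv : H v ≡ true
          hv = trans (sym (kept-g′ v)) kv
          lt′ : degH g k v < t
          lt′ with T v in eq
          ... | true  = ≤-<-trans (low v v₀ eq h₀ t₀ w₀) (≤ᵇ-sound lt₀)
          ... | false = +-cancelʳ-< s _ _ (≤-<-trans (shift v hv eq) (≤ᵇ-sound lt))
      bound | inj₁ none = begin
        below g′ k (t + s)             ≤⟨ countF-mono ⊆ ⟩
        countF (λ v → T v ∨ W v)       ≤⟨ countF-∨ T W ⟩
        countF T + countF W            ≤⟨ few ⟩
        j                              ∎
        where
        ⊆ : ∀ v → (kept g′ k v ∧ (degH g′ k v <ᵇ (t + s))) ≡ true → (T v ∨ W v) ≡ true
        ⊆ v e with T v in eqT | W v in eqW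
        ... | true  | _    = refl
        ... | false | true = refl
        ... | false | false with ∧-elim {kept g′ k v} e
        ... | kv , lt = ⊥-elim (false≢true (trans (sym (none v))
          (∧-intro hv (∧-intro (cong not eqT) (∧-intro (cong not eqW) (≤ᵇ-true lt′))))))
          where
          hv : H v ≡ true
          hv = trans (sym (kept-g′ v)) kv
          lt′ : degH g k v < t
          lt′ = +-cancelʳ-< s _ _ (≤-<-trans (shift v hv eqT) (≤ᵇ-sound lt))

  -- Graphs whose kept degrees all lie on one side

  module _ {n k r j₁ j₂ : ℕ} (S : Sizes n k r j₁ j₂) (g : Fin n → Fin n → Bool)
           (g-sym : Symmetric g) (g-irr : Irreflexive g) where

    open Sizes S
    open ≤-Reasoning

    private
      2k≤n : k + k ≤ n
      2k≤n = subst (k + k ≤_) total (m≤n+m (k + k) (suc (j₁ + j₂)))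

      size : sizeH g k ≡ suc (j₁ + j₂)
      size = +-cancelʳ-≡ (k + k) _ _ (trans (sizeH+2k g k 2k≤n) (sym total))

      j₁<m : j₁ < sizeH g k
      j₁<m = subst (j₁ <_) (sym size) (s≤s (m≤m+n j₁ j₂))

      j₂<m : j₂ < sizeH g k
      j₂<m = subst (j₂ <_) (sym size) (s≤s (m≤n+m j₂ j₁))

      r≤m : r ≤ suc (j₁ + j₂)
      r≤m = *-cancelˡ-≤ 2 (linear (478 * r) (+-mono-≤ r-small k-small) identity)
        where
        identity : 2 * r + (n + n) + 478 * r ≡ 2 * suc (j₁ + j₂) + (480 * r + 4 * k)
        identity = subst (λ n → 2 * r + (n + n) + 478 * r ≡ 2 * suc (j₁ + j₂) + (480 * r + 4 * k)) total
          (solve (r ∷ k ∷ j₁ ∷ j₂ ∷ []))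

      sum-const : ∀ t → sumF (λ v → ind (kept g k v) * t) ≡ suc (j₁ + j₂) * t
      sum-const t = trans (sumF-*ʳ (ind ∘ kept g k) t)
        (cong (_* t) (trans (sym (countF≡sumF (kept g k))) size))

      4E : 4 * edgesH g k ≡ 2 * sumF (λ v → ind (kept g k v) * degH g k v)
      4E = trans (*-assoc 2 2 (edgesH g k)) (cong (2 *_) (twice-edgesH g k g-sym g-irr))

    far-above : ∀ t → j₁ + j₂ + r ≤ 2 * t → (∀ v → kept g k v ≡ true → t ≤ degH g k v) →
                Far g k r j₁ j₂
    far-above t large t≤ = record { size = size ; median-far = inj₁ med ; mean-far = inj₁ mean }
      where
      none : below g k t ≡ 0
      none = countF-none none′
        where
        none′ : ∀ v → (kept g k v ∧ (degH g k v <ᵇ t)) ≡ false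
        none′ v with kept g k v in e
        ... | false = refl
        ... | true  = ≤ᵇ-false (s≤s (t≤ v e))
      stat : ∀ {j} → j < sizeH g k → t ≤ orderStat g k j
      stat j<m = below≤⇒≤orderStat g k j<m (≤-trans (≤-reflexive none) z≤n)
      med : j₁ + j₂ + r ≤ orderStat g k j₁ + orderStat g k j₂
      med = begin
        j₁ + j₂ + r    ≤⟨ large ⟩
        2 * t          ≡⟨ cong (t +_) (+-identityʳ t) ⟩
        t + t          ≤⟨ +-mono-≤ (stat j₁<m) (stat j₂<m) ⟩
        orderStat g k j₁ + orderStat g k j₂ ∎
      bound : ∀ v → ind (kept g k v) * t ≤ ind (kept g k v) * degH g k v
      bound v with kept g k v in e
      ... | false = z≤n
      ... | true  = *-monoʳ-≤ 1 (t≤ v e)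
      mean : suc (j₁ + j₂) * (j₁ + j₂) + r * (r ∸ 1) ≤ 4 * edgesH g k
      mean = begin
        -- Of a deviation `m * r` only `r * (r ∸ 1)` is kept, the amount that the clique yields in
        -- the balanced case.
        suc (j₁ + j₂) * (j₁ + j₂) + r * (r ∸ 1)             ≤⟨ +-monoʳ-≤ (suc (j₁ + j₂) * (j₁ + j₂)) (*-mono-≤ r≤m (m∸n≤m r 1)) ⟩
        suc (j₁ + j₂) * (j₁ + j₂) + suc (j₁ + j₂) * r       ≡⟨ *-distribˡ-+ (suc (j₁ + j₂)) (j₁ + j₂) r ⟨
        suc (j₁ + j₂) * (j₁ + j₂ + r)                       ≤⟨ *-monoʳ-≤ (suc (j₁ + j₂)) large ⟩
        suc (j₁ + j₂) * (2 * t)                             ≡⟨ rearrange (suc (j₁ + j₂)) t ⟩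
        2 * (suc (j₁ + j₂) * t)                             ≡⟨ cong (2 *_) (sum-const t) ⟨
        2 * sumF (λ v → ind (kept g k v) * t)               ≤⟨ *-monoʳ-≤ 2 (sumF-mono bound) ⟩
        2 * sumF (λ v → ind (kept g k v) * degH g k v)      ≡⟨ 4E ⟨
        4 * edgesH g k                                      ∎
        where
        rearrange : ∀ m t → m * (2 * t) ≡ 2 * (m * t)
        rearrange = solve-∀

    far-below : ∀ t → 2 * t + r ≤ j₁ + j₂ → (∀ v → kept g k v ≡ true → degH g k v ≤ t) →
                Far g k r j₁ j₂
    far-below t small ≤t = record { size = size ; median-far = inj₂ med ; mean-far = inj₂ mean }
      where
      all : below g k (suc t) ≡ sizeH g k
      all = countF-cong all′
        where
        all′ : ∀ v → (kept g k v ∧ (degH g k v <ᵇ suc t)) ≡ kept g k v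
        all′ v with kept g k v in e
        ... | false = refl
        ... | true  = ≤ᵇ-true (s≤s (≤t v e))
      stat : ∀ {j} → j < sizeH g k → orderStat g k j ≤ t
      stat {j} j<m with orderStat g k j ≤? t
      ... | yes le = le
      ... | no ¬le = ⊥-elim (<⇒≱ j<m (subst (_≤ j) all (≤orderStat⇒below≤ g k j<m (≰⇒> ¬le))))
      med : orderStat g k j₁ + orderStat g k j₂ + r ≤ j₁ + j₂
      med = begin
        orderStat g k j₁ + orderStat g k j₂ + r ≤⟨ +-monoˡ-≤ r (+-mono-≤ (stat j₁<m) (stat j₂<m)) ⟩
        t + t + r      ≡⟨ cong (λ x → t + x + r) (+-identityʳ t) ⟨
        2 * t + r      ≤⟨ small ⟩
        j₁ + j₂        ∎
      bound : ∀ v → ind (kept g k v) * degH g k v ≤ ind (kept g k v) * t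
      bound v with kept g k v in e
      ... | false = z≤n
      ... | true  = *-monoʳ-≤ 1 (≤t v e)
      mean : 4 * edgesH g k + r * (r ∸ 1) ≤ suc (j₁ + j₂) * (j₁ + j₂)
      mean = begin
        4 * edgesH g k + r * (r ∸ 1)                                     ≡⟨ cong (_+ r * (r ∸ 1)) 4E ⟩
        2 * sumF (λ v → ind (kept g k v) * degH g k v) + r * (r ∸ 1)     ≤⟨ +-mono-≤ (*-monoʳ-≤ 2 (sumF-mono bound)) (*-mono-≤ r≤m (m∸n≤m r 1)) ⟩
        2 * sumF (λ v → ind (kept g k v) * t) + suc (j₁ + j₂) * r        ≡⟨ cong (λ x → 2 * x + suc (j₁ + j₂) * r) (sum-const t) ⟩
        2 * (suc (j₁ + j₂) * t) + suc (j₁ + j₂) * r                      ≡⟨ rearrange (suc (j₁ + j₂)) t r ⟩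
        suc (j₁ + j₂) * (2 * t + r)                                      ≤⟨ *-monoʳ-≤ (suc (j₁ + j₂)) small ⟩
        suc (j₁ + j₂) * (j₁ + j₂)                                        ∎
        where
        rearrange : ∀ m t r → 2 * (m * t) + m * r ≡ m * (2 * t + r)
        rearrange = solve-∀

    private
      degH≤deg : ∀ v → degH g k v ≤ deg g v
      degH≤deg v = countF-mono (λ w e → proj₂ (∧-elim {kept g k w} e))

      deg≤degH : ∀ v → deg g v ≤ degH g k v + (k + k)
      deg≤degH v = begin
        deg g v                                    ≤⟨ countF-mono ⊆ ⟩
        countF (λ w → (kept g k w ∧ g v w) ∨ not (kept g k w)) ≤⟨ countF-∨ (λ w → kept g k w ∧ g v w) (not ∘ kept g k) ⟩
        degH g k v + countF (not ∘ kept g k)       ≡⟨ cong (degH g k v +_) removed ⟩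
        degH g k v + (k + k)                       ∎
        where
        removed : countF (not ∘ kept g k) ≡ k + k
        removed = +-cancelˡ-≡ (sizeH g k) _ _ (trans (countF-not (kept g k)) (sym (sizeH+2k g k 2k≤n)))
        ⊆ : ∀ w → g v w ≡ true → ((kept g k w ∧ g v w) ∨ not (kept g k w)) ≡ true
        ⊆ w e with kept g k w
        ... | true  = trans (Boolₚ.∨-identityʳ _) e
        ... | false = refl

      before⇒deg≤ : ∀ {w v} → before g w v ≡ true → deg g w ≤ deg g v
      before⇒deg≤ e with before-elim g k e
      ... | inj₁ lt = <⇒≤ lt
      ... | inj₂ (le , _) = le

    -- A kept vertex has rank at least `k`, so it is not among the few vertices of degree below
    -- `t + 2k`; deleting `2k` vertices leaves it degree at least `t`.
    far-if-few-low : ∀ t → j₁ + j₂ + r ≤ 2 * t →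
                     countF (λ v → deg g v <ᵇ (t + (k + k))) ≤ k → Far g k r j₁ j₂
    far-if-few-low t large few = far-above t large bound
      where
      bound : ∀ v → kept g k v ≡ true → t ≤ degH g k v
      bound v e with t + (k + k) ≤? deg g v
      ... | yes le = +-cancelʳ-≤ (k + k) _ _ (≤-trans le (deg≤degH v))
      ... | no ¬le = ⊥-elim (<⇒≱ rank< (≤-trans few (≤ᵇ-sound (proj₁ (∧-elim {k ≤ᵇ rank g v} e)))))
        where
        rank< : rank g v < countF (λ w → deg g w <ᵇ (t + (k + k)))
        rank< = countF-mono-< (λ w wv → ≤ᵇ-true (≤-<-trans (before⇒deg≤ wv) (≰⇒> ¬le)))
                  v (before-irrefl g k v) (≤ᵇ-true (≰⇒> ¬le))

    -- A kept vertex of degree above `t` would be preceded by all vertices of degree at most `t`, at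
    -- least `n ∸ k` of them, too many for its rank. Pruning only lowers degrees, so no correction
    -- by `2k` appears.
    far-if-few-high : ∀ t → 2 * t + r ≤ j₁ + j₂ →
                      countF (λ v → not (deg g v ≤ᵇ t)) ≤ k → Far g k r j₁ j₂
    far-if-few-high t small few = far-below t small bound
      where
      bound : ∀ v → kept g k v ≡ true → degH g k v ≤ t
      bound v e with deg g v ≤? t
      ... | yes le = ≤-trans (degH≤deg v) le
      ... | no ¬le = ⊥-elim (<⇒≱ (≤ᵇ-sound (proj₂ (∧-elim {k ≤ᵇ rank g v} e))) (begin
        n ∸ k                                      ≤⟨ ∸-monoʳ-≤ n few ⟩
        n ∸ countF (λ w → not (deg g w ≤ᵇ t))      ≡⟨ cong (_∸ countF (λ w → not (deg g w ≤ᵇ t))) (countF-not (λ w → deg g w ≤ᵇ t)) ⟨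
        countF (λ w → deg g w ≤ᵇ t) + countF (λ w → not (deg g w ≤ᵇ t)) ∸ countF (λ w → not (deg g w ≤ᵇ t)) ≡⟨ m+n∸n≡m _ (countF (λ w → not (deg g w ≤ᵇ t))) ⟩
        countF (λ w → deg g w ≤ᵇ t)                ≤⟨ countF-mono (λ w le → before-intro g k {w} {v} (inj₁ (≤-<-trans (≤ᵇ-sound le) (≰⇒> ¬le)))) ⟩
        rank g v                                   ∎))

  -- Arithmetic of the corrupted degrees

  -- As `M + 2k = A + b`, the corrupted vertices receive `(A + b) * y + Δ` edges in total. Rounding
  -- `y` down loses less than `A + 1` and the two designs lose `b` each, at most `A + 2b ≤ 56 r²`
  -- altogether, while the margin `6 * r * b` is `288 r²`.
  column-lower : ∀ (M Δ k A θ z r cM cR : ℕ) → 1 ≤ r →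
    let b = 48 * r ; y = z + 6 * r in
    M * y + Δ ≤ b * cM + b →
    k * z + k * (z + 12 * r) ≤ b * cR + b →
    A + (b + b) ≡ M + b + (k + k) →
    A + (b + b) ≤ 56 * (r * r) →
    θ * b < A * suc y →
    θ + z < cM + cR
  column-lower M Δ k A θ z r cM cR 1≤r hM hR total A-small θ< = *-cancelˡ-< (48 * r) (θ + z) (cM + cR)
    (linear (Δ + 232 * (r * r))
      (+-mono-≤ (+-mono-≤ (+-mono-≤ (+-mono-≤ hM hR) (≤-reflexive (cong (_* (z + 6 * r)) total))) θ<) A-small)
      (solve (M ∷ Δ ∷ k ∷ A ∷ θ ∷ z ∷ r ∷ cM ∷ cR ∷ [])))

  -- Of the margin `6 * r * b` the surplus `Δ` takes about `3 * r * b`, the clique at most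
  -- `(r - 1) * b` and the two designs `2 * b`, which leaves a positive rest.
  column-upper : ∀ (M Δ k A θ z r cM cR c : ℕ) → 1 ≤ r →
    let b = 48 * r ; y = z + 6 * r in
    b * cM ≤ M * y + Δ + b →
    b * cR ≤ k * z + k * (z + 12 * r) + b →
    A + (b + b) ≡ M + b + (k + k) →
    Δ ≤ r * (3 * b + 2) →
    A * y ≤ θ * b →
    suc c ≤ r →
    cM + cR + c < θ + (z + 12 * r)
  column-upper M Δ k A θ z r cM cR c 1≤r hM hR total hΔ ≤θ c<r =
    *-cancelˡ-< (48 * r) (cM + cR + c) (θ + (z + 12 * r))
      (linear (45 * r)
        (+-mono-≤ (+-mono-≤ (+-mono-≤ (+-mono-≤ (+-mono-≤ (+-mono-≤ (+-mono-≤ hM hR)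
          (≤-reflexive (cong (_* (z + 6 * r)) (sym total)))) hΔ) ≤θ) (scale (48 * r) c<r)) (scale (96 * r) 1≤r)) 1≤r)
        (solve (M ∷ Δ ∷ k ∷ A ∷ θ ∷ z ∷ r ∷ cM ∷ cR ∷ c ∷ [])))

  -- A surplus of `3 * r * b` edges is worth `3 * r` per corrupted vertex: `r` for the lift, at most
  -- `r - 1` to replace the clique, and at least `r + 1` for the rounding of the two columns.
  column-shift : ∀ (M Δ y r cB cU c : ℕ) → 1 ≤ r →
    let b = 48 * r in
    b * cB ≤ M * y + 0 + b →
    M * y + Δ ≤ b * cU + b →
    r * (3 * b + 1) ≤ Δ →
    suc c ≤ r →
    cB + c + r ≤ cU
  column-shift M Δ y r cB cU c 1≤r hB hU hΔ c<r = *-cancelˡ-≤ {cB + c + r} {cU} (48 * r) {{>-nonZero (*-mono-≤ {1} {48} (s≤s z≤n) 1≤r)}}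
    (linear r
      (+-mono-≤ (+-mono-≤ (+-mono-≤ (+-mono-≤ hB hU) hΔ) (scale (48 * r) c<r)) (scale (48 * r) 1≤r))
      (solve (M ∷ Δ ∷ y ∷ r ∷ cB ∷ cU ∷ c ∷ [])))

  -- Partition of the vertices into four classes

  -- lo and hi get pruned, mid is kept, and adv is corrupted.
  data Part : Set where
    lo mid hi adv : Part

  is : Part → Part → Bool
  is lo  lo  = true
  is mid mid = true
  is hi  hi  = true
  is adv adv = true
  is _   _   = false

  is-sound : ∀ c c′ → is c c′ ≡ true → c′ ≡ c
  is-sound lo  lo  _ = refl
  is-sound mid mid _ = refl
  is-sound hi  hi  _ = refl
  is-sound adv adv _ = refl

  remains : Part → Bool
  remains c = not (is lo c) ∧ not (is hi c)

  classify : Bool → Bool → Bool → Part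
  classify true  _     _     = adv
  classify false true  _     = lo
  classify false false true  = mid
  classify false false false = hi

  classify-adv : ∀ b l m → is adv (classify b l m) ≡ b
  classify-adv true  _     _     = refl
  classify-adv false true  _     = refl
  classify-adv false false true  = refl
  classify-adv false false false = refl

  classify-lo : ∀ b l m → (l ≡ true → not b ≡ true) → is lo (classify b l m) ≡ l
  classify-lo true  true  _     h with () ← h refl
  classify-lo true  false _     _ = refl
  classify-lo false true  _     _ = refl
  classify-lo false false true  _ = refl
  classify-lo false false false _ = refl

  classify-mid : ∀ b l m → (m ≡ true → not b ∧ not l ≡ true) → is mid (classify b l m) ≡ m
  classify-mid true  _     true  h with () ← h refl
  classify-mid true  _     false _ = refl
  classify-mid false true  true  h with () ← h refl
  classify-mid false true  false _ = refl
  classify-mid false false true  _ = refl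
  classify-mid false false false _ = refl

  record Classes {n} (g : Fin n → Fin n → Bool) (b k : ℕ) : Set where
    field
      cls : Fin n → Part

    on : Part → Fin n → Bool
    on c v = is c (cls v)

    -- For uncorrupted vertices this is the part of the degree out of the adversary's reach; `inner`
    -- is the part of it that survives when exactly `lo` and `hi` are pruned. The two can order
    -- vertices differently.
    outer : Fin n → ℕ
    outer v = countF (λ w → not (on adv w) ∧ g v w)

    inner : Fin n → ℕ
    inner v = countF (λ w → on mid w ∧ g v w)

    field
      |adv|  : countF (on adv) ≡ b
      |lo|   : countF (on lo) ≡ k
      |hi|   : countF (on hi) ≡ k
      |mid|  : countF (on mid) + b + (k + k) ≡ n
      lo≤mid : ∀ l v → cls l ≡ lo → cls v ≡ mid → outer l ≤ outer v
      lo≤hi  : ∀ l h → cls l ≡ lo → cls h ≡ hi → outer l ≤ outer h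
      mid≤hi : ∀ v h → cls v ≡ mid → cls h ≡ hi → outer v ≤ outer h

  classes : ∀ {n} (g : Fin n → Fin n → Bool) (b k m : ℕ) → m + b + (k + k) ≡ n → Classes g b k
  classes {n} g b k m total = record
    { cls = cls
    ; |adv| = trans (countF-cong adv≡B) B.size
    ; |lo| = trans (countF-cong lo≡L) L.size
    ; |hi| = +-cancelˡ-≡ (b + (k + m)) _ _ (trans |hi|-sum (trans (sym total) (regroup m b k)))
    ; |mid| = trans (cong (λ x → x + b + (k + k)) (trans (countF-cong mid≡M) M.size)) total
    ; lo≤mid = λ l v el ev → lo≤ l v el (λ e → mid≢lo (trans (sym ev) e)) (λ e → mid≢adv (trans (sym ev) e))
    ; lo≤hi = λ l v el ev → lo≤ l v el (λ e → hi≢lo (trans (sym ev) e)) (λ e → hi≢adv (trans (sym ev) e))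
    ; mid≤hi = mid≤hi′
    }
    where
    regroup : ∀ m b k → m + b + (k + k) ≡ b + (k + m) + k
    regroup = solve-∀
    -- The constant key makes this an arbitrary choice of `b` vertices to corrupt.
    module B = Lowest (lowest {n} (λ _ → 0) (λ _ → true) b
      (subst (b ≤_) (trans total (sym (countF-all {n} {P = λ _ → true} (λ _ → refl))))
        (≤-trans (m≤n+m b m) (m≤m+n (m + b) (k + k)))))
    d : Fin n → ℕ
    d v = countF (λ w → not (B.set w) ∧ g v w)
    rest : b + countF (not ∘ B.set) ≡ b + (k + m + k)
    rest = trans (trans (cong (_+ countF (not ∘ B.set)) (sym B.size)) (countF-not B.set))
                 (trans (sym total) (trans (regroup m b k) (+-assoc b (k + m) k)))
    |¬B| : countF (not ∘ B.set) ≡ k + m + k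
    |¬B| = +-cancelˡ-≡ b _ _ rest
    module L = Lowest (lowest d (not ∘ B.set) k (subst (k ≤_) (sym |¬B|) (m≤n+m k (k + m))))
    rest? : Fin n → Bool
    rest? v = not (B.set v) ∧ not (L.set v)
    |rest| : countF rest? ≡ m + k
    |rest| = +-cancelˡ-≡ k _ _ (trans (cong (_+ countF rest?) (sym L.size))
      (trans (sym (countF-∪ disj)) (trans |¬B| (+-assoc k m k))))
      where
      disj : ∀ i → ind (not (B.set i)) ≡ ind (L.set i) + ind (rest? i)
      disj i with B.set i in eb | L.set i in el
      ... | true  | true  = ⊥-elim (false≢true (trans (sym (cong not eb)) (L.subset i el)))
      ... | true  | false = refl
      ... | false | true  = refl
      ... | false | false = refl
    module M = Lowest (lowest d rest? m (subst (m ≤_) (sym |rest|) (m≤m+n m k)))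
    cls : Fin n → Part
    cls v = classify (B.set v) (L.set v) (M.set v)
    adv≡B : ∀ v → is adv (cls v) ≡ B.set v
    adv≡B v = classify-adv (B.set v) (L.set v) (M.set v)
    lo≡L : ∀ v → is lo (cls v) ≡ L.set v
    lo≡L v = classify-lo (B.set v) (L.set v) (M.set v) (L.subset v)
    mid≡M : ∀ v → is mid (cls v) ≡ M.set v
    mid≡M v = classify-mid (B.set v) (L.set v) (M.set v) (M.subset v)
    |hi|-sum : b + (k + m) + countF (λ v → is hi (cls v)) ≡ n
    |hi|-sum = begin
      b + (k + m) + countF (λ v → is hi (cls v))
        ≡⟨ cong (_+ countF (λ v → is hi (cls v))) (cong₂ _+_ B.size (cong₂ _+_ L.size M.size)) ⟨
      countF B.set + (countF L.set + countF M.set) + countF (λ v → is hi (cls v))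
        ≡⟨ cong₂ (λ x y → x + y + countF (λ v → is hi (cls v))) (countF-cong adv≡B) (cong₂ _+_ (countF-cong lo≡L) (countF-cong mid≡M)) ⟨
      countF (λ v → is adv (cls v)) + (countF (λ v → is lo (cls v)) + countF (λ v → is mid (cls v))) + countF (λ v → is hi (cls v))
        ≡⟨ cong (λ x → countF (λ v → is adv (cls v)) + x + countF (λ v → is hi (cls v))) (countF-∪ {R = λ v → is lo (cls v) ∨ is mid (cls v)} (λ v → u₁ (cls v))) ⟨
      countF (λ v → is adv (cls v)) + countF (λ v → is lo (cls v) ∨ is mid (cls v)) + countF (λ v → is hi (cls v))
        ≡⟨ cong (_+ countF (λ v → is hi (cls v))) (countF-∪ {R = λ v → is adv (cls v) ∨ is lo (cls v) ∨ is mid (cls v)} (λ v → u₂ (cls v))) ⟨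
      countF (λ v → is adv (cls v) ∨ is lo (cls v) ∨ is mid (cls v)) + countF (λ v → is hi (cls v))
        ≡⟨ countF-∪ {R = λ _ → true} (λ v → u₃ (cls v)) ⟨
      countF {n} (λ _ → true)
        ≡⟨ countF-all {n} {P = λ _ → true} (λ _ → refl) ⟩
      n ∎
      where
      open ≡-Reasoning
      u₁ : ∀ c → ind (is lo c ∨ is mid c) ≡ ind (is lo c) + ind (is mid c)
      u₁ = λ { lo → refl ; mid → refl ; hi → refl ; adv → refl }
      u₂ : ∀ c → ind (is adv c ∨ is lo c ∨ is mid c) ≡ ind (is adv c) + ind (is lo c ∨ is mid c)
      u₂ = λ { lo → refl ; mid → refl ; hi → refl ; adv → refl }
      u₃ : ∀ c → 1 ≡ ind (is adv c ∨ is lo c ∨ is mid c) + ind (is hi c)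
      u₃ = λ { lo → refl ; mid → refl ; hi → refl ; adv → refl }
    outer : Fin n → ℕ
    outer v = countF (λ w → not (is adv (cls w)) ∧ g v w)
    d≡outer : ∀ v → d v ≡ outer v
    d≡outer v = countF-cong (λ w → cong (λ x → not x ∧ g v w) (sym (adv≡B w)))
    mid≢lo : ∀ {A : Set} → mid ≡ lo → A
    mid≢lo ()
    mid≢adv : ∀ {A : Set} → mid ≡ adv → A
    mid≢adv ()
    hi≢lo : ∀ {A : Set} → hi ≡ lo → A
    hi≢lo ()
    hi≢adv : ∀ {A : Set} → hi ≡ adv → A
    hi≢adv ()
    not-is : ∀ c c′ → ¬ c′ ≡ c → is c c′ ≡ false
    not-is c c′ ¬e with is c c′ in e
    ... | false = refl
    ... | true  = ⊥-elim (¬e (is-sound c c′ e))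
    lo≤ : ∀ l v → cls l ≡ lo → ¬ cls v ≡ lo → ¬ cls v ≡ adv → outer l ≤ outer v
    lo≤ l v el ¬lo ¬adv = subst₂ _≤_ (d≡outer l) (d≡outer v) (L.minimal l v
      (trans (sym (lo≡L l)) (cong (is lo) el))
      (cong not (trans (sym (adv≡B v)) (not-is adv _ ¬adv)))
      (trans (sym (lo≡L v)) (not-is lo _ ¬lo)))
    mid≤hi′ : ∀ v h → cls v ≡ mid → cls h ≡ hi → outer v ≤ outer h
    mid≤hi′ v h ev eh = subst₂ _≤_ (d≡outer v) (d≡outer h) (M.minimal v h
      (trans (sym (mid≡M v)) (cong (is mid) ev))
      (cong₂ (λ s t → not s ∧ not t) (trans (sym (adv≡B h)) (cong (is adv) eh)) (trans (sym (lo≡L h)) (cong (is lo) eh)))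
      (trans (sym (mid≡M h)) (cong (is mid) eh)))

  -- Cliques

  clique : ∀ {n} → (Fin n → Bool) → Fin n → Fin n → Bool
  clique F v w = F v ∧ F w ∧ not (v == w)

  clique-sym : ∀ {n} (F : Fin n → Bool) → Symmetric (clique F)
  clique-sym F v w rewrite ==-sym v w with F v | F w
  ... | true  | true  = refl
  ... | true  | false = refl
  ... | false | true  = refl
  ... | false | false = refl

  clique-irr : ∀ {n} (F : Fin n → Bool) → Irreflexive (clique F)
  clique-irr F v rewrite ==-refl v = trans (cong (F v ∧_) (Boolₚ.∧-zeroʳ (F v))) (Boolₚ.∧-zeroʳ (F v))

  clique-in : ∀ {n} (F : Fin n → Bool) v → F v ≡ true → suc (countF (clique F v)) ≡ countF F
  clique-in F v v∈ = trans (cong (_+ countF (clique F v)) (sym (countF-== v))) (sym (countF-∪ disj))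
    where
    disj : ∀ w → ind (F w) ≡ ind (v == w) + ind (clique F v w)
    disj w rewrite v∈ with v == w in e
    ... | false = cong ind (sym (Boolₚ.∧-identityʳ (F w)))
    ... | true with refl ← ==-sound v w e rewrite v∈ = refl

  clique-out : ∀ {n} (F : Fin n → Bool) v → F v ≡ false → countF (clique F v) ≡ 0
  clique-out F v v∉ = countF-none (λ w → cong (_∧ (F w ∧ not (v == w))) v∉)

  clique-degree< : ∀ {n} (F : Fin n → Bool) r v → 1 ≤ r → countF F ≤ r → countF (clique F v) < r
  clique-degree< F r v 1≤r |F|≤r = by-membership (F v) refl
    where
    by-membership : ∀ y → F v ≡ y → countF (clique F v) < r
    by-membership true  e = subst (_≤ r) (sym (clique-in F v e)) |F|≤r
    by-membership false e = subst (_< r) (sym (clique-out F v e)) 1≤r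

  -- The balanced attack and what it keeps

  -- low, x and high are the numbers of corrupted neighbours of the vertices in
  -- lo, mid and hi.
  module Attacked {n b k : ℕ} {g : Fin n → Fin n → Bool} (C : Classes g b k)
    (g-sym : Symmetric g) (g-irr : Irreflexive g) (low high : ℕ) (x : Fin n → ℕ)
    (EM : Design (Classes.on C adv) (λ v → ind (Classes.on C mid v) * x v))
    (ER : Design (Classes.on C adv) (λ v → ind (Classes.on C lo v) * low + ind (Classes.on C hi v) * high))
    (F : Fin n → Bool) (F⊆adv : ∀ v → F v ≡ true → Classes.on C adv v ≡ true) where

    open Classes C
    private
      module EM = Design EM
      module ER = Design ER

    link : Part → Part → Fin n → Fin n → Bool
    link adv adv v w = clique F v w
    link adv mid v w = EM.edge w v
    link adv lo  v w = ER.edge w v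
    link adv hi  v w = ER.edge w v
    link mid adv v w = EM.edge v w
    link lo  adv v w = ER.edge v w
    link hi  adv v w = ER.edge v w
    link lo  lo  v w = g v w
    link lo  mid v w = g v w
    link lo  hi  v w = g v w
    link mid lo  v w = g v w
    link mid mid v w = g v w
    link mid hi  v w = g v w
    link hi  lo  v w = g v w
    link hi  mid v w = g v w
    link hi  hi  v w = g v w

    attacked : Mat n
    attacked v w = link (cls v) (cls w) v w

    attacked-sym : Symmetric attacked
    attacked-sym v w = link-sym (cls v) (cls w)
      where
      link-sym : ∀ c c′ → link c c′ v w ≡ link c′ c w v
      link-sym adv adv = clique-sym F v w
      link-sym adv mid = refl
      link-sym adv lo  = refl
      link-sym adv hi  = refl
      link-sym mid adv = refl
      link-sym lo  adv = refl
      link-sym hi  adv = refl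
      link-sym lo  lo  = g-sym v w
      link-sym lo  mid = g-sym v w
      link-sym lo  hi  = g-sym v w
      link-sym mid lo  = g-sym v w
      link-sym mid mid = g-sym v w
      link-sym mid hi  = g-sym v w
      link-sym hi  lo  = g-sym v w
      link-sym hi  mid = g-sym v w
      link-sym hi  hi  = g-sym v w

    attacked-irr : Irreflexive attacked
    attacked-irr v with cls v
    ... | adv = clique-irr F v
    ... | lo  = g-irr v
    ... | mid = g-irr v
    ... | hi  = g-irr v

    attacked-local : ∀ v w → on adv v ≡ false → on adv w ≡ false → attacked v w ≡ g v w
    attacked-local v w ev ew with cls v | cls w
    ... | lo  | lo  = refl
    ... | lo  | mid = refl
    ... | lo  | hi  = refl
    ... | mid | lo  = refl
    ... | mid | mid = refl
    ... | mid | hi  = refl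
    ... | hi  | lo  = refl
    ... | hi  | mid = refl
    ... | hi  | hi  = refl

    private
      EM-row : ∀ v → on mid v ≡ false → ∀ w → EM.edge v w ≡ false
      EM-row v e = countF≡0⇒none (trans (EM.row v) (cong (λ s → ind s * x v) e))

      ER-row : ∀ v → on lo v ≡ false → on hi v ≡ false → ∀ w → ER.edge v w ≡ false
      ER-row v e e′ = countF≡0⇒none (trans (ER.row v) (cong₂ (λ s t → ind s * low + ind t * high) e e′))

      EM-col : ∀ v w → on adv w ≡ false → EM.edge v w ≡ false
      EM-col v w e with EM.edge v w in eq
      ... | false = refl
      ... | true  = ⊥-elim (false≢true (trans (sym e) (EM.inside v w eq)))

      ER-col : ∀ v w → on adv w ≡ false → ER.edge v w ≡ false
      ER-col v w e with ER.edge v w in eq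
      ... | false = refl
      ... | true  = ⊥-elim (false≢true (trans (sym e) (ER.inside v w eq)))

    degree-lo : ∀ v → cls v ≡ lo → countF (attacked v) ≡ outer v + low
    degree-lo v ev = trans (countF-∪ split) (cong (outer v +_) row)
      where
      row : countF (ER.edge v) ≡ low
      row = trans (ER.row v) (trans (cong (λ c → ind (is lo c) * low + ind (is hi c) * high) ev)
              (trans (+-identityʳ (1 * low)) (*-identityˡ low)))
      split : ∀ w → ind (attacked v w) ≡ ind (not (on adv w) ∧ g v w) + ind (ER.edge v w)
      split w rewrite ev with cls w in ew
      ... | adv = refl
      ... | lo  rewrite ER-col v w (cong (is adv) ew) = sym (+-identityʳ _)
      ... | mid rewrite ER-col v w (cong (is adv) ew) = sym (+-identityʳ _)
      ... | hi  rewrite ER-col v w (cong (is adv) ew) = sym (+-identityʳ _)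

    degree-hi : ∀ v → cls v ≡ hi → countF (attacked v) ≡ outer v + high
    degree-hi v ev = trans (countF-∪ split) (cong (outer v +_) row)
      where
      row : countF (ER.edge v) ≡ high
      row = trans (ER.row v) (trans (cong (λ c → ind (is lo c) * low + ind (is hi c) * high) ev)
              (*-identityˡ high))
      split : ∀ w → ind (attacked v w) ≡ ind (not (on adv w) ∧ g v w) + ind (ER.edge v w)
      split w rewrite ev with cls w in ew
      ... | adv = refl
      ... | lo  rewrite ER-col v w (cong (is adv) ew) = sym (+-identityʳ _)
      ... | mid rewrite ER-col v w (cong (is adv) ew) = sym (+-identityʳ _)
      ... | hi  rewrite ER-col v w (cong (is adv) ew) = sym (+-identityʳ _)

    private
      row-mid : ∀ v → cls v ≡ mid → countF (EM.edge v) ≡ x v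
      row-mid v ev = trans (EM.row v) (trans (cong (λ c → ind (is mid c) * x v) ev) (*-identityˡ (x v)))

    degree-mid : ∀ v → cls v ≡ mid → countF (attacked v) ≡ outer v + x v
    degree-mid v ev = trans (countF-∪ split) (cong (outer v +_) (row-mid v ev))
      where
      split : ∀ w → ind (attacked v w) ≡ ind (not (on adv w) ∧ g v w) + ind (EM.edge v w)
      split w rewrite ev with cls w in ew
      ... | adv = refl
      ... | lo  rewrite EM-col v w (cong (is adv) ew) = sym (+-identityʳ _)
      ... | mid rewrite EM-col v w (cong (is adv) ew) = sym (+-identityʳ _)
      ... | hi  rewrite EM-col v w (cong (is adv) ew) = sym (+-identityʳ _)

    private
      clique-outside : ∀ w v → on adv v ≡ false → clique F w v ≡ false
      clique-outside w v e with F v in eq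
      ... | false = Boolₚ.∧-zeroʳ (F w)
      ... | true  = ⊥-elim (false≢true (trans (sym e) (F⊆adv v eq)))

    degree-adv : ∀ w → cls w ≡ adv → countF (attacked w) ≡ EM.col w + ER.col w + countF (clique F w)
    degree-adv w ew = begin
      countF (attacked w)                                      ≡⟨ countF≡sumF (attacked w) ⟩
      sumF (λ v → ind (attacked w v))                          ≡⟨ sumF-cong split ⟩
      sumF (λ v → em v + er v + c v)                           ≡⟨ sumF-+ (λ v → em v + er v) c ⟩
      sumF (λ v → em v + er v) + sumF c                        ≡⟨ cong (_+ sumF c) (sumF-+ em er) ⟩
      sumF em + sumF er + sumF c
        ≡⟨ cong₂ _+_ (cong₂ _+_ (countF≡sumF (λ v → EM.edge v w)) (countF≡sumF (λ v → ER.edge v w))) (countF≡sumF (clique F w)) ⟨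
      EM.col w + ER.col w + countF (clique F w)                ∎
      where
      open ≡-Reasoning
      em er c : Fin n → ℕ
      em v = ind (EM.edge v w)
      er v = ind (ER.edge v w)
      c v = ind (clique F w v)
      split : ∀ v → ind (attacked w v) ≡ em v + er v + c v
      split v rewrite ew with cls v in ev
      ... | adv rewrite EM-row v (cong (is mid) ev) w | ER-row v (cong (is lo) ev) (cong (is hi) ev) w = refl
      ... | lo  rewrite EM-row v (cong (is mid) ev) w | clique-outside w v (cong (is adv) ev) = sym (+-identityʳ _)
      ... | hi  rewrite EM-row v (cong (is mid) ev) w | clique-outside w v (cong (is adv) ev) = sym (+-identityʳ _)
      ... | mid rewrite ER-row v (cong (is lo) ev) (cong (is hi) ev) w | clique-outside w v (cong (is adv) ev) =
        sym (trans (+-identityʳ _) (+-identityʳ _))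

    inner-mid : ∀ v → cls v ≡ mid →
                countF (λ w → remains (cls w) ∧ attacked v w) ≡ inner v + x v
    inner-mid v ev = trans (countF-∪ split) (cong (inner v +_) (row-mid v ev))
      where
      split : ∀ w → ind (remains (cls w) ∧ attacked v w) ≡ ind (on mid w ∧ g v w) + ind (EM.edge v w)
      split w rewrite ev with cls w in ew
      ... | adv = refl
      ... | lo  rewrite EM-col v w (cong (is adv) ew) = refl
      ... | mid rewrite EM-col v w (cong (is adv) ew) = sym (+-identityʳ _)
      ... | hi  rewrite EM-col v w (cong (is adv) ew) = refl

    inner-adv : ∀ w → cls w ≡ adv →
                countF (λ v → remains (cls v) ∧ attacked w v) ≡ EM.col w + countF (clique F w)
    inner-adv w ew = countF-∪ split
      where
      split : ∀ v → ind (remains (cls v) ∧ attacked w v) ≡ ind (EM.edge v w) + ind (clique F w v)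
      split v rewrite ew with cls v in ev
      ... | adv rewrite EM-row v (cong (is mid) ev) w = refl
      ... | lo  rewrite EM-row v (cong (is mid) ev) w | clique-outside w v (cong (is adv) ev) = refl
      ... | hi  rewrite EM-row v (cong (is mid) ev) w | clique-outside w v (cong (is adv) ev) = refl
      ... | mid rewrite clique-outside w v (cong (is adv) ev) = sym (+-identityʳ _)

    graph : Fin n → Fin n → Bool
    graph = adj attacked

    graph≡ : ∀ v w → graph v w ≡ attacked v w
    graph≡ = adj-realizes attacked attacked-sym attacked-irr

    private
      deg≡ : ∀ v → deg graph v ≡ countF (attacked v)
      deg≡ v = countF-cong (graph≡ v)

    -- `θ` stands in for the outer degrees when `lo` and `hi` are compared with corrupted vertices.
    -- The clique is left out of `above-lo`, since it only adds edges, and counted in `below-hi`.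
    module Kept
      (lo≤mid′ : ∀ v → cls v ≡ mid → low < x v) (mid≤hi′ : ∀ v → cls v ≡ mid → x v < high) (low<high : low < high)
      (θ : ℕ) (lo≤θ : ∀ l → cls l ≡ lo → outer l ≤ θ) (θ≤hi : ∀ h → cls h ≡ hi → θ ≤ outer h)
      (above-lo : ∀ w → cls w ≡ adv → θ + low < EM.col w + ER.col w)
      (below-hi : ∀ w → cls w ≡ adv → EM.col w + ER.col w + countF (clique F w) < θ + high)
      where

      private
        lo< : ∀ l v → cls l ≡ lo → on lo v ≡ false → deg graph l < deg graph v
        lo< l v el ev = subst (_< deg graph v) (sym (trans (deg≡ l) (degree-lo l el)))
                          (by-class (cls v) refl ev)
          where
          by-class : ∀ c → cls v ≡ c → is lo c ≡ false → outer l + low < deg graph v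
          by-class mid e _ = subst (outer l + low <_) (sym (trans (deg≡ v) (degree-mid v e)))
            (+-mono-≤-< (lo≤mid l v el e) (lo≤mid′ v e))
          by-class hi  e _ = subst (outer l + low <_) (sym (trans (deg≡ v) (degree-hi v e)))
            (+-mono-≤-< (lo≤hi l v el e) low<high)
          by-class adv e _ = subst (outer l + low <_) (sym (trans (deg≡ v) (degree-adv v e)))
            (<-≤-trans (≤-<-trans (+-monoˡ-≤ low (lo≤θ l el)) (above-lo v e)) (m≤m+n _ _))

        <hi : ∀ v h → on hi v ≡ false → cls h ≡ hi → deg graph v < deg graph h
        <hi v h ev eh = subst (deg graph v <_) (sym (trans (deg≡ h) (degree-hi h eh)))
                          (by-class (cls v) refl ev)
          where
          by-class : ∀ c → cls v ≡ c → is hi c ≡ false → deg graph v < outer h + high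
          by-class lo  e _ = subst (_< outer h + high) (sym (trans (deg≡ v) (degree-lo v e)))
            (+-mono-≤-< (lo≤hi v h e eh) low<high)
          by-class mid e _ = subst (_< outer h + high) (sym (trans (deg≡ v) (degree-mid v e)))
            (+-mono-≤-< (mid≤hi v h e eh) (mid≤hi′ v e))
          by-class adv e _ = subst (_< outer h + high) (sym (trans (deg≡ v) (degree-adv v e)))
            (<-≤-trans (below-hi v e) (+-monoˡ-≤ high (θ≤hi h eh)))

      -- `lo<` and `<hi` are strict in the degree, so ties, which `before` breaks by index, never
      -- occur across these cuts.
      kept-remains : ∀ v → kept graph k v ≡ remains (cls v)
      kept-remains = kept-middle graph k (on lo) (on hi) |lo| |hi|
        (λ l v el ev → before-intro graph k {l} {v} (inj₁ (lo< l v (is-sound lo _ el) ev)))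
        (λ v h ev eh → before-intro graph k {v} {h} (inj₁ (<hi v h ev (is-sound hi _ eh))))

      degH-mid : ∀ v → cls v ≡ mid → degH graph k v ≡ inner v + x v
      degH-mid v ev = trans (countF-cong (λ w → cong₂ _∧_ (kept-remains w) (graph≡ v w))) (inner-mid v ev)

      degH-adv : ∀ w → cls w ≡ adv → degH graph k w ≡ EM.col w + countF (clique F w)
      degH-adv w ew = trans (countF-cong (λ v → cong₂ _∧_ (kept-remains v) (graph≡ w v))) (inner-adv w ew)

  record Outcome {n} (g : Fin n → Fin n → Bool) (k r j₁ j₂ : ℕ) : Set where
    field
      corrupted : Fin n → Bool
      |corrupted| : countF corrupted ≡ 48 * r
      attack    : Mat n
      local     : ∀ v w → corrupted v ≡ false → corrupted w ≡ false → adj attack v w ≡ g v w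
      far       : Far (adj attack) k r j₁ j₂

  -- Extreme cases: corrupted vertices complete or isolated

  module Override {n b k : ℕ} {g : Fin n → Fin n → Bool} (C : Classes g b k)
    (g-sym : Symmetric g) (g-irr : Irreflexive g) (β : Bool) where

    open Classes C

    override : Mat n
    override v w = if on adv v ∨ on adv w then β ∧ not (v == w) else g v w

    override-sym : Symmetric override
    override-sym v w rewrite ==-sym v w with on adv v | on adv w
    ... | true  | true  = refl
    ... | true  | false = refl
    ... | false | true  = refl
    ... | false | false = g-sym v w

    override-irr : Irreflexive override
    override-irr v rewrite ==-refl v with on adv v
    ... | true  = Boolₚ.∧-zeroʳ β
    ... | false = g-irr v

    override-local : ∀ v w → on adv v ≡ false → on adv w ≡ false → override v w ≡ g v w
    override-local v w ev ew rewrite ev | ew = refl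

    graph : Fin n → Fin n → Bool
    graph = adj override

    graph≡ : ∀ v w → graph v w ≡ override v w
    graph≡ = adj-realizes override override-sym override-irr

    deg-outer : ∀ v → on adv v ≡ false → deg graph v ≡ outer v + countF (λ w → β ∧ on adv w)
    deg-outer v ev = trans (countF-cong (graph≡ v)) (countF-∪ split)
      where
      split : ∀ w → ind (override v w) ≡ ind (not (on adv w) ∧ g v w) + ind (β ∧ on adv w)
      split w rewrite ev with on adv w in ew
      ... | false rewrite Boolₚ.∧-zeroʳ β = sym (+-identityʳ _)
      ... | true with v == w in e
      ...   | false = refl
      ...   | true with refl ← ==-sound v w e = ⊥-elim (false≢true (trans (sym ev) ew))

    deg-adv : ∀ v → on adv v ≡ true → deg graph v ≡ countF (λ w → β ∧ not (v == w))
    deg-adv v ev = countF-cong (λ w → trans (graph≡ v w) (cong (λ t → if t ∨ on adv w then β ∧ not (v == w) else g v w) ev))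

  private
    k-bound : ∀ {n k r j₁ j₂} → Sizes n k r j₁ j₂ → 1 ≤ r
    k-bound S = ≤-trans (s≤s z≤n) (Sizes.r-large S)

  module Extremes {n k r j₁ j₂ : ℕ} (S : Sizes n k r j₁ j₂) {g : Fin n → Fin n → Bool}
    (g-sym : Symmetric g) (g-irr : Irreflexive g) (C : Classes g (48 * r) k)
    (A : ℕ) (A+2b : A + (48 * r + 48 * r) ≡ n) where

    open Sizes S
    open Classes C

    private
      1≤r : 1 ≤ r
      1≤r = k-bound S

    -- Half of m plus the `2k` deleted vertices is n/2 + k, at most 3n/4 by `k-small`. The bound
    -- 7A/8 leaves about n/8 for the terms in `r`.
    outcome-high : (∀ v → cls v ≡ mid ⊎ cls v ≡ hi → 7 * A ≤ 8 * outer v) → Outcome g k r j₁ j₂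
    outcome-high large = record
      { corrupted = on adv ; |corrupted| = |adv| ; attack = O.override
      ; local = λ v w ev ew → trans (O.graph≡ v w) (O.override-local v w ev ew)
      ; far = far-if-few-low S O.graph (adj-sym O.override) (adj-irr O.override) (j₁ + r) t-large few }
      where
      module O = Override C g-sym g-irr true
      t-large : j₁ + j₂ + r ≤ 2 * (j₁ + r)
      t-large = linear 0 (+-mono-≤ j₂≤ 1≤r) (solve (j₁ ∷ j₂ ∷ r ∷ []))
      high-enough : ∀ v → 7 * A ≤ 8 * outer v → j₁ + r + (k + k) ≤ outer v + 48 * r
      high-enough v 7A≤ = *-cancelˡ-≤ 8 (arith (outer v) 7A≤)
        where
        arith : ∀ o → 7 * A ≤ 8 * o → 8 * (j₁ + r + (k + k)) ≤ 8 * (o + 48 * r)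
        arith o 7A≤ = linear (184 * r + 4)
          (+-mono-≤ (+-mono-≤ (+-mono-≤ (+-mono-≤ (+-mono-≤ 7A≤ (scale 7 (≤-reflexive (sym A+2b))))
            (scale 4 (≤-reflexive total))) (scale 4 j₁≤j₂)) (scale 2 k-small)) r-small)
          (solve (A ∷ o ∷ n ∷ k ∷ r ∷ j₁ ∷ j₂ ∷ []))
      adv-enough : ∀ d → suc d ≡ n → j₁ + r + (k + k) ≤ d
      adv-enough d d≡ = ≤-pred (*-cancelˡ-≤ 4 (subst (λ x → 4 * suc (j₁ + r + (k + k)) ≤ 4 * x) (sym d≡)
        (linear (474 * r)
          (+-mono-≤ (+-mono-≤ (+-mono-≤ (+-mono-≤ (scale 2 (≤-reflexive total)) (scale 2 j₁≤j₂)) k-small) r-small) (scale 2 1≤r))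
          (solve (n ∷ k ∷ r ∷ j₁ ∷ j₂ ∷ [])))))
      large-degree : ∀ v → on lo v ≡ false → j₁ + r + (k + k) ≤ deg O.graph v
      large-degree v ¬lo = by-class (cls v) refl ¬lo
        where
        outside : on adv v ≡ false → 7 * A ≤ 8 * outer v → j₁ + r + (k + k) ≤ deg O.graph v
        outside e 7A≤ = subst (j₁ + r + (k + k) ≤_)
          (sym (trans (O.deg-outer v e) (cong (outer v +_) |adv|))) (high-enough v 7A≤)
        by-class : ∀ c → cls v ≡ c → is lo c ≡ false → j₁ + r + (k + k) ≤ deg O.graph v
        by-class mid e _ = outside (cong (is adv) e) (large v (inj₁ e))
        by-class hi  e _ = outside (cong (is adv) e) (large v (inj₂ e))
        by-class adv e _ = subst (j₁ + r + (k + k) ≤_) (sym (O.deg-adv v (cong (is adv) e)))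
          (adv-enough _ (trans (cong (_+ countF (not ∘ (v ==_))) (sym (countF-== v))) (countF-not (v ==_))))
      few : countF (λ v → deg O.graph v <ᵇ (j₁ + r + (k + k))) ≤ k
      few = subst (countF (λ v → deg O.graph v <ᵇ (j₁ + r + (k + k))) ≤_) |lo| (countF-mono ⊆lo)
        where
        ⊆lo : ∀ v → (deg O.graph v <ᵇ (j₁ + r + (k + k))) ≡ true → on lo v ≡ true
        ⊆lo v lt with on lo v in e
        ... | true  = refl
        ... | false = ⊥-elim (<⇒≱ (≤ᵇ-sound lt) (large-degree v e))

    -- By `k-small`, m/2 is at least n/4, whereas all vertices outside `hi` have degree at most A/8.
    outcome-low : (q : ℕ) → q * 8 ≤ A → (∀ v → cls v ≡ lo ⊎ cls v ≡ mid → outer v ≤ q) → Outcome g k r j₁ j₂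
    outcome-low q 8q≤A small = record
      { corrupted = on adv ; |corrupted| = |adv| ; attack = O.override
      ; local = λ v w ev ew → trans (O.graph≡ v w) (O.override-local v w ev ew)
      ; far = far-if-few-high S O.graph (adj-sym O.override) (adj-irr O.override) q t-small few }
      where
      module O = Override C g-sym g-irr false
      t-small : 2 * q + r ≤ j₁ + j₂
      t-small = *-cancelˡ-≤ 4 (linear (568 * r)
        (+-mono-≤ (+-mono-≤ (+-mono-≤ (+-mono-≤ (+-mono-≤ 8q≤A (≤-reflexive A+2b)) (scale 4 (≤-reflexive (sym total))))
          (scale 2 k-small)) r-small) (scale 4 1≤r))
        (solve (q ∷ A ∷ n ∷ k ∷ r ∷ j₁ ∷ j₂ ∷ [])))
      none-adv : countF {n} (λ w → false) ≡ 0
      none-adv = countF-none {n} {P = λ _ → false} (λ _ → refl)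
      small-degree : ∀ v → on hi v ≡ false → deg O.graph v ≤ q
      small-degree v ¬hi = by-class (cls v) refl ¬hi
        where
        outside : on adv v ≡ false → outer v ≤ q → deg O.graph v ≤ q
        outside e le = subst (_≤ q)
          (sym (trans (O.deg-outer v e) (trans (cong (outer v +_) none-adv) (+-identityʳ _)))) le
        by-class : ∀ c → cls v ≡ c → is hi c ≡ false → deg O.graph v ≤ q
        by-class lo  e _ = outside (cong (is adv) e) (small v (inj₁ e))
        by-class mid e _ = outside (cong (is adv) e) (small v (inj₂ e))
        by-class adv e _ = subst (_≤ q) (sym (trans (O.deg-adv v (cong (is adv) e)) none-adv)) z≤n
      few : countF (λ v → not (deg O.graph v ≤ᵇ q)) ≤ k
      few = subst (countF (λ v → not (deg O.graph v ≤ᵇ q)) ≤_) |hi| (countF-mono ⊆hi)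
        where
        ⊆hi : ∀ v → not (deg O.graph v ≤ᵇ q) ≡ true → on hi v ≡ true
        ⊆hi v gt with on hi v in e
        ... | true  = refl
        ... | false = ⊥-elim (false≢true (trans (sym (cong not (≤ᵇ-true (small-degree v e)))) gt))

  -- The balanced case: raising the median and adding the clique

  ∅ : ∀ {n} → Fin n → Bool
  ∅ _ = false

  |∅| : ∀ n → countF (∅ {n}) ≡ 0
  |∅| n = countF-none {n} {P = ∅} (λ _ → refl)

  -- `τ` is `j₁ - 2b`. Already `j₁ - b` would leave room for the corrupted vertices among the
  -- exceptions below the median, but the second `b` increases the excess of raised over lowered
  -- vertices from about `b` to about `3b`, enough to lift the corrupted vertices as well.
  middle-size : ∀ M b k n {j₁ j₂} δ τ → M + b + (k + k) ≡ n → suc (j₁ + j₂) + (k + k) ≡ n →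
                τ + (b + b) ≡ j₁ → j₁ + δ ≡ j₂ → M ≡ τ + (τ + 3 * b + 1 + δ)
  middle-size M b k n δ τ |mid| total refl refl = +-cancelʳ-≡ (b + (k + k)) _ _ (begin
    M + (b + (k + k))                                ≡⟨ +-assoc M b (k + k) ⟨
    M + b + (k + k)                                  ≡⟨ |mid| ⟩
    n                                                ≡⟨ total ⟨
    suc (τ + (b + b) + (τ + (b + b) + δ)) + (k + k)  ≡⟨ solve (τ ∷ b ∷ δ ∷ k ∷ []) ⟩
    τ + (τ + 3 * b + 1 + δ) + (b + (k + k))          ∎)
    where open ≡-Reasoning

  -- Against `z + 6 * r` everywhere, one side loses `r` per vertex and the other gains `r`, so only
  -- the difference of the sizes counts.
  middle-sum : ∀ M b δ τ z r → M ≡ τ + (τ + 3 * b + 1 + δ) →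
               τ * (z + 5 * r) + (τ + 3 * b + 1 + δ) * (z + 7 * r) ≡ M * (z + 6 * r) + r * (3 * b + 1 + δ)
  middle-sum M b δ τ z r refl = solve (b ∷ δ ∷ τ ∷ z ∷ r ∷ [])

  -- With y corrupted neighbours on average, a corrupted vertex has degree about
  -- (A + b) y / b, which A y ≈ θ b turns into θ + y.
  module Middle {n k r j₁ j₂ : ℕ} (S : Sizes n k r j₁ j₂) {g : Fin n → Fin n → Bool}
    (g-sym : Symmetric g) (g-irr : Irreflexive g) (C : Classes g (48 * r) k)
    (A : ℕ) (A+2b : A + (48 * r + 48 * r) ≡ n)
    (θ z : ℕ) (lo≤θ : ∀ l → Classes.cls C l ≡ lo → Classes.outer C l ≤ θ)
    (θ≤hi : ∀ h → Classes.cls C h ≡ hi → θ ≤ Classes.outer C h)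
    (z≤36r : z ≤ 36 * r)
    (Ay≤ : A * (z + 6 * r) ≤ θ * (48 * r)) (<Ay : θ * (48 * r) < A * suc (z + 6 * r))
    where

    open Sizes S
    open Classes C

    1≤r : 1 ≤ r
    1≤r = ≤-trans (s≤s z≤n) r-large

    b y M : ℕ
    b = 48 * r
    y = z + 6 * r
    M = countF (on mid)

    private
      high = z + 12 * r

      high≤b : high ≤ b
      high≤b = linear {z + 12 * r} {48 * r} 0 z≤36r (solve (z ∷ r ∷ []))

      split-n : A + (b + b) ≡ M + b + (k + k)
      split-n = trans A+2b (sym |mid|)

      A-small : A + (b + b) ≤ 56 * (r * r)
      A-small = ≤-trans (≤-reflexive A+2b) n-small

      XR : Fin n → ℕ
      XR v = ind (on lo v) * z + ind (on hi v) * high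

      XR≤b : ∀ v → XR v ≤ countF (on adv)
      XR≤b v = ≤-trans (by-class (cls v)) (≤-trans high≤b (≤-reflexive (sym |adv|)))
        where
        by-class : ∀ c → ind (is lo c) * z + ind (is hi c) * high ≤ high
        by-class lo  = ≤-trans (≤-reflexive (trans (+-identityʳ _) (*-identityˡ z))) (m≤m+n z _)
        by-class hi  = ≤-reflexive (*-identityˡ high)
        by-class mid = z≤n
        by-class adv = z≤n

      ER : Design (on adv) XR
      ER = design (on adv) XR XR≤b

      sum-XR : sumF XR ≡ k * z + k * high
      sum-XR = begin
        sumF XR
          ≡⟨ sumF-+ (λ v → ind (on lo v) * z) (λ v → ind (on hi v) * high) ⟩
        sumF (λ v → ind (on lo v) * z) + sumF (λ v → ind (on hi v) * high)
          ≡⟨ cong₂ _+_ (sumF-*ʳ (ind ∘ on lo) z) (sumF-*ʳ (ind ∘ on hi) high) ⟩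
        sumF (ind ∘ on lo) * z + sumF (ind ∘ on hi) * high
          ≡⟨ cong₂ (λ s t → s * z + t * high) (trans (sym (countF≡sumF (on lo))) |lo|) (trans (sym (countF≡sumF (on hi))) |hi|) ⟩
        k * z + k * high ∎
        where open ≡-Reasoning

      module ER = Design ER

      adv∈ : ∀ w → cls w ≡ adv → on adv w ≡ true
      adv∈ w e = cong (is adv) e

      R-lower : ∀ w → cls w ≡ adv → k * z + k * high ≤ b * ER.col w + b
      R-lower w e = subst₂ (λ s t → s ≤ t * ER.col w + t) sum-XR |adv| (col-lower ER w (adv∈ w e))

      R-upper : ∀ w → cls w ≡ adv → b * ER.col w ≤ k * z + k * high + b
      R-upper w e = subst₂ (λ s t → t * ER.col w ≤ s + t) sum-XR |adv| (col-upper ER w (adv∈ w e))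

    record Variant (x c : Fin n → ℕ) (F : Fin n → Bool) : Set where
      field
        attack : Mat n
      graph : Fin n → Fin n → Bool
      graph = adj attack
      field
        local    : ∀ v w → on adv v ≡ false → on adv w ≡ false → graph v w ≡ g v w
        kept-H   : ∀ v → kept graph k v ≡ remains (cls v)
        degH-mid : ∀ v → cls v ≡ mid → degH graph k v ≡ inner v + x v
        degH-adv : ∀ w → cls w ≡ adv → degH graph k w ≡ c w + countF (clique F w)

    open Variant using (graph)

    -- `Δ` is the surplus of edges between middle and corrupted vertices over `y` per middle vertex.
    -- All variants share `col`, so two of them differ only in the clique.
    record Level (x : Fin n → ℕ) (Δ : ℕ) : Set where
      field
        col       : Fin n → ℕ
        col-lower′ : ∀ w → cls w ≡ adv → M * y + Δ ≤ b * col w + b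
        col-upper′ : ∀ w → cls w ≡ adv → b * col w ≤ M * y + Δ + b
        variant   : ∀ F → (∀ v → F v ≡ true → on adv v ≡ true) → countF F ≤ r → Variant x col F

    level : ∀ x Δ → (∀ v → cls v ≡ mid → z < x v) → (∀ v → cls v ≡ mid → x v < high) →
            sumF (λ v → ind (on mid v) * x v) ≡ M * y + Δ → Δ ≤ r * (3 * b + 2) → Level x Δ
    level x Δ z<x x<high sum-x Δ≤ = record
      { col = EM.col
      ; col-lower′ = M-lower
      ; col-upper′ = M-upper
      ; variant = λ F F⊆adv |F|≤r →
          let module At = Attacked C g-sym g-irr z high x EM ER F F⊆adv
              module Kp = At.Kept z<x x<high low<high θ lo≤θ θ≤hi
                (λ w e → column-lower M Δ k A θ z r (EM.col w) (ER.col w) 1≤r (M-lower w e) (R-lower w e) split-n A-small <Ay)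
                (λ w e → column-upper M Δ k A θ z r (EM.col w) (ER.col w) (countF (clique F w)) 1≤r
                  (M-upper w e) (R-upper w e) split-n Δ≤ Ay≤ (clique-degree< F r w 1≤r |F|≤r))
          in record
          { attack = At.attacked
          ; local = λ v w ev ew → trans (At.graph≡ v w) (At.attacked-local v w ev ew)
          ; kept-H = Kp.kept-remains
          ; degH-mid = Kp.degH-mid
          ; degH-adv = Kp.degH-adv } }
      where
      X≤b : ∀ v → ind (on mid v) * x v ≤ countF (on adv)
      X≤b v with cls v in e
      ... | mid = ≤-trans (≤-reflexive (*-identityˡ (x v))) (≤-trans (<⇒≤ (x<high v e)) (≤-trans high≤b (≤-reflexive (sym |adv|))))
      ... | lo  = z≤n
      ... | hi  = z≤n
      ... | adv = z≤n
      EM : Design (on adv) (λ v → ind (on mid v) * x v)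
      EM = design (on adv) (λ v → ind (on mid v) * x v) X≤b
      module EM = Design EM
      M-lower : ∀ w → cls w ≡ adv → M * y + Δ ≤ b * EM.col w + b
      M-lower w e = subst₂ (λ s t → s ≤ t * EM.col w + t) sum-x |adv| (col-lower EM w (adv∈ w e))
      M-upper : ∀ w → cls w ≡ adv → b * EM.col w ≤ M * y + Δ + b
      M-upper w e = subst₂ (λ s t → t * EM.col w ≤ s + t) sum-x |adv| (col-upper EM w (adv∈ w e))
      low<high : z < high
      low<high = linear {suc z} {z + 12 * r} (11 * r) 1≤r (solve (z ∷ r ∷ []))

    module Clique = Lowest (lowest (λ _ → 0) (on adv) r
      (≤-trans (m≤n*m r 48) (≤-reflexive (sym |adv|))))

    F₁ : Fin n → Bool
    F₁ = Clique.set

    private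
      remaining : ∀ {c} → remains c ≡ true → c ≡ mid ⊎ c ≡ adv
      remaining {mid} _ = inj₁ refl
      remaining {adv} _ = inj₂ refl

    |H| : countF (λ v → remains (cls v)) ≡ suc (j₁ + j₂)
    |H| = +-cancelʳ-≡ (k + k) _ _ (begin
      countF (λ v → remains (cls v)) + (k + k)   ≡⟨ cong (_+ (k + k)) (countF-∪ (λ v → parts (cls v))) ⟩
      M + countF (on adv) + (k + k)              ≡⟨ cong (λ t → M + t + (k + k)) |adv| ⟩
      M + b + (k + k)                            ≡⟨ |mid| ⟩
      n                                          ≡⟨ total ⟨
      suc (j₁ + j₂) + (k + k)                    ∎)
      where
      open ≡-Reasoning
      parts : ∀ c → ind (remains c) ≡ ind (is mid c) + ind (is adv c)
      parts lo  = refl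
      parts mid = refl
      parts hi  = refl
      parts adv = refl

    module _ {x c : Fin n → ℕ} (V₀ : Variant x c ∅) (V₁ : Variant x c F₁) where
      private
        module V₀ = Variant V₀
        module V₁ = Variant V₁

      clique-step : ∀ v → remains (cls v) ≡ true →
                    degH (graph V₀) k v + ind (F₁ v) * (r ∸ 1) ≤ degH (graph V₁) k v
      clique-step v h with remaining h
      ... | inj₁ e = ≤-reflexive (begin
        degH (graph V₀) k v + ind (F₁ v) * (r ∸ 1)  ≡⟨ cong (λ t → degH (graph V₀) k v + ind t * (r ∸ 1)) not-in-F ⟩
        degH (graph V₀) k v + 0                     ≡⟨ +-identityʳ _ ⟩
        degH (graph V₀) k v                         ≡⟨ V₀.degH-mid v e ⟩
        inner v + x v                       ≡⟨ V₁.degH-mid v e ⟨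
        degH (graph V₁) k v                         ∎)
        where
        open ≡-Reasoning
        not-in-F : F₁ v ≡ false
        not-in-F with F₁ v in ef
        ... | false = refl
        ... | true  = ⊥-elim (false≢true (trans (sym (cong (is adv) e)) (Clique.subset v ef)))
      ... | inj₂ e = subst₂ _≤_ (cong (_+ ind (F₁ v) * (r ∸ 1)) (sym (V₀.degH-adv v e))) (sym (V₁.degH-adv v e))
        (begin
          c v + countF (clique ∅ v) + ind (F₁ v) * (r ∸ 1) ≡⟨ cong (λ t → c v + t + ind (F₁ v) * (r ∸ 1)) (clique-out ∅ v refl) ⟩
          c v + 0 + ind (F₁ v) * (r ∸ 1)                   ≡⟨ cong (_+ ind (F₁ v) * (r ∸ 1)) (+-identityʳ (c v)) ⟩
          c v + ind (F₁ v) * (r ∸ 1)                       ≤⟨ +-monoʳ-≤ (c v) gain ⟩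
          c v + countF (clique F₁ v)                       ∎)
        where
        open ≤-Reasoning
        gain : ind (F₁ v) * (r ∸ 1) ≤ countF (clique F₁ v)
        gain = by-membership (F₁ v) refl
          where
          by-membership : ∀ t → F₁ v ≡ t → ind t * (r ∸ 1) ≤ countF (clique F₁ v)
          by-membership false _ = z≤n
          by-membership true ef = ≤-reflexive (trans (*-identityˡ (r ∸ 1))
            (cong (_∸ 1) (trans (sym Clique.size) (sym (clique-in F₁ v ef)))))

      -- The clique changes neither the kept set nor the kept degrees of `mid`, so this is
      -- `orderStat-shift` with shift 0 and no exceptions.
      clique-mono : ∀ j → j < suc (j₁ + j₂) → orderStat (graph V₀) k j ≤ orderStat (graph V₁) k j
      clique-mono j j<m = subst (_≤ orderStat (graph V₁) k j) (+-identityʳ _)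
        (orderStat-shift {g = graph V₀} {g′ = graph V₁} {k = k} V₀.kept-H V₁.kept-H ∅ ∅ 0 j (subst (j <_) (sym |H|) j<m)
          (≤-trans (≤-reflexive (cong₂ _+_ (|∅| n) (|∅| n))) z≤n)
          (λ v h _ → ≤-trans (+-monoʳ-≤ (degH (graph V₀) k v) z≤n) (clique-step v h))
          (λ _ _ ()))

      -- All corrupted vertices are kept, so every vertex of `F₁` adds its `r ∸ 1` new neighbours to
      -- the sum of kept degrees.
      clique-edges : 2 * edgesH (graph V₀) k + r * (r ∸ 1) ≤ 2 * edgesH (graph V₁) k
      clique-edges = begin
        2 * edgesH (graph V₀) k + r * (r ∸ 1)
          ≡⟨ cong₂ _+_ (twice-edgesH (graph V₀) k (adj-sym V₀.attack) (adj-irr V₀.attack)) (cong (_* (r ∸ 1)) (trans (sym Clique.size) (countF≡sumF F₁))) ⟩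
        sumF (λ v → ind (kept (graph V₀) k v) * degH (graph V₀) k v) + sumF (ind ∘ F₁) * (r ∸ 1)
          ≡⟨ cong (sumF (λ v → ind (kept (graph V₀) k v) * degH (graph V₀) k v) +_) (sumF-*ʳ (ind ∘ F₁) (r ∸ 1)) ⟨
        sumF (λ v → ind (kept (graph V₀) k v) * degH (graph V₀) k v) + sumF (λ v → ind (F₁ v) * (r ∸ 1))
          ≡⟨ sumF-+ (λ v → ind (kept (graph V₀) k v) * degH (graph V₀) k v) (λ v → ind (F₁ v) * (r ∸ 1)) ⟨
        sumF (λ v → ind (kept (graph V₀) k v) * degH (graph V₀) k v + ind (F₁ v) * (r ∸ 1))
          ≤⟨ sumF-mono step ⟩
        sumF (λ v → ind (kept (graph V₁) k v) * degH (graph V₁) k v)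
          ≡⟨ twice-edgesH (graph V₁) k (adj-sym V₁.attack) (adj-irr V₁.attack) ⟨
        2 * edgesH (graph V₁) k ∎
        where
        open ≤-Reasoning
        step : ∀ v → ind (kept (graph V₀) k v) * degH (graph V₀) k v + ind (F₁ v) * (r ∸ 1) ≤ ind (kept (graph V₁) k v) * degH (graph V₁) k v
        step v rewrite V₀.kept-H v | V₁.kept-H v with remains (cls v) in h
        ... | true  = subst₂ _≤_ (cong (_+ ind (F₁ v) * (r ∸ 1)) (sym (*-identityˡ (degH (graph V₀) k v)))) (sym (*-identityˡ (degH (graph V₁) k v))) (clique-step v h)
        ... | false with F₁ v in ef
        ...   | false = z≤n
        ...   | true  = ⊥-elim (false≢true (trans (sym h) (cong remains (is-sound adv _ (Clique.subset v ef)))))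

      -- The two variants have the same kept set but different numbers of
      -- edges, so one of the means is far from 1/2.
      choose : Apart (orderStat (graph V₀) k j₁ + orderStat (graph V₀) k j₂) (j₁ + j₂) r →
               Apart (orderStat (graph V₁) k j₁ + orderStat (graph V₁) k j₂) (j₁ + j₂) r → Outcome g k r j₁ j₂
      choose med₀ med₁ with ≤-total (4 * edgesH (graph V₀) k + r * (r ∸ 1)) (suc (j₁ + j₂) * (j₁ + j₂))
      ... | inj₁ le = record
        { corrupted = on adv ; |corrupted| = |adv| ; attack = V₀.attack ; local = V₀.local
        ; far = record { size = trans (countF-cong V₀.kept-H) |H| ; median-far = med₀ ; mean-far = inj₂ le } }
      ... | inj₂ ge = record
        { corrupted = on adv ; |corrupted| = |adv| ; attack = V₁.attack ; local = V₁.local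
        ; far = record { size = trans (countF-cong V₁.kept-H) |H| ; median-far = med₁
                       ; mean-far = inj₁ (raise (edgesH (graph V₀) k) (edgesH (graph V₁) k) (r * (r ∸ 1)) _ clique-edges ge) } }
        where
        -- The two values of 4E are at least `2 * D` apart: if the smaller one is not clearly `D`
        -- below `q`, the larger one is `D` above it.
        raise : ∀ e₀ e₁ D q → 2 * e₀ + D ≤ 2 * e₁ → q ≤ 4 * e₀ + D → q + D ≤ 4 * e₁
        raise e₀ e₁ D q h h′ = linear 0 (+-mono-≤ (scale 2 h) h′) (solve (e₀ ∷ e₁ ∷ D ∷ q ∷ []))

    -- U is so large that raising it creates enough edges to lift the degrees of
    -- the corrupted vertices by r as well, even if they lose the clique on F₁.
    module Raise (τ δ : ℕ) (j₁≡ : τ + (b + b) ≡ j₁) (j₂≡ : j₁ + δ ≡ j₂) where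

      private
        δ≤1 : δ ≤ 1
        δ≤1 = +-cancelˡ-≤ j₁ δ 1 (≤-trans (≤-reflexive j₂≡) (≤-trans j₂≤ (≤-reflexive (+-comm 1 j₁))))

        |M| : M ≡ τ + (τ + 3 * b + 1 + δ)
        |M| = middle-size M b k n δ τ |mid| total j₁≡ j₂≡

        -- `inner` rather than `outer`: with `y` corrupted neighbours for every middle vertex, kept
        -- degrees are ordered like `inner`.
        module T = Lowest (lowest inner (on mid) τ (≤-trans (m≤m+n τ _) (≤-reflexive (sym |M|))))

        U : Fin n → Bool
        U v = on mid v ∧ not (T.set v)

        T∪U : ∀ v → ind (on mid v) ≡ ind (T.set v) + ind (U v)
        T∪U v with T.set v in e
        ... | true  rewrite T.subset v e = refl
        ... | false = cong ind (sym (Boolₚ.∧-identityʳ (on mid v)))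

        |U| : countF U ≡ τ + 3 * b + 1 + δ
        |U| = +-cancelˡ-≡ τ _ _ (trans (cong (_+ countF U) (sym T.size)) (trans (sym (countF-∪ T∪U)) |M|))

        -- Lowering `T` offsets the raise on `U`. Without it the surplus would be `r * countF U`, of
        -- order n * r instead of b * r, and corrupted degrees could overtake those in `hi`.
        xU : Fin n → ℕ
        xU v = if T.set v then z + 5 * r else z + 7 * r

        Δ : ℕ
        Δ = r * (3 * b + 1 + δ)

        sum-xU : sumF (λ v → ind (on mid v) * xU v) ≡ M * y + Δ
        sum-xU = begin
          sumF (λ v → ind (on mid v) * xU v)
            ≡⟨ sumF-cong split ⟩
          sumF (λ v → ind (T.set v) * (z + 5 * r) + ind (U v) * (z + 7 * r))
            ≡⟨ sumF-+ (λ v → ind (T.set v) * (z + 5 * r)) (λ v → ind (U v) * (z + 7 * r)) ⟩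
          sumF (λ v → ind (T.set v) * (z + 5 * r)) + sumF (λ v → ind (U v) * (z + 7 * r))
            ≡⟨ cong₂ _+_ (sumF-*ʳ (ind ∘ T.set) (z + 5 * r)) (sumF-*ʳ (ind ∘ U) (z + 7 * r)) ⟩
          sumF (ind ∘ T.set) * (z + 5 * r) + sumF (ind ∘ U) * (z + 7 * r)
            ≡⟨ cong₂ (λ s t → s * (z + 5 * r) + t * (z + 7 * r)) (trans (sym (countF≡sumF T.set)) T.size) (trans (sym (countF≡sumF U)) |U|) ⟩
          τ * (z + 5 * r) + (τ + 3 * b + 1 + δ) * (z + 7 * r)
            ≡⟨ middle-sum M b δ τ z r |M| ⟩
          M * y + Δ ∎
          where
          open ≡-Reasoning
          split : ∀ v → ind (on mid v) * xU v ≡ ind (T.set v) * (z + 5 * r) + ind (U v) * (z + 7 * r)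
          split v with T.set v in e
          ... | true  rewrite T.subset v e = sym (+-identityʳ _)
          ... | false = cong (λ s → ind s * (z + 7 * r)) (sym (Boolₚ.∧-identityʳ (on mid v)))

        abstract
          base : Level (λ _ → y) 0
          base = level (λ _ → y) 0 (λ _ _ → z<y) (λ _ _ → y<high) sum-y z≤n
            where
            z<y : z < y
            z<y = linear {suc z} {z + 6 * r} (5 * r) 1≤r (solve (z ∷ r ∷ []))
            y<high : y < high
            y<high = linear {suc (z + 6 * r)} {z + 12 * r} (5 * r) 1≤r (solve (z ∷ r ∷ []))
            sum-y : sumF (λ v → ind (on mid v) * y) ≡ M * y + 0
            sum-y = trans (sumF-*ʳ (ind ∘ on mid) y)
              (trans (cong (_* y) (sym (countF≡sumF (on mid)))) (sym (+-identityʳ _)))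

          raised : Level xU Δ
          raised = level xU Δ (λ v _ → z<x v) (λ v _ → x<high v) sum-xU
            (scale r (≤-trans (≤-reflexive (+-assoc (3 * b) 1 δ)) (+-monoʳ-≤ (3 * b) (s≤s δ≤1))))
            where
            z<x : ∀ v → z < xU v
            z<x v with T.set v
            ... | true  = linear {suc z} {z + 5 * r} (4 * r) 1≤r (solve (z ∷ r ∷ []))
            ... | false = linear {suc z} {z + 7 * r} (6 * r) 1≤r (solve (z ∷ r ∷ []))
            x<high : ∀ v → xU v < high
            x<high v with T.set v
            ... | true  = linear {suc (z + 5 * r)} {z + 12 * r} (6 * r) 1≤r (solve (z ∷ r ∷ []))
            ... | false = linear {suc (z + 7 * r)} {z + 12 * r} (4 * r) 1≤r (solve (z ∷ r ∷ []))

        module Base = Level base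
        module Raised = Level raised

        ∅⊆adv : ∀ v → ∅ v ≡ true → on adv v ≡ true
        ∅⊆adv v ()

        B₀ : Variant (λ _ → y) Base.col ∅
        B₀ = Base.variant ∅ ∅⊆adv (≤-trans (≤-reflexive (|∅| n)) z≤n)
        B₁ : Variant (λ _ → y) Base.col F₁
        B₁ = Base.variant F₁ Clique.subset (≤-reflexive Clique.size)
        R₀ : Variant xU Raised.col ∅
        R₀ = Raised.variant ∅ ∅⊆adv (≤-trans (≤-reflexive (|∅| n)) z≤n)
        R₁ : Variant xU Raised.col F₁
        R₁ = Raised.variant F₁ Clique.subset (≤-reflexive Clique.size)

        module B₁ = Variant B₁
        module R₀ = Variant R₀

        lift-adv : ∀ w → cls w ≡ adv → degH (graph B₁) k w + r ≤ degH (graph R₀) k w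
        lift-adv w e = subst₂ _≤_ (cong (_+ r) (sym (B₁.degH-adv w e))) (sym (R₀.degH-adv w e))
          (≤-trans (column-shift M Δ y r (Base.col w) (Raised.col w) (countF (clique F₁ w)) 1≤r
              (Base.col-upper′ w e) (Raised.col-lower′ w e)
              (scale r (m≤m+n (3 * b + 1) δ))
              (clique-degree< F₁ r w 1≤r (≤-reflexive Clique.size)))
            (m≤m+n (Raised.col w) _))

        lift : ∀ v → remains (cls v) ≡ true → T.set v ≡ false → degH (graph B₁) k v + r ≤ degH (graph R₀) k v
        lift v h v∉T = by-class (remaining h)
          where
          open ≡-Reasoning
          rearrange : ∀ i z r → i + (z + 6 * r) + r ≡ i + (z + 7 * r)
          rearrange = solve-∀
          by-class : cls v ≡ mid ⊎ cls v ≡ adv → degH (graph B₁) k v + r ≤ degH (graph R₀) k v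
          by-class (inj₂ e) = lift-adv v e
          by-class (inj₁ e) = ≤-reflexive (begin
            degH (graph B₁) k v + r      ≡⟨ cong (_+ r) (B₁.degH-mid v e) ⟩
            inner v + (z + 6 * r) + r    ≡⟨ rearrange (inner v) z r ⟩
            inner v + (z + 7 * r)        ≡⟨ cong (λ t → inner v + (if t then z + 5 * r else z + 7 * r)) v∉T ⟨
            inner v + xU v               ≡⟨ R₀.degH-mid v e ⟨
            degH (graph R₀) k v          ∎)

        T-low : ∀ t v → T.set t ≡ true → remains (cls v) ≡ true → T.set v ≡ false → on adv v ≡ false →
                degH (graph B₁) k t ≤ degH (graph B₁) k v
        T-low t v t∈ h v∉ v∉adv = by-class (remaining h)
          where
          by-class : cls v ≡ mid ⊎ cls v ≡ adv → degH (graph B₁) k t ≤ degH (graph B₁) k v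
          by-class (inj₂ e) = ⊥-elim (false≢true (trans (sym v∉adv) (cong (is adv) e)))
          by-class (inj₁ e) = subst₂ _≤_ (sym (B₁.degH-mid t (is-sound mid _ (T.subset t t∈)))) (sym (B₁.degH-mid v e))
            (+-monoˡ-≤ y (T.minimal t v t∈ (cong (is mid) e) v∉))

        -- The corrupted vertices are lifted too, but nothing compares their kept degrees with those
        -- in `T`; hence `on adv` as the second exceptional set.
        stat-lift : ∀ j → j₁ ≤ j → j < suc (j₁ + j₂) → orderStat (graph B₁) k j + r ≤ orderStat (graph R₀) k j
        stat-lift j j₁≤j j<m = orderStat-shift {g = graph B₁} {g′ = graph R₀} {k = k} B₁.kept-H R₀.kept-H T.set (on adv) r j
          (subst (j <_) (sym |H|) j<m) few lift T-low
          where
          few : countF T.set + countF (on adv) ≤ j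
          few = begin
            countF T.set + countF (on adv)  ≡⟨ cong₂ _+_ T.size |adv| ⟩
            τ + b                           ≤⟨ +-monoʳ-≤ τ (m≤m+n b b) ⟩
            τ + (b + b)                     ≡⟨ j₁≡ ⟩
            j₁                              ≤⟨ j₁≤j ⟩
            j                               ∎
            where open ≤-Reasoning

        j₁<m : j₁ < suc (j₁ + j₂)
        j₁<m = s≤s (m≤m+n j₁ j₂)
        j₂<m : j₂ < suc (j₁ + j₂)
        j₂<m = s≤s (m≤n+m j₂ j₁)

      -- If the median of the base attack is not clearly too small, then that of
      -- the raised attack is clearly too large.
      outcome : Outcome g k r j₁ j₂
      outcome = by-size (≤-total (middle-sum-B + r) (j₁ + j₂))
        where
        middle-sum-B : ℕ
        middle-sum-B = orderStat (graph B₁) k j₁ + orderStat (graph B₁) k j₂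
        combine : ∀ s t s′ t′ j r → s + r ≤ s′ → t + r ≤ t′ → j ≤ s + t + r → j + r ≤ s′ + t′
        combine s t s′ t′ j r h h′ h″ = linear 0 (+-mono-≤ (+-mono-≤ h h′) h″) (solve (s ∷ t ∷ s′ ∷ t′ ∷ j ∷ r ∷ []))
        by-size : middle-sum-B + r ≤ j₁ + j₂ ⊎ j₁ + j₂ ≤ middle-sum-B + r → Outcome g k r j₁ j₂
        -- The clique only increases order statistics. Comparing the larger base variant `B₁` with
        -- the smaller raised variant `R₀` makes each verdict valid for both members of its pair,
        -- which leaves the clique free for the mean.
        by-size (inj₁ small) = choose B₀ B₁
          (inj₂ (≤-trans (+-monoˡ-≤ r (+-mono-≤ (clique-mono B₀ B₁ j₁ j₁<m) (clique-mono B₀ B₁ j₂ j₂<m))) small)) (inj₂ small)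
        by-size (inj₂ large) = choose R₀ R₁ (inj₁ large₀)
          (inj₁ (≤-trans large₀ (+-mono-≤ (clique-mono R₀ R₁ j₁ j₁<m) (clique-mono R₀ R₁ j₂ j₂<m))))
          where
          large₀ : j₁ + j₂ + r ≤ orderStat (graph R₀) k j₁ + orderStat (graph R₀) k j₂
          large₀ = combine (orderStat (graph B₁) k j₁) (orderStat (graph B₁) k j₂)
            (orderStat (graph R₀) k j₁) (orderStat (graph R₀) k j₂) (j₁ + j₂) r
            (stat-lift j₁ ≤-refl j₁<m) (stat-lift j₂ j₁≤j₂ j₂<m) large

  -- Choice of the threshold and of the case

  maxF : ∀ {n} → (Fin n → ℕ) → ℕ
  maxF {zero}  f = 0
  maxF {suc n} f = f Fin.zero ⊔ maxF (f ∘ Fin.suc)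

  ≤maxF : ∀ {n} (f : Fin n → ℕ) v → f v ≤ maxF f
  ≤maxF f Fin.zero    = m≤m⊔n _ _
  ≤maxF f (Fin.suc v) = ≤-trans (≤maxF (f ∘ Fin.suc) v) (m≤n⊔m (f Fin.zero) _)

  ⊔-elim : (P : ℕ → Set) → ∀ x y → P x → P y → P (x ⊔ y)
  ⊔-elim P x y px py with ⊔-sel x y
  ... | inj₁ e = subst P (sym e) px
  ... | inj₂ e = subst P (sym e) py

  maxF-elim : ∀ {n} (P : ℕ → Set) (f : Fin n → ℕ) → P 0 → (∀ v → P (f v)) → P (maxF f)
  maxF-elim {zero}  P f p0 pf = p0
  maxF-elim {suc n} P f p0 pf =
    ⊔-elim P (f Fin.zero) (maxF (f ∘ Fin.suc)) (pf Fin.zero) (maxF-elim P (f ∘ Fin.suc) p0 (pf ∘ Fin.suc))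

  quotient : ∀ a d → 1 ≤ d → ∃[ q ] q * d ≤ a × a < suc q * d
  quotient a (suc d) _ = a / suc d
    , ≤-trans (m≤n+m _ (a % suc d)) (≤-reflexive (sym (m≡m%n+[m/n]*n a (suc d))))
    , ≤-<-trans (≤-reflexive (m≡m%n+[m/n]*n a (suc d))) (+-monoˡ-< (a / suc d * suc d) (m%n<n a (suc d)))

  sizes-split : ∀ τ b j₂ k {j₁ n} → τ + (b + b) ≡ j₁ → suc (j₁ + j₂) + (k + k) ≡ n →
                τ + (b + suc j₂) + b + (k + k) ≡ n
  sizes-split τ b j₂ k refl refl = solve (τ ∷ b ∷ j₂ ∷ k ∷ [])

  outer-size : ∀ τ b j₂ k {j₁ n} → τ + (b + b) ≡ j₁ → suc (j₁ + j₂) + (k + k) ≡ n →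
               τ + suc j₂ + (k + k) + (b + b) ≡ n
  outer-size τ b j₂ k refl refl = solve (τ ∷ b ∷ j₂ ∷ k ∷ [])

  module _ {n k r j₁ j₂ : ℕ} (S : Sizes n k r j₁ j₂) (u : Mat n) where

    open Sizes S

    private
      1≤r : 1 ≤ r
      1≤r = ≤-trans (s≤s z≤n) r-large

      96r≤j₁ : 48 * r + 48 * r ≤ j₁
      96r≤j₁ = *-cancelˡ-≤ 4 (linear {4 * (48 * r + 48 * r)} {4 * j₁} (92 * r)
        (+-mono-≤ (+-mono-≤ (+-mono-≤ (+-mono-≤ r-small k-small) (scale 2 (≤-reflexive (sym total)))) (scale 2 j₂≤)) (scale 4 1≤r))
        (solve (n ∷ k ∷ r ∷ j₁ ∷ j₂ ∷ [])))

    outcome-middle : (C : Classes (adj u) (48 * r) k) (A q τ δ : ℕ) →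
      A + (48 * r + 48 * r) ≡ n → τ + (48 * r + 48 * r) ≡ j₁ → j₁ + δ ≡ j₂ →
      q * 8 ≤ A → A < suc q * 8 →
      (∀ l → Classes.cls C l ≡ lo → 8 * Classes.outer C l ≤ 7 * A) →
      (∀ h → Classes.cls C h ≡ hi → A < 8 * Classes.outer C h) → Outcome (adj u) k r j₁ j₂
    outcome-middle C A q τ δ A+2b j₁≡ j₂≡ 8q≤A A<8q lo-small hi-large =
      Middle.Raise.outcome S (adj-sym u) (adj-irr u) C A A+2b θ z lo≤θ θ≤hi z≤36r
        (≤-trans (≤-reflexive (trans (cong (A *_) z+6r) (*-comm A y))) yA≤)
        (<-≤-trans <yA (≤-reflexive (trans (*-comm (suc y) A) (cong (λ t → A * suc t) (sym z+6r)))))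
        τ δ j₁≡ j₂≡
      where
      open Classes C
      lo-outer : Fin n → ℕ
      lo-outer v = ind (on lo v) * outer v
      θ : ℕ
      -- `suc q` keeps `θ` above A/8, hence `y` at least 6r, when the lowest vertices have small
      -- outer degrees or, for `k = 0`, when there are none.
      θ = maxF lo-outer ⊔ suc q
      lo≤θ : ∀ l → cls l ≡ lo → outer l ≤ θ
      lo≤θ l e = ≤-trans (≤-trans (≤-reflexive (sym (trans (cong (λ c → ind (is lo c) * outer l) e) (*-identityˡ _))))
        (≤maxF lo-outer l)) (m≤m⊔n _ (suc q))
      on-lo : ∀ (P : ℕ → Set) v → P 0 → (cls v ≡ lo → P (outer v)) → P (lo-outer v)
      on-lo P v p0 p with cls v in e
      ... | lo  = subst P (sym (*-identityˡ (outer v))) (p refl)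
      ... | mid = p0
      ... | hi  = p0
      ... | adv = p0
      θ≤hi : ∀ h → cls h ≡ hi → θ ≤ outer h
      θ≤hi h e = ⊔-elim (_≤ outer h) (maxF lo-outer) (suc q)
        (maxF-elim (_≤ outer h) lo-outer z≤n (λ v → on-lo (_≤ outer h) v z≤n (λ el → lo≤hi v h el e)))
        (*-cancelˡ-< 8 q (outer h) (≤-<-trans (≤-reflexive (*-comm 8 q)) (≤-<-trans 8q≤A (hi-large h e))))
      8θ≤7A : 8 * θ ≤ 7 * A
      8θ≤7A = ⊔-elim (λ t → 8 * t ≤ 7 * A) (maxF lo-outer) (suc q)
        (maxF-elim (λ t → 8 * t ≤ 7 * A) lo-outer z≤n (λ v → on-lo (λ t → 8 * t ≤ 7 * A) v z≤n (lo-small v)))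
        (linear {8 * suc q} {7 * A} (5 * A + 376 * r)
          (+-mono-≤ (+-mono-≤ (+-mono-≤ 8q≤A r-small) (scale 8 1≤r)) (≤-reflexive (sym A+2b)))
          (solve (q ∷ A ∷ n ∷ r ∷ [])))
      A<8θ : A < θ * 8
      A<8θ = <-≤-trans A<8q (*-monoˡ-≤ 8 (m≤n⊔m (maxF lo-outer) (suc q)))
      1≤A : 1 ≤ A
      1≤A = linear {1} {A} (383 * r) (+-mono-≤ (+-mono-≤ r-small (≤-reflexive (sym A+2b))) 1≤r) (solve (A ∷ n ∷ r ∷ []))
      y-spec : ∃[ y ] y * A ≤ θ * (48 * r) × θ * (48 * r) < suc y * A
      y-spec = quotient (θ * (48 * r)) A 1≤A
      y : ℕ
      y = proj₁ y-spec
      yA≤ : y * A ≤ θ * (48 * r)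
      yA≤ = proj₁ (proj₂ y-spec)
      <yA : θ * (48 * r) < suc y * A
      <yA = proj₂ (proj₂ y-spec)
      6r≤y : 6 * r ≤ y
      6r≤y = ≤-pred (*-cancelʳ-< A (6 * r) (suc y) (≤-<-trans
        (≤-trans (≤-reflexive (*-comm (6 * r) A)) (≤-trans (*-monoˡ-≤ (6 * r) (<⇒≤ A<8θ)) (≤-reflexive (rearrange θ r)))) <yA))
        where
        rearrange : ∀ θ r → θ * 8 * (6 * r) ≡ θ * (48 * r)
        rearrange = solve-∀
      y≤42r : y ≤ 42 * r
      y≤42r = *-cancelʳ-≤ y (42 * r) A {{>-nonZero 1≤A}} (≤-trans yA≤ (≤-trans (≤-reflexive (rearrange θ r))
        (≤-trans (*-monoʳ-≤ (6 * r) 8θ≤7A) (≤-reflexive (rearrange′ A r)))))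
        where
        rearrange : ∀ θ r → θ * (48 * r) ≡ 6 * r * (8 * θ)
        rearrange = solve-∀
        rearrange′ : ∀ A r → 6 * r * (7 * A) ≡ 42 * r * A
        rearrange′ = solve-∀
      z : ℕ
      z = y ∸ 6 * r
      z+6r : z + 6 * r ≡ y
      z+6r = m∸n+n≡m 6r≤y
      z≤36r : z ≤ 36 * r
      z≤36r = ≤-trans (∸-monoˡ-≤ (6 * r) y≤42r) (≤-reflexive (trans (cong (_∸ 6 * r) (*-distribʳ-+ r 36 6)) (m+n∸n≡m (36 * r) (6 * r))))

    outcome-of-classes : (C : Classes (adj u) (48 * r) k) (A q τ δ : ℕ) →
      A + (48 * r + 48 * r) ≡ n → τ + (48 * r + 48 * r) ≡ j₁ → j₁ + δ ≡ j₂ →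
      q * 8 ≤ A → A < suc q * 8 → Outcome (adj u) k r j₁ j₂
    outcome-of-classes C A q τ δ A+2b τ≡ δ≡ 8q≤A A<8q =
      by-cases (argmin (λ _ → 0) high-lo) (argmin (λ _ → 0) low-hi)
      where
      open Classes C
      high-lo low-hi : Fin n → Bool
      high-lo v = on lo v ∧ (7 * A ≤ᵇ 8 * outer v)
      low-hi v = on hi v ∧ (8 * outer v ≤ᵇ A)
      not-large : ∀ l → cls l ≡ lo → high-lo l ≡ false → 8 * outer l ≤ 7 * A
      not-large l e none = ≮⇒≥ (λ lt → false≢true (trans (sym none) (∧-intro (cong (is lo) e) (≤ᵇ-true (<⇒≤ lt)))))
      not-small : ∀ h → cls h ≡ hi → low-hi h ≡ false → A < 8 * outer h
      not-small h e none = ≰⇒> (λ le → false≢true (trans (sym none) (∧-intro (cong (is hi) e) (≤ᵇ-true le))))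
      by-cases : (∀ v → high-lo v ≡ false) ⊎ (∃[ v ] high-lo v ≡ true × (∀ w → high-lo w ≡ true → 0 ≤ 0)) →
                 (∀ v → low-hi v ≡ false) ⊎ (∃[ v ] low-hi v ≡ true × (∀ w → low-hi w ≡ true → 0 ≤ 0)) →
                 Outcome (adj u) k r j₁ j₂
      by-cases (inj₂ (l , l∈ , _)) _ = Extremes.outcome-high S (adj-sym u) (adj-irr u) C A A+2b λ
        { v (inj₁ e) → ≤-trans 7A≤ (*-monoʳ-≤ 8 (lo≤mid l v l-lo e))
        ; v (inj₂ e) → ≤-trans 7A≤ (*-monoʳ-≤ 8 (lo≤hi l v l-lo e)) }
        where
        l-lo : cls l ≡ lo
        l-lo = is-sound lo _ (proj₁ (∧-elim {on lo l} l∈))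
        7A≤ : 7 * A ≤ 8 * outer l
        7A≤ = ≤ᵇ-sound (proj₂ (∧-elim {on lo l} l∈))
      by-cases (inj₁ _) (inj₂ (h , h∈ , _)) = Extremes.outcome-low S (adj-sym u) (adj-irr u) C A A+2b q 8q≤A λ
        { v (inj₁ e) → ≤-trans (lo≤hi v h e h-hi) outer≤q
        ; v (inj₂ e) → ≤-trans (mid≤hi v h e h-hi) outer≤q }
        where
        h-hi : cls h ≡ hi
        h-hi = is-sound hi _ (proj₁ (∧-elim {on hi h} h∈))
        outer≤q : outer h ≤ q
        outer≤q = ≤-pred (*-cancelˡ-< 8 (outer h) (suc q)
          (≤-<-trans (≤ᵇ-sound (proj₂ (∧-elim {on hi h} h∈))) (<-≤-trans A<8q (≤-reflexive (*-comm (suc q) 8)))))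
      by-cases (inj₁ none-lo) (inj₁ none-hi) = outcome-middle C A q τ δ A+2b τ≡ δ≡ 8q≤A A<8q
        (λ l e → not-large l e (none-lo l)) (λ h e → not-small h e (none-hi h))

    outcome : Outcome (adj u) k r j₁ j₂
    outcome = split (m≤n⇒∃[o]m+o≡n 96r≤j₁) (m≤n⇒∃[o]m+o≡n j₁≤j₂)
      where
      b : ℕ
      b = 48 * r
      split : (∃[ τ ] b + b + τ ≡ j₁) → (∃[ δ ] j₁ + δ ≡ j₂) → Outcome (adj u) k r j₁ j₂
      split (τ , 2b+τ) (δ , j₁+δ) = outcome-of-classes
        -- There are `j₁ + j₂ + 1 - b` middle vertices and `A` is `n - 2b`; both are written through
        -- `τ` to avoid truncated subtraction.
        (classes (adj u) b k (τ + (b + suc j₂)) (sizes-split τ b j₂ k τ≡ total))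
        A (proj₁ q) τ δ (outer-size τ b j₂ k τ≡ total) τ≡ j₁+δ (proj₁ (proj₂ q)) (proj₂ (proj₂ q))
        where
        A : ℕ
        A = τ + suc j₂ + (k + k)
        q : ∃[ q ] q * 8 ≤ A × A < suc q * 8
        q = quotient A 8 (s≤s z≤n)
        τ≡ : τ + (b + b) ≡ j₁
        τ≡ = trans (+-comm τ (b + b)) 2b+τ

  -- Natural numbers as rationals

  open ℤ using (+_; -[1+_]; +≤+; +<+)

  ι-toℚᵘ : ∀ k → toℚᵘ (ℕtoℚ k) ℚᵘ.≃ mkℚᵘ (+ k) 0
  ι-toℚᵘ k = ℚₚ.toℚᵘ-fromℚᵘ (mkℚᵘ (+ k) 0)

  ι-+ : ∀ a b → ℕtoℚ (a + b) ≡ ℕtoℚ a ℚ.+ ℕtoℚ b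
  ι-+ a b = ℚₚ.toℚᵘ-injective (begin
    toℚᵘ (ℕtoℚ (a + b))                          ≈⟨ ι-toℚᵘ (a + b) ⟩
    mkℚᵘ (+ (a + b)) 0                           ≈⟨ *≡* (cong (ℤ._* + 1) (sym (cong₂ ℤ._+_ (ℤₚ.*-identityʳ (+ a)) (ℤₚ.*-identityʳ (+ b))))) ⟩
    mkℚᵘ (+ a) 0 ℚᵘ.+ mkℚᵘ (+ b) 0               ≈⟨ ℚᵘₚ.+-cong (ι-toℚᵘ a) (ι-toℚᵘ b) ⟨
    toℚᵘ (ℕtoℚ a) ℚᵘ.+ toℚᵘ (ℕtoℚ b)             ≈⟨ ℚₚ.toℚᵘ-homo-+ (ℕtoℚ a) (ℕtoℚ b) ⟨
    toℚᵘ (ℕtoℚ a ℚ.+ ℕtoℚ b)                     ∎)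
    where open ℚᵘₚ.≃-Reasoning

  ι-* : ∀ a b → ℕtoℚ (a * b) ≡ ℕtoℚ a ℚ.* ℕtoℚ b
  ι-* a b = ℚₚ.toℚᵘ-injective (begin
    toℚᵘ (ℕtoℚ (a * b))                          ≈⟨ ι-toℚᵘ (a * b) ⟩
    mkℚᵘ (+ (a * b)) 0                           ≈⟨ *≡* (cong (ℤ._* + 1) (ℤₚ.pos-* a b)) ⟩
    mkℚᵘ (+ a) 0 ℚᵘ.* mkℚᵘ (+ b) 0               ≈⟨ ℚᵘₚ.*-cong (ι-toℚᵘ a) (ι-toℚᵘ b) ⟨
    toℚᵘ (ℕtoℚ a) ℚᵘ.* toℚᵘ (ℕtoℚ b)             ≈⟨ ℚₚ.toℚᵘ-homo-* (ℕtoℚ a) (ℕtoℚ b) ⟨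
    toℚᵘ (ℕtoℚ a ℚ.* ℕtoℚ b)                     ∎)
    where open ℚᵘₚ.≃-Reasoning

  ι-mono-≤ : ∀ {a b} → a ≤ b → ℕtoℚ a ℚ.≤ ℕtoℚ b
  ι-mono-≤ {a} {b} a≤b = ℚₚ.toℚᵘ-cancel-≤
    (ℚᵘₚ.≤-respˡ-≃ (ℚᵘₚ.≃-sym (ι-toℚᵘ a)) (ℚᵘₚ.≤-respʳ-≃ (ℚᵘₚ.≃-sym (ι-toℚᵘ b))
      (*≤* (ℤₚ.*-monoʳ-≤-nonNeg (+ 1) (+≤+ a≤b)))))

  ι-cancel-≤ : ∀ {a b} → ℕtoℚ a ℚ.≤ ℕtoℚ b → a ≤ b
  ι-cancel-≤ {a} {b} h with ℚᵘₚ.≤-respˡ-≃ (ι-toℚᵘ a) (ℚᵘₚ.≤-respʳ-≃ (ι-toℚᵘ b) (ℚₚ.toℚᵘ-mono-≤ h))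
  ... | *≤* h′ = ℤₚ.drop‿+≤+ (subst₂ ℤ._≤_ (ℤₚ.*-identityʳ (+ a)) (ℤₚ.*-identityʳ (+ b)) h′)

  ι-mono-< : ∀ {a b} → a < b → ℕtoℚ a ℚ.< ℕtoℚ b
  ι-mono-< a<b = ℚₚ.≰⇒> (λ h → <⇒≱ a<b (ι-cancel-≤ h))

  ι-cancel-< : ∀ {a b} → ℕtoℚ a ℚ.< ℕtoℚ b → a < b
  ι-cancel-< h = ≰⇒> (λ b≤a → ℚₚ.<-irrefl refl (ℚₚ.<-≤-trans h (ι-mono-≤ b≤a)))

  ι-nonNeg : ∀ k → ℚ.NonNegative (ℕtoℚ k)
  ι-nonNeg k = ℚ.nonNegative (ι-mono-≤ {0} {k} z≤n)

  ι-pos : ∀ {k} → 1 ≤ k → ℚ.Positive (ℕtoℚ k)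
  ι-pos 1≤k = ℚ.positive (ι-mono-< 1≤k)

  ι-inverse : ∀ d → (+ 1 ℚ./ suc d) ℚ.* ℕtoℚ (suc d) ≡ 1ℚ
  ι-inverse d = ℚₚ.toℚᵘ-injective (begin
    toℚᵘ ((+ 1 ℚ./ suc d) ℚ.* ℕtoℚ (suc d))               ≈⟨ ℚₚ.toℚᵘ-homo-* (+ 1 ℚ./ suc d) (ℕtoℚ (suc d)) ⟩
    toℚᵘ (+ 1 ℚ./ suc d) ℚᵘ.* toℚᵘ (ℕtoℚ (suc d))         ≈⟨ ℚᵘₚ.*-cong (ℚₚ.toℚᵘ-fromℚᵘ (mkℚᵘ (+ 1) d)) (ι-toℚᵘ (suc d)) ⟩
    mkℚᵘ (+ 1) d ℚᵘ.* mkℚᵘ (+ suc d) 0                    ≈⟨ *≡* (trans (ℤₚ.*-identityʳ _) (cong ℤ.+_ (rearrange d))) ⟩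
    toℚᵘ 1ℚ                                               ∎)
    where
    open ℚᵘₚ.≃-Reasoning
    rearrange : ∀ d → suc d + 0 ≡ suc (d * 1 + 0)
    rearrange = solve-∀

  divℕ-cancel : ∀ x d → 1 ≤ d → divℕ x d ℚ.* ℕtoℚ d ≡ x
  divℕ-cancel x (suc d) _ = begin
    x ℚ.* (+ 1 ℚ./ suc d) ℚ.* ℕtoℚ (suc d)     ≡⟨ ℚₚ.*-assoc x _ _ ⟩
    x ℚ.* ((+ 1 ℚ./ suc d) ℚ.* ℕtoℚ (suc d))   ≡⟨ cong (x ℚ.*_) (ι-inverse d) ⟩
    x ℚ.* 1ℚ                                   ≡⟨ ℚₚ.*-identityʳ x ⟩
    x                                          ∎
    where open ≡-Reasoning

  floor-spec : ∀ p → 0ℚ ℚ.≤ p → ℕtoℚ ℤ.∣ ℚ.floor p ∣ ℚ.≤ p × p ℚ.< ℕtoℚ (suc ℤ.∣ ℚ.floor p ∣)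
  floor-spec (mkℚ -[1+ a ] d c) 0≤p with ℚₚ.drop-*≤* 0≤p
  ... | ()
  floor-spec p@(mkℚ (+ a) d c) 0≤p = lower , upper
    where
    q : ℕ
    q = ℤ.∣ ℚ.floor p ∣
    q≡ : q ≡ a / suc d
    q≡ = cong ℤ.∣_∣ (ℤₚ.*-identityˡ (+ (a / suc d)))
    lower : ℕtoℚ q ℚ.≤ p
    lower = ℚₚ.toℚᵘ-cancel-≤ (ℚᵘₚ.≤-respˡ-≃ (ℚᵘₚ.≃-sym (ι-toℚᵘ q)) (*≤* (subst₂ ℤ._≤_
      (ℤₚ.pos-* q (suc d)) (sym (ℤₚ.*-identityʳ (+ a)))
      (+≤+ (subst (λ t → t * suc d ≤ a) (sym q≡) (m/n*n≤m a (suc d)))))))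
    upper : p ℚ.< ℕtoℚ (suc q)
    upper = ℚₚ.toℚᵘ-cancel-< (ℚᵘₚ.<-respʳ-≃ (ℚᵘₚ.≃-sym (ι-toℚᵘ (suc q))) (*<* (subst₂ ℤ._<_
      (sym (ℤₚ.*-identityʳ (+ a))) (ℤₚ.pos-* (suc q) (suc d))
      (+<+ (subst (λ t → a < suc t * suc d) (sym q≡) (proj₂ (proj₂ (quotient a (suc d) (s≤s z≤n)))))))))

  scaleℚ : ∀ k {p q} → p ℚ.≤ q → ℕtoℚ k ℚ.* p ℚ.≤ ℕtoℚ k ℚ.* q
  scaleℚ k = ℚₚ.*-monoˡ-≤-nonNeg (ℕtoℚ k) {{ι-nonNeg k}}

  *-nonNeg : ∀ p q → 0ℚ ℚ.≤ p → 0ℚ ℚ.≤ q → 0ℚ ℚ.≤ p ℚ.* q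
  *-nonNeg p q 0≤p 0≤q = ℚₚ.nonNegative⁻¹ (p ℚ.* q)
    {{ℚₚ.nonNeg*nonNeg⇒nonNeg p {{ℚ.nonNegative 0≤p}} q {{ℚ.nonNegative 0≤q}}}}

  unit≥0 : ∀ k → 0ℚ ℚ.≤ (+ 1 ℚ./ suc k)
  unit≥0 k = ℚₚ.nonNegative⁻¹ (+ 1 ℚ./ suc k) {{ℚₚ.normalize-nonNeg 1 (suc k)}}

  -- The exponential series at points of [0, 1/2]

  expPartial≤2 : ∀ x → 0ℚ ℚ.≤ x → x ℚ.≤ ½ → ∀ K → expPartial x K ℚ.≤ ℕtoℚ 2
  expPartial≤2 x 0≤x x≤½ K = ≤-trans′ (ℚₚ.≤-reflexive (sym (ℚₚ.+-identityʳ _)))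
    (≤-trans′ (ℚₚ.+-monoʳ-≤ (expPartial x K) (term≥0 K)) (bound K))
    where
    ≤-trans′ = ℚₚ.≤-trans
    term≥0 : ∀ k → 0ℚ ℚ.≤ expTerm x k
    term≥0 zero    = ι-mono-≤ {0} {1} z≤n
    term≥0 (suc k) = *-nonNeg (expTerm x k ℚ.* x) (+ 1 ℚ./ suc k) (*-nonNeg (expTerm x k) x (term≥0 k) 0≤x) (unit≥0 k)
    unit≤1 : ∀ k → (+ 1 ℚ./ suc k) ℚ.≤ 1ℚ
    unit≤1 k = ℚₚ.*-cancelʳ-≤-pos (ℕtoℚ (suc k)) {{ι-pos {suc k} (s≤s z≤n)}} (subst₂ ℚ._≤_
      (sym (ι-inverse k)) (sym (ℚₚ.*-identityˡ (ℕtoℚ (suc k)))) (ι-mono-≤ {1} {suc k} (s≤s z≤n)))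
    halves : ∀ k → expTerm x (suc k) ℚ.≤ expTerm x k ℚ.* ½
    halves k = ≤-trans′
      (ℚₚ.*-monoˡ-≤-nonNeg (expTerm x k ℚ.* x) {{ℚ.nonNegative (*-nonNeg (expTerm x k) x (term≥0 k) 0≤x)}} (unit≤1 k))
      (≤-trans′ (ℚₚ.≤-reflexive (ℚₚ.*-identityʳ (expTerm x k ℚ.* x)))
        (ℚₚ.*-monoˡ-≤-nonNeg (expTerm x k) {{ℚ.nonNegative (term≥0 k)}} x≤½))
    -- The last term dominates the rest of the series.
    bound : ∀ K → expPartial x K ℚ.+ expTerm x K ℚ.≤ ℕtoℚ 2
    bound zero    = ℚₚ.≤-refl
    bound (suc K) = ≤-trans′
      (ℚₚ.+-mono-≤ (ℚₚ.+-monoʳ-≤ (expPartial x K) (halves K)) (halves K))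
      (≤-trans′ (ℚₚ.≤-reflexive (twice (expPartial x K) (expTerm x K))) (bound K))
      where
      twice : ∀ e t → e ℚ.+ t ℚ.* ½ ℚ.+ t ℚ.* ½ ≡ e ℚ.+ t
      twice e t = begin
        e ℚ.+ t ℚ.* ½ ℚ.+ t ℚ.* ½      ≡⟨ ℚₚ.+-assoc e _ _ ⟩
        e ℚ.+ (t ℚ.* ½ ℚ.+ t ℚ.* ½)    ≡⟨ cong (e ℚ.+_) (ℚₚ.*-distribˡ-+ t ½ ½) ⟨
        e ℚ.+ t ℚ.* 1ℚ                 ≡⟨ cong (e ℚ.+_) (ℚₚ.*-identityʳ t) ⟩
        e ℚ.+ t                        ∎
        where open ≡-Reasoning

  -- Distance from 1/2

  -- Multiplying by the positive `Q` turns `X - 1/2` into `a - q`, whose absolute value is at least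
  -- `δ` by `Apart`.
  far-from-half : ∀ X a q δ ε → 1 ≤ q → X ℚ.* ℕtoℚ (2 * q) ≡ ℕtoℚ a → Apart a q δ →
                  ε ℚ.* ℕtoℚ (2 * q) ℚ.≤ ℕtoℚ δ → ε ℚ.≤ ℚ.∣ X ℚ.- ½ ∣
  far-from-half X a q δ ε 1≤q X≡ apart ε≤ = by-side apart
    where
    open ℚₚ.≤-Reasoning
    Q : ℚ
    Q = ℕtoℚ (2 * q)
    Q-pos : ℚ.Positive Q
    Q-pos = ι-pos (≤-trans 1≤q (m≤m+n q _))
    ½Q : ½ ℚ.* Q ≡ ℕtoℚ q
    ½Q = trans (cong (½ ℚ.*_) (ι-* 2 q)) (trans (sym (ℚₚ.*-assoc ½ (ℕtoℚ 2) (ℕtoℚ q))) (ℚₚ.*-identityˡ (ℕtoℚ q)))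
    difference : (X ℚ.- ½) ℚ.* Q ≡ ℕtoℚ a ℚ.- ℕtoℚ q
    difference = trans (ℚₚ.*-distribʳ-+ Q X (ℚ.- ½)) (cong₂ ℚ._+_ X≡
      (trans (sym (ℚₚ.neg-distribˡ-* ½ Q)) (cong ℚ.-_ ½Q)))
    gap : ∀ s t → s + δ ≤ t → ε ℚ.* Q ℚ.≤ ℕtoℚ t ℚ.- ℕtoℚ s
    gap s t h = begin
      ε ℚ.* Q                            ≤⟨ ε≤ ⟩
      ℕtoℚ δ                             ≡⟨ cancel (ℕtoℚ s) (ℕtoℚ δ) ⟩
      ℕtoℚ s ℚ.+ ℕtoℚ δ ℚ.- ℕtoℚ s       ≡⟨ cong (ℚ._- ℕtoℚ s) (ι-+ s δ) ⟨
      ℕtoℚ (s + δ) ℚ.- ℕtoℚ s            ≤⟨ ℚₚ.+-monoˡ-≤ (ℚ.- ℕtoℚ s) (ι-mono-≤ h) ⟩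
      ℕtoℚ t ℚ.- ℕtoℚ s                  ∎
      where
      cancel : ∀ s d → d ≡ s ℚ.+ d ℚ.- s
      cancel = +-*-Solver.solve 2 (λ s d → d := s :+ d :- s) refl
        where open +-*-Solver
    p≤∣p∣ : ∀ p → p ℚ.≤ ℚ.∣ p ∣
    p≤∣p∣ p with ℚₚ.≤-total 0ℚ p
    ... | inj₁ 0≤p = ℚₚ.≤-reflexive (sym (ℚₚ.0≤p⇒∣p∣≡p 0≤p))
    ... | inj₂ p≤0 = ℚₚ.≤-trans p≤0 (ℚₚ.0≤∣p∣ p)
    by-side : Apart a q δ → ε ℚ.≤ ℚ.∣ X ℚ.- ½ ∣
    by-side (inj₁ above) = ℚₚ.≤-trans
      (ℚₚ.*-cancelʳ-≤-pos Q {{Q-pos}} (ℚₚ.≤-trans (gap q a above) (ℚₚ.≤-reflexive (sym difference))))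
      (p≤∣p∣ (X ℚ.- ½))
    by-side (inj₂ below) = ℚₚ.≤-trans
      (ℚₚ.*-cancelʳ-≤-pos Q {{Q-pos}} (ℚₚ.≤-trans (gap a q below) (ℚₚ.≤-reflexive (sym negated))))
      (subst (ℚ.- (X ℚ.- ½) ℚ.≤_) (ℚₚ.∣-p∣≡∣p∣ (X ℚ.- ½)) (p≤∣p∣ (ℚ.- (X ℚ.- ½))))
      where
      negated : ℚ.- (X ℚ.- ½) ℚ.* Q ≡ ℕtoℚ q ℚ.- ℕtoℚ a
      negated = trans (sym (ℚₚ.neg-distribˡ-* (X ℚ.- ½) Q)) (trans (cong ℚ.-_ difference) (flip (ℕtoℚ a) (ℕtoℚ q)))
        where
        flip : ∀ s t → ℚ.- (s ℚ.- t) ≡ t ℚ.- s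
        flip = +-*-Solver.solve 2 (λ s t → :- (s :- t) := t :- s) refl
          where open +-*-Solver

  -- From integer deviations to the estimators

  median-odd : ∀ xs → length xs % 2 ≡ 1 → median xs ≡ ℕtoℚ (nth (sort xs) (length xs / 2))
  median-odd xs e with length xs % 2 | e
  ... | .1 | refl = refl

  median-even : ∀ xs → length xs % 2 ≡ 0 →
    median xs ≡ divℕ (ℕtoℚ (nth (sort xs) (length xs / 2 ∸ 1)) ℚ.+ ℕtoℚ (nth (sort xs) (length xs / 2))) 2
  median-even xs e with length xs % 2 | e
  ... | .0 | refl = refl

  -- The two indices coincide for odd length and are adjacent for even length, so one formula covers
  -- both branches of `median`.
  median-middle : ∀ xs j₁ j₂ → length xs ≡ suc (j₁ + j₂) → j₁ ≤ j₂ → j₂ ≤ suc j₁ →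
                  median xs ℚ.* ℕtoℚ 2 ≡ ℕtoℚ (nth (sort xs) j₁ + nth (sort xs) j₂)
  median-middle xs j₁ j₂ len j₁≤j₂ j₂≤ with m≤n⇒m<n∨m≡n j₂≤
  ... | inj₂ refl = begin
    median xs ℚ.* ℕtoℚ 2
      ≡⟨ cong (ℚ._* ℕtoℚ 2) (median-even xs (trans (cong (_% 2) len′) ([m+kn]%n≡m%n 0 (suc j₁) 2))) ⟩
    divℕ (ℕtoℚ (s (length xs / 2 ∸ 1)) ℚ.+ ℕtoℚ (s (length xs / 2))) 2 ℚ.* ℕtoℚ 2
      ≡⟨ divℕ-cancel _ 2 (s≤s z≤n) ⟩
    ℕtoℚ (s (length xs / 2 ∸ 1)) ℚ.+ ℕtoℚ (s (length xs / 2))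
      ≡⟨ ι-+ (s (length xs / 2 ∸ 1)) (s (length xs / 2)) ⟨
    ℕtoℚ (s (length xs / 2 ∸ 1) + s (length xs / 2))
      ≡⟨ cong (λ h → ℕtoℚ (s (h ∸ 1) + s h)) (trans (cong (_/ 2) len′) (m*n/n≡m (suc j₁) 2)) ⟩
    ℕtoℚ (s j₁ + s (suc j₁)) ∎
    where
    open ≡-Reasoning
    s : ℕ → ℕ
    s = nth (sort xs)
    len′ : length xs ≡ suc j₁ * 2
    len′ = trans len (double j₁)
      where
      double : ∀ j → suc (j + suc j) ≡ suc j * 2
      double = solve-∀
  ... | inj₁ (s≤s j₂≤j₁) with refl ← ≤-antisym j₁≤j₂ j₂≤j₁ = begin
    median xs ℚ.* ℕtoℚ 2
      ≡⟨ cong (ℚ._* ℕtoℚ 2) (median-odd xs (trans (cong (_% 2) len′) ([m+kn]%n≡m%n 1 j₁ 2))) ⟩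
    ℕtoℚ (s (length xs / 2)) ℚ.* ℕtoℚ 2
      ≡⟨ cong (λ h → ℕtoℚ (s h) ℚ.* ℕtoℚ 2) (trans (cong (_/ 2) len′)
           (trans (+-distrib-/-∣ʳ 1 {j₁ * 2} {2} (divides-refl j₁)) (m*n/n≡m j₁ 2))) ⟩
    ℕtoℚ (s j₁) ℚ.* ℕtoℚ 2
      ≡⟨ ι-* (s j₁) 2 ⟨
    ℕtoℚ (s j₁ * 2)
      ≡⟨ cong ℕtoℚ (double (s j₁)) ⟩
    ℕtoℚ (s j₁ + s j₁) ∎
    where
    open ≡-Reasoning
    s : ℕ → ℕ
    s = nth (sort xs)
    len′ : length xs ≡ 1 + j₁ * 2
    len′ = trans len (odd j₁)
      where
      odd : ∀ j → suc (j + j) ≡ 1 + j * 2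
      odd = solve-∀
    double : ∀ t → t * 2 ≡ t + t
    double = solve-∀

  -- This makes the integer division by 2 in the denominator of `meanEst` exact.
  pronic-even : ∀ q → ∃[ t ] suc q * q ≡ t * 2
  pronic-even zero = 0 , refl
  pronic-even (suc q) with pronic-even q
  ... | t , e = t + suc q , trans (expand q) (trans (cong (_+ suc q * 2) e) (sym (*-distribʳ-+ 2 t (suc q))))
    where
    expand : ∀ q → suc (suc q) * suc q ≡ suc q * q + suc q * 2
    expand = solve-∀

  middle-indices : ∀ q → ∃[ j₁ ] ∃[ j₂ ] j₁ + j₂ ≡ q × j₁ ≤ j₂ × j₂ ≤ suc j₁
  middle-indices zero = 0 , 0 , refl , z≤n , z≤n
  middle-indices (suc q) with middle-indices q
  ... | j₁ , j₂ , e , h , h′ = j₂ , suc j₁ , trans (+-suc j₂ j₁) (cong suc (trans (+-comm j₂ j₁) e)) , h′ , s≤s h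

  -- The mean is the more demanding estimate: 2 * 528² = 557568, and `10 ≤ r` bounds `r * r` by 10/9
  -- of `r * (r ∸ 1)`, so any denominator from 619520 on would do.
  C′ : ℚ
  C′ = + 1 ℚ./ 1000000

  C′-pos : ℚ.Positive C′
  C′-pos = ℚₚ.normalize-pos 1 1000000

  0<C′ : 0ℚ ℚ.< C′
  0<C′ = ℚₚ.positive⁻¹ C′ {{C′-pos}}

  C′-small : ∀ Y δ → Y ℚ.≤ ℕtoℚ (1000000 * δ) → C′ ℚ.* Y ℚ.≤ ℕtoℚ δ
  C′-small Y δ Y≤ = begin
    C′ ℚ.* Y                            ≤⟨ ℚₚ.*-monoˡ-≤-nonNeg C′ {{ℚₚ.pos⇒nonNeg C′ {{C′-pos}}}} Y≤ ⟩
    C′ ℚ.* ℕtoℚ (1000000 * δ)           ≡⟨ cong (C′ ℚ.*_) (ι-* 1000000 δ) ⟩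
    C′ ℚ.* (ℕtoℚ 1000000 ℚ.* ℕtoℚ δ)    ≡⟨ ℚₚ.*-assoc C′ (ℕtoℚ 1000000) (ℕtoℚ δ) ⟨
    C′ ℚ.* ℕtoℚ 1000000 ℚ.* ℕtoℚ δ      ≡⟨ cong (ℚ._* ℕtoℚ δ) (ι-inverse 999999) ⟩
    1ℚ ℚ.* ℕtoℚ δ                       ≡⟨ ℚₚ.*-identityˡ _ ⟩
    ℕtoℚ δ                              ∎
    where open ℚₚ.≤-Reasoning

  FarEstimates : ∀ {n} (γ : ℚ) (g : Fin n → Fin n → Bool) (k : ℕ) → Set
  FarEstimates γ g k = C′ ℚ.* γ ℚ.≤ ℚ.∣ medianEst g k ℚ.- ½ ∣ × C′ ℚ.* (γ ℚ.* γ) ℚ.≤ ℚ.∣ meanEst g k ℚ.- ½ ∣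

  module _ {n k r j₁ j₂ : ℕ} (S : Sizes n k r j₁ j₂) {γ : ℚ} (0<γ : 0ℚ ℚ.< γ)
           (γn≤ : γ ℚ.* ℕtoℚ n ℚ.≤ ℕtoℚ (528 * r)) where

    open Sizes S

    private
      q : ℕ
      q = j₁ + j₂

      γ-nonNeg : ℚ.NonNegative γ
      γ-nonNeg = ℚ.nonNegative (ℚₚ.<⇒≤ 0<γ)

      γn-nonNeg : ℚ.NonNegative (γ ℚ.* ℕtoℚ n)
      γn-nonNeg = ℚₚ.nonNeg*nonNeg⇒nonNeg γ {{γ-nonNeg}} (ℕtoℚ n) {{ι-nonNeg n}}

      1+q≤n : suc q ≤ n
      1+q≤n = ≤-trans (m≤m+n (suc q) (k + k)) (≤-reflexive total)

      1≤q : 1 ≤ q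
      1≤q = *-cancelˡ-≤ 2 (linear {2 * 1} {2 * (j₁ + j₂)} (479 * r + 6)
        (+-mono-≤ (+-mono-≤ (+-mono-≤ r-small k-small) (scale 2 (≤-reflexive (sym total)))) r-large)
        (solve (n ∷ k ∷ r ∷ j₁ ∷ j₂ ∷ [])))

      median-bound : C′ ℚ.* γ ℚ.* ℕtoℚ (2 * q) ℚ.≤ ℕtoℚ r
      median-bound = ℚₚ.≤-trans (ℚₚ.≤-reflexive (ℚₚ.*-assoc C′ γ (ℕtoℚ (2 * q)))) (C′-small _ r (begin
        γ ℚ.* ℕtoℚ (2 * q)              ≤⟨ ℚₚ.*-monoˡ-≤-nonNeg γ {{γ-nonNeg}} (ι-mono-≤ (*-monoʳ-≤ 2 (≤-trans (n≤1+n q) 1+q≤n))) ⟩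
        γ ℚ.* ℕtoℚ (2 * n)              ≡⟨ cong (γ ℚ.*_) (ι-* 2 n) ⟩
        γ ℚ.* (ℕtoℚ 2 ℚ.* ℕtoℚ n)       ≡⟨ exchange γ (ℕtoℚ 2) (ℕtoℚ n) ⟩
        ℕtoℚ 2 ℚ.* (γ ℚ.* ℕtoℚ n)       ≤⟨ scaleℚ 2 γn≤ ⟩
        ℕtoℚ 2 ℚ.* ℕtoℚ (528 * r)       ≡⟨ ι-* 2 (528 * r) ⟨
        ℕtoℚ (2 * (528 * r))            ≤⟨ ι-mono-≤ (linear {2 * (528 * r)} {1000000 * r} {0} {0} (998944 * r) z≤n (solve (r ∷ []))) ⟩
        ℕtoℚ (1000000 * r)              ∎))
        where
        open ℚₚ.≤-Reasoning
        exchange : ∀ a b c → a ℚ.* (b ℚ.* c) ≡ b ℚ.* (a ℚ.* c)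
        exchange = +-*-Solver.solve 3 (λ a b c → a :* (b :* c) := b :* (a :* c)) refl
          where open +-*-Solver

      mean-bound : C′ ℚ.* (γ ℚ.* γ) ℚ.* ℕtoℚ (2 * (suc q * q)) ℚ.≤ ℕtoℚ (r * (r ∸ 1))
      mean-bound = ℚₚ.≤-trans (ℚₚ.≤-reflexive (ℚₚ.*-assoc C′ (γ ℚ.* γ) (ℕtoℚ (2 * (suc q * q))))) (C′-small _ (r * (r ∸ 1)) (begin
        γ ℚ.* γ ℚ.* ℕtoℚ (2 * (suc q * q))
          ≤⟨ ℚₚ.*-monoˡ-≤-nonNeg (γ ℚ.* γ) {{ℚₚ.nonNeg*nonNeg⇒nonNeg γ {{γ-nonNeg}} γ {{γ-nonNeg}}}}
               (ι-mono-≤ (*-monoʳ-≤ 2 (*-mono-≤ 1+q≤n (≤-trans (n≤1+n q) 1+q≤n)))) ⟩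
        γ ℚ.* γ ℚ.* ℕtoℚ (2 * (n * n))
          ≡⟨ cong (γ ℚ.* γ ℚ.*_) (trans (ι-* 2 (n * n)) (cong (ℕtoℚ 2 ℚ.*_) (ι-* n n))) ⟩
        γ ℚ.* γ ℚ.* (ℕtoℚ 2 ℚ.* (ℕtoℚ n ℚ.* ℕtoℚ n))
          ≡⟨ exchange γ (ℕtoℚ 2) (ℕtoℚ n) ⟩
        ℕtoℚ 2 ℚ.* ((γ ℚ.* ℕtoℚ n) ℚ.* (γ ℚ.* ℕtoℚ n))
          ≤⟨ scaleℚ 2 (ℚₚ.≤-trans (ℚₚ.*-monoˡ-≤-nonNeg (γ ℚ.* ℕtoℚ n) {{γn-nonNeg}} γn≤)
               (ℚₚ.*-monoʳ-≤-nonNeg (ℕtoℚ (528 * r)) {{ι-nonNeg (528 * r)}} γn≤)) ⟩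
        ℕtoℚ 2 ℚ.* (ℕtoℚ (528 * r) ℚ.* ℕtoℚ (528 * r))
          ≡⟨ trans (ι-* 2 (528 * r * (528 * r))) (cong (ℕtoℚ 2 ℚ.*_) (ι-* (528 * r) (528 * r))) ⟨
        ℕtoℚ (2 * (528 * r * (528 * r)))
          ≤⟨ ι-mono-≤ (squares r r-large) ⟩
        ℕtoℚ (1000000 * (r * (r ∸ 1))) ∎))
        where
        open ℚₚ.≤-Reasoning
        exchange : ∀ a b c → a ℚ.* a ℚ.* (b ℚ.* (c ℚ.* c)) ≡ b ℚ.* ((a ℚ.* c) ℚ.* (a ℚ.* c))
        exchange = +-*-Solver.solve 3 (λ a b c → a :* a :* (b :* (c :* c)) := b :* ((a :* c) :* (a :* c))) refl
          where open +-*-Solver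
        squares : ∀ r → 10 ≤ r → 2 * (528 * r * (528 * r)) ≤ 1000000 * (r * (r ∸ 1))
        squares (suc e) (s≤s 9≤e) = ≤-trans (≤-reflexive (regroup (suc e)))
          (≤-trans (scale (suc e) (linear {557568 * (1 + e)} {1000000 * e} (380480 * e) (scale 61952 9≤e) (solve (e ∷ []))))
            (≤-reflexive (regroup′ 1000000 (suc e) e)))
          where
          regroup : ∀ s → 2 * (528 * s * (528 * s)) ≡ s * (557568 * s)
          regroup = solve-∀
          regroup′ : ∀ c s e → s * (c * e) ≡ c * (s * e)
          regroup′ = solve-∀

    far-estimates : ∀ (g : Fin n → Fin n → Bool) → Far g k r j₁ j₂ → FarEstimates γ g k
    far-estimates g F =
        far-from-half (medianEst g k) _ q r (C′ ℚ.* γ) 1≤q median≡ F.median-far median-bound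
      , far-from-half (meanEst g k) _ (suc q * q) (r * (r ∸ 1)) (C′ ℚ.* (γ ℚ.* γ)) (*-mono-≤ {1} {suc q} (s≤s z≤n) 1≤q) mean≡ F.mean-far mean-bound
      where
      module F = Far F
      open ≡-Reasoning
      swap : ∀ a b c → a ℚ.* (b ℚ.* c) ≡ a ℚ.* c ℚ.* b
      swap = +-*-Solver.solve 3 (λ a b c → a :* (b :* c) := a :* c :* b) refl
        where open +-*-Solver
      median≡ : medianEst g k ℚ.* ℕtoℚ (2 * q) ≡ ℕtoℚ (orderStat g k j₁ + orderStat g k j₂)
      median≡ = begin
        medianEst g k ℚ.* ℕtoℚ (2 * q)                   ≡⟨ cong₂ (λ s t → divℕ (median (degreesH g k)) (s ∸ 1) ℚ.* t) F.size (ι-* 2 q) ⟩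
        divℕ (median (degreesH g k)) q ℚ.* (ℕtoℚ 2 ℚ.* ℕtoℚ q)   ≡⟨ swap (divℕ (median (degreesH g k)) q) (ℕtoℚ 2) (ℕtoℚ q) ⟩
        divℕ (median (degreesH g k)) q ℚ.* ℕtoℚ q ℚ.* ℕtoℚ 2     ≡⟨ cong (ℚ._* ℕtoℚ 2) (divℕ-cancel _ q 1≤q) ⟩
        median (degreesH g k) ℚ.* ℕtoℚ 2                 ≡⟨ median-middle (degreesH g k) j₁ j₂ (trans (length-degrees g k) F.size) j₁≤j₂ j₂≤ ⟩
        ℕtoℚ (orderStat g k j₁ + orderStat g k j₂)       ∎
      t : ℕ
      t = proj₁ (pronic-even q)
      t≡ : suc q * q ≡ t * 2
      t≡ = proj₂ (pronic-even q)
      1≤t : 1 ≤ t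
      1≤t = *-cancelʳ-< 2 0 t (subst (1 ≤_) t≡ (*-mono-≤ {1} {suc q} (s≤s z≤n) 1≤q))
      mean≡ : meanEst g k ℚ.* ℕtoℚ (2 * (suc q * q)) ≡ ℕtoℚ (4 * edgesH g k)
      mean≡ = begin
        meanEst g k ℚ.* ℕtoℚ (2 * (suc q * q))
          ≡⟨ cong₂ (λ s u → divℕ (ℕtoℚ (edgesH g k)) ((s * (s ∸ 1)) / 2) ℚ.* ℕtoℚ (2 * u)) F.size t≡ ⟩
        divℕ (ℕtoℚ (edgesH g k)) ((suc q * q) / 2) ℚ.* ℕtoℚ (2 * (t * 2))
          ≡⟨ cong₂ (λ d u → divℕ (ℕtoℚ (edgesH g k)) d ℚ.* ℕtoℚ u) (trans (cong (_/ 2) t≡) (m*n/n≡m t 2)) (four t) ⟩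
        divℕ (ℕtoℚ (edgesH g k)) t ℚ.* ℕtoℚ (4 * t)
          ≡⟨ cong (divℕ (ℕtoℚ (edgesH g k)) t ℚ.*_) (ι-* 4 t) ⟩
        divℕ (ℕtoℚ (edgesH g k)) t ℚ.* (ℕtoℚ 4 ℚ.* ℕtoℚ t)
          ≡⟨ swap (divℕ (ℕtoℚ (edgesH g k)) t) (ℕtoℚ 4) (ℕtoℚ t) ⟩
        divℕ (ℕtoℚ (edgesH g k)) t ℚ.* ℕtoℚ t ℚ.* ℕtoℚ 4
          ≡⟨ cong (ℚ._* ℕtoℚ 4) (divℕ-cancel _ t 1≤t) ⟩
        ℕtoℚ (edgesH g k) ℚ.* ℕtoℚ 4
          ≡⟨ ι-* (edgesH g k) 4 ⟨
        ℕtoℚ (edgesH g k * 4)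
          ≡⟨ cong ℕtoℚ (*-comm (edgesH g k) 4) ⟩
        ℕtoℚ (4 * edgesH g k) ∎
        where
        four : ∀ t → 2 * (t * 2) ≡ 4 * t
        four = solve-∀

  -- Parameters from the hypotheses

  5000<γ²n : ∀ n γ → 0ℚ ℚ.< γ → 2 ≤ n → LnLt n (γ ℚ.* γ ℚ.* ℕtoℚ n ℚ.* (+ 1 ℚ./ 10000)) →
          ℕtoℚ 5000 ℚ.< γ ℚ.* γ ℚ.* ℕtoℚ n
  5000<γ²n n γ 0<γ 2≤n (K , n<) = begin-strict
    ℕtoℚ 5000                                               ≡⟨⟩
    ½ ℚ.* ℕtoℚ 10000                                        <⟨ ℚₚ.*-monoˡ-<-pos (ℕtoℚ 10000) {{ι-pos {10000} (s≤s z≤n)}} ½<x ⟩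
    x ℚ.* ℕtoℚ 10000                                        ≡⟨ ℚₚ.*-assoc Y (+ 1 ℚ./ 10000) (ℕtoℚ 10000) ⟩
    Y ℚ.* ((+ 1 ℚ./ 10000) ℚ.* ℕtoℚ 10000)                  ≡⟨ cong (Y ℚ.*_) (ι-inverse 9999) ⟩
    Y ℚ.* 1ℚ                                                ≡⟨ ℚₚ.*-identityʳ Y ⟩
    Y                                                       ∎
    where
    open ℚₚ.≤-Reasoning
    Y x : ℚ
    Y = γ ℚ.* γ ℚ.* ℕtoℚ n
    x = Y ℚ.* (+ 1 ℚ./ 10000)
    γ-nonNeg : ℚ.NonNegative γ
    γ-nonNeg = ℚ.nonNegative (ℚₚ.<⇒≤ 0<γ)
    0≤x : 0ℚ ℚ.≤ x
    0≤x = ℚₚ.nonNegative⁻¹ x {{ℚₚ.nonNeg*nonNeg⇒nonNeg Y {{ℚₚ.nonNeg*nonNeg⇒nonNeg (γ ℚ.* γ)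
      {{ℚₚ.nonNeg*nonNeg⇒nonNeg γ {{γ-nonNeg}} γ {{γ-nonNeg}}}} (ℕtoℚ n) {{ι-nonNeg n}}}} (+ 1 ℚ./ 10000) {{ℚₚ.normalize-nonNeg 1 10000}}}}
    ½<x : ½ ℚ.< x
    -- Otherwise every partial sum of the exponential series at `x` is at most 2, hence at most `n`,
    -- against `n<`.
    ½<x = ℚₚ.≰⇒> (λ x≤½ → <⇒≱ (ι-cancel-< (ℚₚ.<-≤-trans n< (expPartial≤2 x 0≤x x≤½ K))) 2≤n)

  -- Rounding `γ * n / 480` down costs less than 480 in `γ * n`, at most a tenth of `480 * r` once
  -- `10 ≤ r`.
  480*suc≤528* : ∀ r → 10 ≤ r → 480 * suc r ≤ 528 * r
  480*suc≤528* r 10≤r = linear {480 * suc r} {528 * r} 0 (scale 48 10≤r) (solve (r ∷ []))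

  -- The 56 is 528² / 5000 rounded up: 528² = 278784 and 5000 * 56 = 280000.
  5000*≤⇒≤56* : ∀ n r → 5000 * n ≤ 528 * r * (528 * r) → n ≤ 56 * (r * r)
  5000*≤⇒≤56* n r h = *-cancelˡ-≤ {n} {56 * (r * r)} 5000 (begin
    5000 * n                 ≤⟨ h ⟩
    528 * r * (528 * r)      ≡⟨ square 528 r ⟩
    528 * 528 * (r * r)      ≤⟨ *-monoˡ-≤ (r * r) (m≤m+n 278784 1216) ⟩
    5000 * 56 * (r * r)      ≡⟨ *-assoc 5000 56 (r * r) ⟩
    5000 * (56 * (r * r))    ∎)
    where
    open ≤-Reasoning
    square : ∀ c r → c * r * (c * r) ≡ c * c * (r * r)
    square = solve-∀

  4*≤⇒+< : ∀ k n → 2 ≤ n → 4 * k ≤ n → k + k < n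
  4*≤⇒+< k n 2≤n 4k≤n = *-cancelˡ-< 2 (k + k) n
    (linear {suc (2 * (k + k))} {2 * n} 1 (+-mono-≤ 4k≤n 2≤n) (solve (k ∷ n ∷ [])))

  sizes-exist : ∀ n k r → 2 ≤ n → 4 * k ≤ n → 480 * r ≤ n → 10 ≤ r → n ≤ 56 * (r * r) →
                ∃[ j₁ ] ∃[ j₂ ] Sizes n k r j₁ j₂
  sizes-exist n k r 2≤n 4k≤n 480r≤n 10≤r n≤ with m≤n⇒∃[o]m+o≡n (4*≤⇒+< k n 2≤n 4k≤n)
  ... | q , e with middle-indices q
  ... | j₁ , j₂ , j≡ , j₁≤j₂ , j₂≤ = j₁ , j₂ , record
    { total = trans (cong (λ t → suc t + (k + k)) j≡) (trans (+-comm (suc q) (k + k)) (trans (+-suc (k + k) q) e))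
    ; j₁≤j₂ = j₁≤j₂ ; j₂≤ = j₂≤ ; k-small = 4k≤n ; r-small = 480r≤n ; r-large = 10≤r ; n-small = n≤ }

  module Parameters (n : ℕ) (γ c : ℚ) (2≤n : 2 ≤ n) (0<γ : 0ℚ ℚ.< γ) (γ≤1 : γ ℚ.≤ 1ℚ)
    (γ-large : LnLt n (γ ℚ.* γ ℚ.* ℕtoℚ n ℚ.* (+ 1 ℚ./ 10000)))
    (0<c : 0ℚ ℚ.< c) (cγ<¼ : c ℚ.* γ ℚ.< (+ 1) ℚ./ 4) where

    private
      G : ℚ
      G = γ ℚ.* ℕtoℚ n

      γ-nonNeg : ℚ.NonNegative γ
      γ-nonNeg = ℚ.nonNegative (ℚₚ.<⇒≤ 0<γ)

      G-nonNeg : ℚ.NonNegative G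
      G-nonNeg = ℚₚ.nonNeg*nonNeg⇒nonNeg γ {{γ-nonNeg}} (ℕtoℚ n) {{ι-nonNeg n}}

      G≤n : G ℚ.≤ ℕtoℚ n
      G≤n = ℚₚ.≤-trans (ℚₚ.*-monoʳ-≤-nonNeg (ℕtoℚ n) {{ι-nonNeg n}} γ≤1) (ℚₚ.≤-reflexive (ℚₚ.*-identityˡ (ℕtoℚ n)))

      -- Dividing by 480 and not by 48 keeps the `48 * r` corrupted vertices at most a tenth of all
      -- vertices even for `γ = 1`, as the size estimates require.
      share : ℚ
      share = G ℚ.* (+ 1 ℚ./ 480)

      480*share : ℕtoℚ 480 ℚ.* share ≡ G
      480*share = trans (ℚₚ.*-comm (ℕtoℚ 480) share) (trans (ℚₚ.*-assoc G (+ 1 ℚ./ 480) (ℕtoℚ 480))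
        (trans (cong (G ℚ.*_) (ι-inverse 479)) (ℚₚ.*-identityʳ G)))

      share-floor : ℕtoℚ ℤ.∣ ℚ.floor share ∣ ℚ.≤ share × share ℚ.< ℕtoℚ (suc ℤ.∣ ℚ.floor share ∣)
      share-floor = floor-spec share (ℚₚ.nonNegative⁻¹ share
        {{ℚₚ.nonNeg*nonNeg⇒nonNeg G {{G-nonNeg}} (+ 1 ℚ./ 480) {{ℚₚ.normalize-nonNeg 1 480}}}})

    r : ℕ
    r = ℤ.∣ ℚ.floor share ∣

    480r≤γn : ℕtoℚ (480 * r) ℚ.≤ γ ℚ.* ℕtoℚ n
    480r≤γn = begin
      ℕtoℚ (480 * r)              ≡⟨ ι-* 480 r ⟩
      ℕtoℚ 480 ℚ.* ℕtoℚ r         ≤⟨ scaleℚ 480 (proj₁ share-floor) ⟩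
      ℕtoℚ 480 ℚ.* share              ≡⟨ 480*share ⟩
      G                           ∎
      where open ℚₚ.≤-Reasoning

    private
      G<480[1+r] : G ℚ.< ℕtoℚ (480 * suc r)
      G<480[1+r] = begin-strict
        G                            ≡⟨ 480*share ⟨
        ℕtoℚ 480 ℚ.* share               <⟨ ℚₚ.*-monoʳ-<-pos (ℕtoℚ 480) {{ι-pos {480} (s≤s z≤n)}} (proj₂ share-floor) ⟩
        ℕtoℚ 480 ℚ.* ℕtoℚ (suc r)    ≡⟨ ι-* 480 (suc r) ⟨
        ℕtoℚ (480 * suc r)           ∎
        where open ℚₚ.≤-Reasoning

      γ²n≤G : γ ℚ.* γ ℚ.* ℕtoℚ n ℚ.≤ G
      γ²n≤G = begin
        γ ℚ.* γ ℚ.* ℕtoℚ n      ≡⟨ ℚₚ.*-assoc γ γ (ℕtoℚ n) ⟩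
        γ ℚ.* G                 ≤⟨ ℚₚ.*-monoʳ-≤-nonNeg G {{G-nonNeg}} γ≤1 ⟩
        1ℚ ℚ.* G                ≡⟨ ℚₚ.*-identityˡ G ⟩
        G                       ∎
        where open ℚₚ.≤-Reasoning

      -- By `γ ≤ 1`, 5000 < γ²n ≤ γn < 480(r + 1), whereas `r < 10` would make the last term at most
      -- 4800.
      10≤r : 10 ≤ r
      10≤r = ≮⇒≥ (λ r<10 → <⇒≱ (ι-cancel-< {5000} (ℚₚ.<-trans (5000<γ²n n γ 0<γ 2≤n γ-large) (ℚₚ.≤-<-trans γ²n≤G G<480[1+r])))
        (≤-trans (*-monoʳ-≤ 480 r<10) (m≤m+n 4800 200)))

    γn≤528r : γ ℚ.* ℕtoℚ n ℚ.≤ ℕtoℚ (528 * r)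
    γn≤528r = ℚₚ.≤-trans (ℚₚ.<⇒≤ G<480[1+r]) (ι-mono-≤ (480*suc≤528* r 10≤r))

    private
      n≤56r² : n ≤ 56 * (r * r)
      n≤56r² = 5000*≤⇒≤56* n r (ι-cancel-≤ {5000 * n} {528 * r * (528 * r)} 5000n≤)
        where
        5000n≤ : ℕtoℚ (5000 * n) ℚ.≤ ℕtoℚ (528 * r * (528 * r))
        5000n≤ = begin
          ℕtoℚ (5000 * n)                       ≡⟨ ι-* 5000 n ⟩
          ℕtoℚ 5000 ℚ.* ℕtoℚ n                  ≤⟨ ℚₚ.*-monoʳ-≤-nonNeg (ℕtoℚ n) {{ι-nonNeg n}} (ℚₚ.<⇒≤ (5000<γ²n n γ 0<γ 2≤n γ-large)) ⟩
          γ ℚ.* γ ℚ.* ℕtoℚ n ℚ.* ℕtoℚ n         ≡⟨ exchange γ (ℕtoℚ n) ⟩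
          G ℚ.* G                               ≤⟨ ℚₚ.*-monoˡ-≤-nonNeg G {{G-nonNeg}} γn≤528r ⟩
          G ℚ.* ℕtoℚ (528 * r)                  ≤⟨ ℚₚ.*-monoʳ-≤-nonNeg (ℕtoℚ (528 * r)) {{ι-nonNeg (528 * r)}} γn≤528r ⟩
          ℕtoℚ (528 * r) ℚ.* ℕtoℚ (528 * r)     ≡⟨ ι-* (528 * r) (528 * r) ⟨
          ℕtoℚ (528 * r * (528 * r))            ∎
          where
          open ℚₚ.≤-Reasoning
          exchange : ∀ g m → g ℚ.* g ℚ.* m ℚ.* m ≡ (g ℚ.* m) ℚ.* (g ℚ.* m)
          exchange = +-*-Solver.solve 2 (λ g m → g :* g :* m :* m := (g :* m) :* (g :* m)) refl
            where open +-*-Solver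

    k : ℕ
    k = pruneCount n c γ

    private
      4k≤n : 4 * k ≤ n
      4k≤n = ι-cancel-≤ {4 * k} {n} (begin
        ℕtoℚ (4 * k)                         ≡⟨ ι-* 4 k ⟩
        ℕtoℚ 4 ℚ.* ℕtoℚ k                    ≤⟨ scaleℚ 4 (proj₁ (floor-spec (c ℚ.* γ ℚ.* ℕtoℚ n) (ℚₚ.nonNegative⁻¹ _ {{cγn-nonNeg}}))) ⟩
        ℕtoℚ 4 ℚ.* (c ℚ.* γ ℚ.* ℕtoℚ n)      ≤⟨ scaleℚ 4 (ℚₚ.*-monoʳ-≤-nonNeg (ℕtoℚ n) {{ι-nonNeg n}} (ℚₚ.<⇒≤ cγ<¼)) ⟩
        ℕtoℚ 4 ℚ.* ((+ 1 ℚ./ 4) ℚ.* ℕtoℚ n)  ≡⟨ ℚₚ.*-assoc (ℕtoℚ 4) (+ 1 ℚ./ 4) (ℕtoℚ n) ⟨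
        1ℚ ℚ.* ℕtoℚ n                        ≡⟨ ℚₚ.*-identityˡ (ℕtoℚ n) ⟩
        ℕtoℚ n                               ∎)
        where
        open ℚₚ.≤-Reasoning
        cγn-nonNeg : ℚ.NonNegative (c ℚ.* γ ℚ.* ℕtoℚ n)
        cγn-nonNeg = ℚₚ.nonNeg*nonNeg⇒nonNeg (c ℚ.* γ) {{ℚₚ.nonNeg*nonNeg⇒nonNeg c {{ℚ.nonNegative (ℚₚ.<⇒≤ 0<c)}} γ {{γ-nonNeg}}}}
          (ℕtoℚ n) {{ι-nonNeg n}}

    sizes : ∃[ j₁ ] ∃[ j₂ ] Sizes n k r j₁ j₂
    sizes = sizes-exist n k r 2≤n 4k≤n (ι-cancel-≤ {480 * r} {n} (ℚₚ.≤-trans 480r≤γn G≤n)) 10≤r n≤56r²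

  -- Assembling the adversary

  ≤Q-true : ∀ {p q} → p ℚ.≤ q → (p ≤Q q) ≡ true
  ≤Q-true h = Boolₚ.T-≡ .Equivalence.to (ℚₚ.≤⇒≤ᵇ h)

  probability-one : ∀ n (P : Mat n → Bool) → (∀ u → P u ≡ true) → ProbAtLeast n P 99 100
  probability-one n P all = subst (λ l → 99 * length (allMats n) ≤ 100 * l)
    (cong length (sym (filter-all (λ u → P u Bool.≟ true) (All.universal all (allMats n)))))
    (*-monoˡ-≤ (length (allMats n)) (m≤m+n 99 1))

  Conclusion : ∀ n (γ c : ℚ) → Set
  Conclusion n γ c = ∃ λ (A : Adversary n γ) → ProbAtLeast n
    (λ u → ((C′ ℚ.* γ) ≤Q ℚ.∣ medianEst (adj (Adversary.attack A u)) (pruneCount n c γ) ℚ.- (+ 1) ℚ./ 2 ∣)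
         ∧ ((C′ ℚ.* (γ ℚ.* γ)) ≤Q ℚ.∣ meanEst (adj (Adversary.attack A u)) (pruneCount n c γ) ℚ.- (+ 1) ℚ./ 2 ∣)) 99 100

  adversary : ∀ n γ c →
    (∀ u → ∃[ B ] ℕtoℚ (countF B) ℚ.≤ γ ℚ.* ℕtoℚ n × ∃[ v ]
      (∀ i j → B i ≡ false → B j ≡ false → adj v i j ≡ adj u i j) × FarEstimates γ (adj v) (pruneCount n c γ)) →
    Conclusion n γ c
  adversary n γ c attack = record
    { corrupt = λ u → proj₁ (attack u)
    ; attack  = λ u → proj₁ (proj₂ (proj₂ (attack u)))
    ; budget  = λ u → proj₁ (proj₂ (attack u))
    ; local   = λ u → proj₁ (proj₂ (proj₂ (proj₂ (attack u)))) }
    , probability-one n _ (λ u → ∧-intro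
        (≤Q-true (proj₁ (proj₂ (proj₂ (proj₂ (proj₂ (attack u)))))))
        (≤Q-true (proj₂ (proj₂ (proj₂ (proj₂ (proj₂ (attack u))))))))

  -- On a single vertex both estimates are 0 by the convention for divℕ.
  single-vertex : ∀ γ c → 0ℚ ℚ.< γ → γ ℚ.≤ 1ℚ → Conclusion 1 γ c
  single-vertex γ c 0<γ γ≤1 = adversary 1 γ c (λ u → ∅ , ℚₚ.nonNegative⁻¹ _ {{γ1-nonNeg}} , u , (λ _ _ _ _ → refl) ,
    subst (λ e → C′ ℚ.* γ ℚ.≤ ℚ.∣ e ℚ.- ½ ∣) (sym (median-0 u)) (≤½ γ γ≤1) ,
    subst (λ e → C′ ℚ.* (γ ℚ.* γ) ℚ.≤ ℚ.∣ e ℚ.- ½ ∣) (sym (mean-0 u)) (≤½ (γ ℚ.* γ) γ²≤1))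
    where
    k : ℕ
    k = pruneCount 1 c γ
    γ-nonNeg : ℚ.NonNegative γ
    γ-nonNeg = ℚ.nonNegative (ℚₚ.<⇒≤ 0<γ)
    γ1-nonNeg : ℚ.NonNegative (γ ℚ.* ℕtoℚ 1)
    γ1-nonNeg = ℚₚ.nonNeg*nonNeg⇒nonNeg γ {{γ-nonNeg}} (ℕtoℚ 1) {{ι-nonNeg 1}}
    γ²≤1 : γ ℚ.* γ ℚ.≤ 1ℚ
    γ²≤1 = ℚₚ.≤-trans (ℚₚ.*-monoˡ-≤-nonNeg γ {{γ-nonNeg}} γ≤1) (ℚₚ.≤-trans (ℚₚ.≤-reflexive (ℚₚ.*-identityʳ γ)) γ≤1)
    ≤½ : ∀ x → x ℚ.≤ 1ℚ → C′ ℚ.* x ℚ.≤ ℚ.∣ 0ℚ ℚ.- ½ ∣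
    ≤½ x x≤1 = ℚₚ.≤-trans (ℚₚ.*-monoˡ-≤-nonNeg C′ {{ℚₚ.pos⇒nonNeg C′ {{C′-pos}}}} x≤1)
      (ℚₚ.≤-trans (ℚₚ.≤-reflexive (ℚₚ.*-identityʳ C′)) (ℚₚ.≤ᵇ⇒≤ _))
    at-most-one : ∀ (g : Fin 1 → Fin 1 → Bool) → sizeH g k ∸ 1 ≡ 0
    at-most-one g with kept g k Fin.zero
    ... | true  = refl
    ... | false = refl
    median-0 : ∀ u → medianEst (adj u) k ≡ 0ℚ
    median-0 u = cong (divℕ (median (degreesH (adj u) k))) (at-most-one (adj u))
    mean-0 : ∀ u → meanEst (adj u) k ≡ 0ℚ
    mean-0 u = cong (divℕ (ℕtoℚ (edgesH (adj u) k))) (cong (_/ 2)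
      (trans (cong (sizeH (adj u) k *_) (at-most-one (adj u))) (*-zeroʳ (sizeH (adj u) k))))

  attack-of-sizes : ∀ {n k r j₁ j₂ γ} → Sizes n k r j₁ j₂ → 0ℚ ℚ.< γ →
    ℕtoℚ (480 * r) ℚ.≤ γ ℚ.* ℕtoℚ n → γ ℚ.* ℕtoℚ n ℚ.≤ ℕtoℚ (528 * r) →
    ∀ u → ∃[ B ] ℕtoℚ (countF B) ℚ.≤ γ ℚ.* ℕtoℚ n × ∃[ v ]
      (∀ i j → B i ≡ false → B j ≡ false → adj v i j ≡ adj u i j) × FarEstimates γ (adj v) k
  attack-of-sizes {n} {k} {r} {γ = γ} S 0<γ 480r≤γn γn≤528r u = O.corrupted
    , ℚₚ.≤-trans (ι-mono-≤ {countF O.corrupted} {480 * r}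
        (≤-trans (≤-reflexive O.|corrupted|) (*-monoˡ-≤ r (m≤m+n 48 432)))) 480r≤γn
    , O.attack , O.local , far-estimates S 0<γ γn≤528r (adj O.attack) O.far
    where module O = Outcome (outcome S u)

  module _ (n : ℕ) (γ c : ℚ) (2≤n : 2 ≤ n) (0<γ : 0ℚ ℚ.< γ) (γ≤1 : γ ℚ.≤ 1ℚ)
    (γ-large : LnLt n (γ ℚ.* γ ℚ.* ℕtoℚ n ℚ.* (+ 1 ℚ./ 10000)))
    (0<c : 0ℚ ℚ.< c) (cγ<¼ : c ℚ.* γ ℚ.< (+ 1) ℚ./ 4) where

    open Parameters n γ c 2≤n 0<γ γ≤1 γ-large 0<c cγ<¼

    attack-many : Conclusion n γ c
    attack-many = adversary n γ c
      (attack-of-sizes {n} {k} {r} {proj₁ sizes} {proj₁ (proj₂ sizes)} {γ} (proj₂ (proj₂ sizes)) 0<γ 480r≤γn γn≤528r)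

  attack-exists : ∀ n (γ c : ℚ) → 1 ≤ n → 0ℚ ℚ.< γ → γ ℚ.≤ 1ℚ →
    LnLt n (γ ℚ.* γ ℚ.* ℕtoℚ n ℚ.* (+ 1 ℚ./ 10000)) → 0ℚ ℚ.< c → c ℚ.* γ ℚ.< + 1 ℚ./ 4 →
    Conclusion n γ c
  attack-exists n γ c 1≤n 0<γ γ≤1 γ-large 0<c cγ<¼ = by-size (m≤n⇒m<n∨m≡n 1≤n)
    where
    -- For `n = 1` the logarithm is 0, so `γ-large` yields no constant lower bound on γ²n, and this
    -- case is settled separately.
    by-size : 2 ≤ n ⊎ 1 ≡ n → Conclusion n γ c
    by-size (inj₁ 2≤n)  = attack-many n γ c 2≤n 0<γ γ≤1 γ-large 0<c cγ<¼
    by-size (inj₂ 1≡n) = subst (λ n → Conclusion n γ c) 1≡n (single-vertex γ c 0<γ γ≤1)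

open import Data.Bool using (_∧_)
open import Data.Nat using (ℕ; _≤_)
open import Data.Integer using (+_)
open import Data.Rational using (ℚ; 0ℚ; 1ℚ; _<_; _*_; _-_; _/_; ∣_∣) renaming (_≤_ to _≤ℚ_)
open import Data.Product using (∃; _×_)

theorem3p4 : ∃ λ (C′ : ℚ) → 0ℚ < C′ ×
    ((n : ℕ) (γ c : ℚ) →
    1 ≤ n → 0ℚ < γ → γ ≤ℚ 1ℚ →
    LnLt n (γ * γ * ℕtoℚ n * ((+ 1) / 10000)) →
    0ℚ < c → c * γ < (+ 1) / 4 →
    ∃ λ (A : Adversary n γ) →
    ProbAtLeast n
    (λ u →
    ((C′ * γ) ≤Q ∣ medianEst (adj (Adversary.attack A u)) (pruneCount n c γ) - (+ 1) / 2 ∣)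
    ∧ ((C′ * (γ * γ)) ≤Q ∣ meanEst (adj (Adversary.attack A u)) (pruneCount n c γ) - (+ 1) / 2 ∣))
    99 100)
theorem3p4 = Pruning.C′ , Pruning.0<C′ , Pruning.attack-exists
  where open import Data.Product using (_,_)
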